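{- Let $M_1,M_2$ be matroids on the same ground set $E$ with $n$ elements, and let $J_k$ be the number of pairs $(I_1,I_2)$, where $I_1$ is an independent set of $M_1$ and $I_2$ is an independent set of $M_2$, such that $I_1\subseteq I_2$ and $|I_2\setminus I_1|=k$. Then for every integer $k$ with $0\leq k\leq n-2$, $$\frac{J_k}{\binom{n}{k}}\cdot \frac{J_{k+2}}{\binom{n}{k+2}}\leq \left(\frac{J_{k+1}}{\binom{n}{k+1}}\right)^2.$$
   Context: Matroids are finite matroids in the usual sense. -}

module Defs where

open import Level using (0ℓ)
open import Data.Fin.Base using (Fin)
open import Data.Fin.Subset
  using (Subset; inside; outside; ⊥; ⁅_⁆; _∈_; _∉_; _⊆_; _∪_; _─_; ∣_∣)
open import Data.Fin.Subset.Properties using (_⊆?_)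
open import Data.Integer.Base using (+_)
open import Data.List.Base
  using (List; []; _∷_; _++_; map; filter; length; cartesianProduct)
open import Data.Nat.Base using (ℕ; zero; suc; _<_; _≤_; NonZero; _!; _∸_; _*_; >-nonZero)
open import Data.Nat.Combinatorics using (_C_; nCk≡n!/k![n-k]!; [n∸k]!k!∣n!)
open import Data.Nat.Divisibility using (∣⇒≤; _∣_)
open import Data.Nat.DivMod using (m≥n⇒m/n>0)
open import Data.Nat.Properties using (_≟_; _!≢0; _!*_!≢0; *-comm)
open import Data.Product.Base using (∃; _×_; _,_)
open import Data.Rational.Base using (ℚ; _/_)
import Data.Vec.Base as Vec
open import Relation.Binary.PropositionalEquality using (_≡_; sym; subst)
open import Relation.Nullary.Decidable using (_×-dec_)
open import Relation.Unary using (Pred; Decidable)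

-- A matroid on the ground set Fin n, given by its independent sets.
-- Decidability of independence is automatic classically; it is what makes
-- counting independent sets meaningful here.
record Matroid (n : ℕ) : Set₁ where
  field
    Independent  : Pred (Subset n) 0ℓ
    independent? : Decidable Independent
    empty        : Independent ⊥
    hereditary   : ∀ {I J} → I ⊆ J → Independent J → Independent I
    augmentation : ∀ {I J} → Independent I → Independent J → ∣ I ∣ < ∣ J ∣ →
                   ∃ λ (x : Fin n) → x ∈ J × x ∉ I × Independent (I ∪ ⁅ x ⁆)

open Matroid public

subsets : (n : ℕ) → List (Subset n)
subsets zero    = Vec.[] ∷ []
subsets (suc n) = map (outside Vec.∷_) (subsets n) ++ map (inside Vec.∷_) (subsets n)

module _ {n : ℕ} (M₁ M₂ : Matroid n) where

  NestedPair : ℕ → Pred (Subset n × Subset n) 0ℓ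
  NestedPair k (I₁ , I₂) =
    Independent M₁ I₁ × Independent M₂ I₂ × I₁ ⊆ I₂ × ∣ I₂ ─ I₁ ∣ ≡ k

  nestedPair? : (k : ℕ) → Decidable (NestedPair k)
  nestedPair? k (I₁ , I₂) =
    independent? M₁ I₁ ×-dec independent? M₂ I₂ ×-dec I₁ ⊆? I₂ ×-dec ∣ I₂ ─ I₁ ∣ ≟ k

  J : ℕ → ℕ
  J k = length (filter (nestedPair? k) (cartesianProduct (subsets n) (subsets n)))

nCk-nonZero : ∀ {n k} → k ≤ n → NonZero (n C k)
nCk-nonZero {n} {k} k≤n =
  subst NonZero (sym (nCk≡n!/k![n-k]! k≤n)) (>-nonZero (m≥n⇒m/n>0 (∣⇒≤ k![n∸k]!∣n!)))
  where
  instance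
    _ = n !≢0
    _ = k !* (n ∸ k) !≢0
  k![n∸k]!∣n! : k ! * (n ∸ k) ! ∣ n !
  k![n∸k]!∣n! = subst (_∣ n !) (*-comm ((n ∸ k) !) (k !)) ([n∸k]!k!∣n! k≤n)

-- The bound k ≤ n only serves to make the denominator nonzero.
J/C : ∀ {n} (M₁ M₂ : Matroid n) (k : ℕ) → .(k ≤ n) → ℚ
J/C {n} M₁ M₂ k k≤n = _/_ (+ J M₁ M₂ k) (n C k) {{nCk-nonZero k≤n}}

{-# OPTIONS --safe #-}
-- The polynomial f₂ = Σ y^(n−|I₂|) x^I₂ over the independent sets of M₂ and the polynomial
-- f₁ = Σ y^|I₁| x^(E∖I₁) over those of M₁ are Lorentzian: their second-order parts, left over after
-- differentiating down to degree two, have at most one positive direction by the exchange property.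
-- This is propagated from degree d to degree d + 1 by a Bochner-type argument on weighted graphs (no
-- eigenvalues are needed, so everything takes place over ℚ), and it passes to the product P of f₁ and f₂
-- in disjoint variables. Differentiating P once along x_e + x′_e for every e, a times along y + y′ and
-- k times along Σ (x_e + x′_e), where a + k = n, gives 2^k k! a! J_k, so that the claim is the
-- Alexandrov–Fenchel inequality for P.

module Submission where

open import Algebra.Bundles using (CommutativeRing)
open import Data.Bool.Properties using (∨-identityʳ)
open import Data.Empty using (⊥; ⊥-elim)
open import Data.Fin.Base using (Fin; zero; suc; splitAt; join; _↑ˡ_; _↑ʳ_)
open import Data.Fin.Properties as FinP
  using (any?; splitAt-↑ˡ; splitAt-↑ʳ; splitAt-join; join-splitAt)
open import Data.Fin.Subset
  using (Subset; inside; outside; _∈_; _∉_; _⊆_; _∪_; _∩_; _─_; ∁; ⁅_⁆; ∣_∣)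
  renaming (⊥ to ∅; ⊤ to ⊤ˢ)
open import Data.Fin.Subset.Properties
open import Data.Integer.Base as ℤ using () renaming (+_ to pos)
import Data.Integer.Properties as ℤP
open import Data.List.Base
  using (List; []; _∷_; _++_; length; map; filter; cartesianProduct; foldr; replicate)
open import Data.List.Properties as ListP using (++-assoc; ++-identityʳ)
open import Data.List.Relation.Unary.All as All using (All; []; _∷_)
import Data.List.Relation.Unary.All.Properties as All
open import Data.Maybe.Base using (Maybe; just; nothing)
open import Data.Nat.Base as ℕ using (ℕ; zero; suc; _!; _^_)
open import Data.Nat.Combinatorics renaming (_C_ to _choose_) using (nCk≡n!/k![n-k]!; [n∸k]!k!∣n!)
open import Data.Nat.DivMod using (m/n*n≡m)
open import Data.Nat.Divisibility using (_∣_)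
open import Data.Nat.Properties as ℕP
  using (m+n≤o⇒n≤o; _!*_!≢0; +-suc; suc-injective; ≰⇒>; ∸-monoʳ-<; n≤1+n; m≤m+n; m+n∸m≡n; m+[n∸m]≡n; +-cancelˡ-≡; +-cancelʳ-≡; +-cancelʳ-≤; +-cancelˡ-≤)
open import Data.Nat.Tactic.RingSolver using () renaming (solve-∀ to ℕ-solve-∀)
open import Data.Product.Base using (∃; _×_; _,_; proj₁; proj₂)
open import Data.Rational.Base
  using (ℚ; 0ℚ; 1ℚ; _+_; _*_; -_; _-_; _≤_; _<_; 1/_; _/_; toℚᵘ; ≢-nonZero; nonNegative; positive)
open import Data.Rational.Properties as ℚP
  using (*-zeroˡ; *-zeroʳ; *-identityˡ; *-identityʳ; *-comm; *-assoc; <⇒≤; +-identityˡ; +-identityʳ; positive⁻¹; nonNegative⁻¹; <⇒≢; *-distribˡ-+)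
open import Data.Rational.Solver using (module +-*-Solver)
open import Data.Rational.Unnormalised.Base as ℚᵘ using (mkℚᵘ; *≡*)
import Data.Rational.Unnormalised.Properties as ℚᵘP
open import Data.Sum.Base as Sum using (_⊎_; inj₁; inj₂)
open import Data.Unit.Base using (⊤; tt)
open import Data.Vec.Base using (_∷_; []; here; there)
open import Defs
open import Function.Base using (_∘_)
open import Relation.Binary.Definitions using (tri<; tri≈; tri>)
open import Relation.Binary.PropositionalEquality
  using (_≡_; _≢_; refl; sym; trans; cong; cong₂; subst; subst₂; module ≡-Reasoning)
open import Relation.Nullary using (¬_; Dec; yes; no; contradiction)
open import Relation.Nullary.Decidable using (¬?; _×-dec_; decidable-stable)
open import Relation.Unary using (Decidable)
open import Algebra.Properties.Semiring.Sum (CommutativeRing.semiring ℚP.+-*-commutativeRing)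
  using (sum; sum-cong-≗; *-distribˡ-sum; *-distribʳ-sum; ∑-distrib-+; ∑-comm; sum-replicate-zero)
open import Algebra.Properties.Semiring.Mult (CommutativeRing.semiring ℚP.+-*-commutativeRing)
  using (×-homo-+; ×1-homo-*) renaming (_×_ to _·_)
open +-*-Solver using (solve; _:=_; _:+_; _:*_; :-_; _:-_; con)

-- The complement enters f₁ because I₁ ⊆ I₂ holds exactly when E∖I₁ and I₂ together cover E. The
-- derivatives along x_e + x′_e demand such a cover, and each element of I₂∖I₁ may be charged to
-- either factor: this is the 2^k. The remaining k + a derivatives match the degree only if |I₂∖I₁|
-- = k, and k! a! = n!/C(n,k) is the binomial normalisation.
--
-- For the Bochner argument let Q be a contraction of third derivatives, D its degree matrix and A =
-- D⁻¹Q. Positivity of the Laplacian D - Q bounds the eigenvalues of A by 1, and connectedness makes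
-- 1 simple. The inequalities for the slices sum to A² ≥ A, which excludes eigenvalues strictly
-- between 0 and 1; a single positive one is left. Over ℚ the Fredholm alternative for D - Q takes
-- the place of diagonalisation.
--
-- The argument needs strictly positive directions of differentiation, whereas those used at the end
-- have zero coordinates. A limit is therefore taken, and it concerns only a quadratic polynomial in
-- ε.

private variable
  m n : ℕ

-- Inequalities between rational numbers

2ℚ : ℚ
2ℚ = 1ℚ + 1ℚ

≤-from : ∀ {a b c} → 0ℚ ≤ c → c ≡ b - a → a ≤ b
≤-from {a} {b} {c} 0≤c c≡ = subst₂ _≤_ (+-identityʳ a) (trans (cong (a +_) c≡) (solve 2 (λ a b → a :+ (b :- a) := b) refl a b)) (ℚP.+-monoʳ-≤ a 0≤c)

≤⇒0≤- : ∀ {a b} → a ≤ b → 0ℚ ≤ b - a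
≤⇒0≤- {a} {b} a≤b = subst (_≤ b - a) (ℚP.+-inverseʳ a) (ℚP.+-monoˡ-≤ (- a) a≤b)

0≤+ : ∀ {a b} → 0ℚ ≤ a → 0ℚ ≤ b → 0ℚ ≤ a + b
0≤+ = ℚP.+-mono-≤

0≤* : ∀ {a b} → 0ℚ ≤ a → 0ℚ ≤ b → 0ℚ ≤ a * b
0≤* {a} {b} p q = nonNegative⁻¹ (a * b) {{ℚP.nonNeg*nonNeg⇒nonNeg a {{nonNegative p}} b {{nonNegative q}}}}

*-≡0ˡ : ∀ {p} q → p ≡ 0ℚ → p * q ≡ 0ℚ
*-≡0ˡ q refl = *-zeroˡ q

*-≡0ʳ : ∀ p {q} → q ≡ 0ℚ → p * q ≡ 0ℚ
*-≡0ʳ p refl = *-zeroʳ p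

0<* : ∀ {a b} → 0ℚ < a → 0ℚ < b → 0ℚ < a * b
0<* {a} {b} p q = positive⁻¹ (a * b) {{ℚP.pos*pos⇒pos a {{positive p}} b {{positive q}}}}

0<+ : ∀ {a b} → 0ℚ < a → 0ℚ ≤ b → 0ℚ < a + b
0<+ = ℚP.+-mono-<-≤

0≤² : ∀ a → 0ℚ ≤ a * a
0≤² a with ℚP.≤-total 0ℚ a
... | inj₁ p = 0≤* p p
... | inj₂ p = subst (0ℚ ≤_) (solve 1 (λ a → (:- a) :* (:- a) := a :* a) refl a) (0≤* (ℚP.neg-antimono-≤ p) (ℚP.neg-antimono-≤ p))

≤∧≢⇒< : ∀ {a b} → a ≤ b → a ≢ b → a < b
≤∧≢⇒< {a} {b} a≤b a≢b with ℚP.<-cmp a b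
... | tri< p _ _ = p
... | tri≈ _ p _ = contradiction p a≢b
... | tri> _ _ p = contradiction (ℚP.≤-antisym a≤b (<⇒≤ p)) a≢b

0<² : ∀ {a} → a ≢ 0ℚ → 0ℚ < a * a
0<² {a} a≢0 with ℚP.<-cmp 0ℚ a
... | tri< p _ _ = 0<* p p
... | tri≈ _ p _ = contradiction (sym p) a≢0
... | tri> _ _ p = subst (0ℚ <_) (solve 1 (λ a → (:- a) :* (:- a) := a :* a) refl a) (0<* (ℚP.neg-antimono-< p) (ℚP.neg-antimono-< p))

cancel-≤ : ∀ {r a b} → 0ℚ < r → r * a ≤ r * b → a ≤ b
cancel-≤ {r} p = ℚP.*-cancelˡ-≤-pos r {{positive p}}

-- Linear algebra over ℚ

sum-+ : (f g : Fin n → ℚ) → sum (λ i → f i + g i) ≡ sum f + sum g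
sum-+ = ∑-distrib-+

sum-* : (c : ℚ) (f : Fin n → ℚ) → sum (λ i → c * f i) ≡ c * sum f
sum-* c f = sym (*-distribˡ-sum c f)

sum-linear : (a b : ℚ) (f g : Fin n → ℚ) → sum (λ i → a * f i + b * g i) ≡ a * sum f + b * sum g
sum-linear a b f g = trans (sum-+ (λ i → a * f i) (λ i → b * g i)) (cong₂ _+_ (sum-* a f) (sum-* b g))

sum-minus : (f g : Fin n → ℚ) → sum (λ i → f i - g i) ≡ sum f - sum g
sum-minus f g = trans (sum-cong-≗ λ i → solve 2 (λ a b → a :- b := con 1ℚ :* a :+ (:- con 1ℚ) :* b) refl (f i) (g i))
  (trans (sum-linear 1ℚ (- 1ℚ) f g) (solve 2 (λ a b → con 1ℚ :* a :+ (:- con 1ℚ) :* b := a :- b) refl (sum f) (sum g)))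

sum-swap : (f : Fin m → Fin n → ℚ) → sum (λ i → sum (f i)) ≡ sum (λ j → sum (λ i → f i j))
sum-swap f = ∑-comm f

sum-zero : {f : Fin n → ℚ} → (∀ i → f i ≡ 0ℚ) → sum f ≡ 0ℚ
sum-zero {n} f≡0 = trans (sum-cong-≗ f≡0) (sum-replicate-zero n)

nonzero? : (f : Fin n → ℚ) → (∃ λ i → f i ≢ 0ℚ) ⊎ (∀ i → f i ≡ 0ℚ)
nonzero? f with any? (λ i → ¬? (f i ℚP.≟ 0ℚ))
... | yes p = inj₁ p
... | no ∄  = inj₂ λ i → decidable-stable (f i ℚP.≟ 0ℚ) λ ≢0 → ∄ (i , ≢0)

sum-≢0 : (f : Fin n → ℚ) → sum f ≢ 0ℚ → ∃ λ i → f i ≢ 0ℚ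
sum-≢0 f s≢0 = Sum.fromInj₁ (λ f≡0 → contradiction (sum-zero f≡0) s≢0) (nonzero? f)

sum-0≤ : {f : Fin n → ℚ} → (∀ i → 0ℚ ≤ f i) → 0ℚ ≤ sum f
sum-0≤ {zero}  _ = ℚP.≤-refl
sum-0≤ {suc n} p = 0≤+ (p zero) (sum-0≤ (λ i → p (suc i)))

term≤sum : {f : Fin n → ℚ} → (∀ i → 0ℚ ≤ f i) → ∀ i → f i ≤ sum f
term≤sum {f = f} p zero    = subst (_≤ sum f) (+-identityʳ (f zero)) (ℚP.+-monoʳ-≤ (f zero) (sum-0≤ (λ i → p (suc i))))
term≤sum {f = f} p (suc i) = subst (_≤ sum f) (+-identityˡ (f (suc i))) (ℚP.+-mono-≤ (p zero) (term≤sum (λ i → p (suc i)) i))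

sum-0< : {f : Fin n → ℚ} → (∀ i → 0ℚ ≤ f i) → ∀ i → 0ℚ < f i → 0ℚ < sum f
sum-0< p i q = ℚP.<-≤-trans q (term≤sum p i)

sum-mono : {f g : Fin n → ℚ} → (∀ i → f i ≤ g i) → sum f ≤ sum g
sum-mono {zero}  _ = ℚP.≤-refl
sum-mono {suc n} p = ℚP.+-mono-≤ (p zero) (sum-mono (λ i → p (suc i)))

δ : Fin n → Fin n → ℚ
δ zero    zero    = 1ℚ
δ zero    (suc j) = 0ℚ
δ (suc i) zero    = 0ℚ
δ (suc i) (suc j) = δ i j

sum-δ : (p : Fin n) (f : Fin n → ℚ) → sum (λ i → δ p i * f i) ≡ f p
sum-δ zero f = trans (cong₂ _+_ (*-identityˡ (f zero)) (sum-zero λ i → *-zeroˡ (f (suc i)))) (+-identityʳ (f zero))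
sum-δ (suc p) f = trans (cong₂ _+_ (*-zeroˡ (f zero)) (sum-δ p (λ i → f (suc i)))) (+-identityˡ (f (suc p)))

Vect : ℕ → Set
Vect n = Fin n → ℚ

Matrix : ℕ → ℕ → Set
Matrix m n = Fin m → Fin n → ℚ

dot : Vect n → Vect n → ℚ
dot x y = sum (λ i → x i * y i)

app : Matrix m n → Vect n → Vect m
app M x i = dot (M i) x

bil : Matrix n n → Vect n → Vect n → ℚ
bil M x y = dot x (app M y)

comb : ℚ → ℚ → Vect n → Vect n → Vect n
comb a b x y i = a * x i + b * y i

dot-cong : {x x′ y y′ : Vect n} → (∀ i → x i ≡ x′ i) → (∀ i → y i ≡ y′ i) → dot x y ≡ dot x′ y′
dot-cong p q = sum-cong-≗ (λ i → cong₂ _*_ (p i) (q i))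

dot-comm : (x y : Vect n) → dot x y ≡ dot y x
dot-comm x y = sum-cong-≗ (λ i → *-comm (x i) (y i))

dot-combʳ : (z : Vect n) (a b : ℚ) (x y : Vect n) → dot z (comb a b x y) ≡ a * dot z x + b * dot z y
dot-combʳ z a b x y = trans
  (sum-cong-≗ (λ i → solve 5 (λ z a b x y → z :* (a :* x :+ b :* y) := a :* (z :* x) :+ b :* (z :* y)) refl (z i) a b (x i) (y i)))
  (sum-linear a b (λ i → z i * x i) (λ i → z i * y i))

dot-combˡ : (a b : ℚ) (x y z : Vect n) → dot (comb a b x y) z ≡ a * dot x z + b * dot y z
dot-combˡ a b x y z = trans (dot-comm (comb a b x y) z)
  (trans (dot-combʳ z a b x y) (cong₂ (λ s t → a * s + b * t) (dot-comm z x) (dot-comm z y)))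

bil-comm : {M : Matrix n n} → (∀ i j → M i j ≡ M j i) → ∀ x y → bil M x y ≡ bil M y x
bil-comm {M = M} M-sym x y = begin
  sum (λ i → x i * sum (λ j → M i j * y j))  ≡⟨ sum-cong-≗ (λ i → sym (sum-* (x i) (λ j → M i j * y j))) ⟩
  sum (λ i → sum (λ j → x i * (M i j * y j))) ≡⟨ sum-swap (λ i j → x i * (M i j * y j)) ⟩
  sum (λ j → sum (λ i → x i * (M i j * y j))) ≡⟨ sum-cong-≗ (λ j → trans (sum-cong-≗ (λ i → trans (cong (λ q → x i * (q * y j)) (M-sym i j)) (solve 3 (λ x m y → x :* (m :* y) := y :* (m :* x)) refl (x i) (M j i) (y j)))) (sum-* (y j) (λ i → M j i * x i))) ⟩
  sum (λ j → y j * sum (λ i → M j i * x i)) ∎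
  where open ≡-Reasoning

bil-combˡ : (M : Matrix n n) (a b : ℚ) (x y z : Vect n) → bil M (comb a b x y) z ≡ a * bil M x z + b * bil M y z
bil-combˡ M a b x y z = dot-combˡ a b x y (app M z)

bil-combʳ : (M : Matrix n n) (z : Vect n) (a b : ℚ) (x y : Vect n) → bil M z (comb a b x y) ≡ a * bil M z x + b * bil M z y
bil-combʳ M z a b x y = trans
  (sum-cong-≗ (λ i → cong (z i *_) (dot-combʳ (M i) a b x y)))
  (dot-combʳ z a b (app M x) (app M y))

bil-square : {M : Matrix n n} → (∀ i j → M i j ≡ M j i) → ∀ a b x y →
  bil M (comb a b x y) (comb a b x y) ≡ a * a * bil M x x + 2ℚ * (a * b * bil M x y) + b * b * bil M y y
bil-square {M = M} M-sym a b x y = begin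
  bil M (comb a b x y) (comb a b x y) ≡⟨ bil-combˡ M a b x y (comb a b x y) ⟩
  a * bil M x (comb a b x y) + b * bil M y (comb a b x y) ≡⟨ cong₂ (λ s t → a * s + b * t) (bil-combʳ M x a b x y) (trans (bil-combʳ M y a b x y) (cong (λ q → a * q + b * bil M y y) (bil-comm M-sym y x))) ⟩
  a * (a * bil M x x + b * bil M x y) + b * (a * bil M x y + b * bil M y y) ≡⟨ solve 5 (λ a b X Z Y → a :* (a :* X :+ b :* Z) :+ b :* (a :* Z :+ b :* Y) := a :* a :* X :+ con 2ℚ :* (a :* b :* Z) :+ b :* b :* Y)
      refl a b (bil M x x) (bil M x y) (bil M y y) ⟩
  a * a * bil M x x + 2ℚ * (a * b * bil M x y) + b * b * bil M y y ∎
  where open ≡-Reasoning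

private
  dot-pivotˡ : (z : Vect n) (t : ℚ) (p : Fin n) (g : Vect n) → dot (λ i → z i - t * δ p i) g ≡ dot z g - t * g p
  dot-pivotˡ z t p g = trans
    (sum-cong-≗ λ i → solve 4 (λ z t d g → (z :- t :* d) :* g := z :* g :- t :* (d :* g)) refl (z i) t (δ p i) (g i))
    (trans (sum-minus (λ i → z i * g i) (λ i → t * (δ p i * g i)))
      (cong (λ q → dot z g - q) (trans (sum-* t (λ i → δ p i * g i)) (cong (t *_) (sum-δ p g)))))

  dot-pivotʳ : (z g r : Vect n) (h : ℚ) → dot z (λ i → g i - r i * h) ≡ dot z g - dot z r * h
  dot-pivotʳ z g r h = trans
    (sum-cong-≗ λ i → solve 4 (λ z g r h → z :* (g :- r :* h) := z :* g :- z :* r :* h) refl (z i) (g i) (r i) h)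
    (trans (sum-minus (λ i → z i * g i) (λ i → z i * r i * h)) (cong (λ q → dot z g - q) (sym (*-distribʳ-sum h (λ i → z i * r i)))))

-- Gaussian elimination on the first column.
fredholm : ∀ n {m} (M : Matrix m n) (y : Vect m) →
  (∃ λ x → ∀ i → app M x i ≡ y i) ⊎
  (∃ λ z → (∀ j → dot z (λ i → M i j) ≡ 0ℚ) × dot z y ≢ 0ℚ)
fredholm zero M y with nonzero? y
... | inj₁ (p , y≢0) = inj₂ (δ p , (λ ()) , λ e → y≢0 (trans (sym (sum-δ p y)) e))
... | inj₂ y≡0 = inj₁ ((λ ()) , λ i → sym (y≡0 i))
fredholm (suc n) M y with nonzero? (λ i → M i zero)
... | inj₂ column≡0 = extend (fredholm n (λ i j → M i (suc j)) y)
  where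
  extend : _ ⊎ _ → _
  extend (inj₁ (x , Mx≡y)) = inj₁ (x⁺ , λ i → trans (cong₂ _+_ (*-zeroʳ (M i zero)) (Mx≡y i)) (+-identityˡ (y i)))
    where
    x⁺ : Vect (suc n)
    x⁺ zero    = 0ℚ
    x⁺ (suc j) = x j
  extend (inj₂ (z , zM≡0 , zy≢0)) = inj₂ (z , zM≡0⁺ , zy≢0)
    where
    zM≡0⁺ : ∀ j → dot z (λ i → M i j) ≡ 0ℚ
    zM≡0⁺ zero    = sum-zero λ i → *-≡0ʳ (z i) (column≡0 i)
    zM≡0⁺ (suc j) = zM≡0 j
... | inj₁ (p , c≢0) = extend (fredholm n M′ y′)
  where
  instance _ = ≢-nonZero c≢0
  c = M p zero
  r : Vect _
  r i = M i zero * 1/ c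
  N M′ : Matrix _ n
  N i j = M i (suc j)
  M′ i j = N i j - r i * N p j
  y′ : Vect _
  y′ i = y i - r i * y p
  rc : ∀ i → r i * c ≡ M i zero
  rc i = trans (*-assoc (M i zero) (1/ c) c) (trans (cong (M i zero *_) (ℚP.*-inverseˡ c)) (*-identityʳ (M i zero)))
  extend : _ ⊎ _ → _
  extend (inj₁ (x , M′x≡y′)) = inj₁ (x⁺ , solves)
    where
    open ≡-Reasoning
    S = app N x p
    x⁺ : Vect (suc n)
    x⁺ zero    = 1/ c * (y p - S)
    x⁺ (suc j) = x j
    row : ∀ i → app M′ x i ≡ app N x i - r i * S
    row i = trans
      (sum-cong-≗ λ j → solve 4 (λ a r b x → (a :- r :* b) :* x := a :* x :- r :* (b :* x)) refl (N i j) (r i) (N p j) (x j))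
      (trans (sum-minus (λ j → N i j * x j) (λ j → r i * (N p j * x j))) (cong (λ q → app N x i - q) (sum-* (r i) (λ j → N p j * x j))))
    solves : ∀ i → app M x⁺ i ≡ y i
    solves i = begin
      M i zero * (1/ c * (y p - S)) + app N x i ≡⟨ solve 5 (λ a b y s t → a :* (b :* (y :- s)) :+ t := (t :- (a :* b) :* s) :+ (a :* b) :* y) refl (M i zero) (1/ c) (y p) S (app N x i) ⟩
      (app N x i - r i * S) + r i * y p ≡⟨ cong (_+ r i * y p) (trans (sym (row i)) (M′x≡y′ i)) ⟩
      (y i - r i * y p) + r i * y p ≡⟨ solve 2 (λ a b → (a :- b) :+ b := a) refl (y i) (r i * y p) ⟩
      y i ∎
  extend (inj₂ (z , zM≡0 , zy≢0)) = inj₂ (z⁺ , zM≡0⁺ , λ e → zy≢0 (trans (dot-pivotʳ z y r (y p)) (trans (sym (dot-pivotˡ z t p y)) e)))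
    where
    open ≡-Reasoning
    t = dot z r
    z⁺ : Vect _
    -- Row `i` of `M′` is row `i` minus `r i` times row `p`, so a combination `z` of the reduced
    -- rows is one of the original rows after `dot z r` has been subtracted at `p`.
    z⁺ i = z i - t * δ p i
    zM≡0⁺ : ∀ j → dot z⁺ (λ i → M i j) ≡ 0ℚ
    zM≡0⁺ zero = begin
      dot z⁺ (λ i → M i zero) ≡⟨ dot-pivotˡ z t p (λ i → M i zero) ⟩
      dot z (λ i → M i zero) - t * c ≡⟨ cong (_- t * c) (trans (sum-cong-≗ (λ i → trans (cong (z i *_) (sym (rc i))) (solve 3 (λ z r c → z :* (r :* c) := c :* (z :* r)) refl (z i) (r i) c))) (sum-* c (λ i → z i * r i))) ⟩
      c * t - t * c ≡⟨ solve 2 (λ c t → c :* t :- t :* c := con 0ℚ) refl c t ⟩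
      0ℚ ∎
    zM≡0⁺ (suc j) = trans (dot-pivotˡ z t p (λ i → N i j)) (trans (sym (dot-pivotʳ z (λ i → N i j) r (N p j))) (zM≡0 j))

-- Quadratic forms with one positive direction

-- The reversed Cauchy-Schwarz inequality. For a symmetric nonnegative matrix it expresses at most
-- one positive direction without eigenvalues, and it is a closed condition, which the limit
-- argument exploits.
Hyperbolic : Matrix n n → Set
Hyperbolic M = ∀ x y → (∀ i → 0ℚ ≤ y i) → bil M x x * bil M y y ≤ bil M x y * bil M x y

bil-0≤ : {M : Matrix n n} → (∀ i j → 0ℚ ≤ M i j) → ∀ {x y} → (∀ i → 0ℚ ≤ x i) → (∀ i → 0ℚ ≤ y i) → 0ℚ ≤ bil M x y
bil-0≤ M≥0 x≥0 y≥0 = sum-0≤ λ i → 0≤* (x≥0 i) (sum-0≤ λ j → 0≤* (M≥0 i j) (y≥0 j))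

-- The vector `α x − β y` is orthogonal to `u`, so the form is nonpositive there; multiplying the
-- expansion by `Y ≥ 0` and completing the square gives `α²` times the claim. If `α = 0`, then `y`
-- itself is orthogonal to `u`, which forces `Y = 0`.
hyperbolic-criterion : (M : Matrix n n) → (∀ i j → M i j ≡ M j i) → (∀ i j → 0ℚ ≤ M i j) →
  (u : Vect n) → (∀ x → dot u x ≡ 0ℚ → bil M x x ≤ 0ℚ) → Hyperbolic M
hyperbolic-criterion M M-sym M≥0 u neg x y y≥0 = go (Y ℚP.≟ 0ℚ)
  where
  X = bil M x x
  Y = bil M y y
  Z = bil M x y
  α = dot u y
  β = dot u x
  go : Dec (Y ≡ 0ℚ) → X * Y ≤ Z * Z
  go (yes Y≡0) = subst (_≤ Z * Z) (sym (*-≡0ʳ X Y≡0)) (0≤² Z)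
  go (no Y≢0) = cancel-≤ (0<² α≢0) (≤-from (0≤+ (0≤² (α * Z - β * Y)) (0≤* Y≥0 (≤⇒0≤- P≤0)))
    (solve 5 (λ a b X Y Z → (a :* Z :- b :* Y) :* (a :* Z :- b :* Y) :+ Y :* (con 0ℚ :- (a :* a :* X :+ con 2ℚ :* (a :* (:- b) :* Z) :+ (:- b) :* (:- b) :* Y))
       := a :* a :* (Z :* Z) :- a :* a :* (X :* Y)) refl α β X Y Z))
    where
    Y≥0 : 0ℚ ≤ Y
    Y≥0 = bil-0≤ M≥0 y≥0 y≥0
    α≢0 : α ≢ 0ℚ
    α≢0 α≡0 = Y≢0 (ℚP.≤-antisym (neg y α≡0) Y≥0)
    p = comb α (- β) x y
    up≡0 : dot u p ≡ 0ℚ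
    up≡0 = trans (dot-combʳ u α (- β) x y) (solve 2 (λ a b → a :* b :+ (:- b) :* a := con 0ℚ) refl α β)
    P≤0 : α * α * X + 2ℚ * (α * (- β) * Z) + (- β) * (- β) * Y ≤ 0ℚ
    P≤0 = subst (_≤ 0ℚ) (bil-square M-sym α (- β) x y) (neg p up≡0)

-- 1/q, with the junk value 0 at q = 0.
recip : ℚ → ℚ
recip q with q ℚP.≟ 0ℚ
... | yes _  = 0ℚ
... | no q≢0 = (1/ q) {{≢-nonZero q≢0}}

recip-0≤ : ∀ {q} → 0ℚ ≤ q → 0ℚ ≤ recip q
recip-0≤ {q} q≥0 with q ℚP.≟ 0ℚ
... | yes _  = ℚP.≤-refl
... | no q≢0 = <⇒≤ (positive⁻¹ _ {{ℚP.1/pos⇒pos q {{positive (≤∧≢⇒< q≥0 (λ e → q≢0 (sym e)))}}}})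

recip-inverse : ∀ {q} → q ≢ 0ℚ → recip q * q ≡ 1ℚ
recip-inverse {q} q≢0 with q ℚP.≟ 0ℚ
... | yes q≡0 = contradiction q≡0 q≢0
... | no q≢0′ = ℚP.*-inverseˡ q {{≢-nonZero q≢0′}}

recip-cancel : ∀ q {a} → (q ≡ 0ℚ → a ≡ 0ℚ) → recip q * q * a ≡ a
recip-cancel q {a} h = go (q ℚP.≟ 0ℚ)
  where
  go : Dec (q ≡ 0ℚ) → recip q * q * a ≡ a
  go (yes q≡0) = trans (cong (recip q * q *_) (h q≡0)) (trans (*-zeroʳ (recip q * q)) (sym (h q≡0)))
  go (no q≢0)  = trans (cong (_* a) (recip-inverse q≢0)) (*-identityˡ a)

-- Weighted graphs and the Bochner step

sum-0≤-≡0 : {f : Fin n → ℚ} → (∀ i → 0ℚ ≤ f i) → sum f ≡ 0ℚ → ∀ i → f i ≡ 0ℚ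
sum-0≤-≡0 {f = f} f≥0 s≡0 i = decidable-stable (f i ℚP.≟ 0ℚ) λ fi≢0 →
  <⇒≢ (sum-0< f≥0 i (≤∧≢⇒< (f≥0 i) (λ e → fi≢0 (sym e)))) (sym s≡0)

-- Non-isolated vertices are at distance at most two. Asking for this instead of connectedness
-- avoids paths, and it is what the exchange arguments deliver.
Connected : Matrix n n → Set
Connected Q = ∀ {i k a b} → Q i a ≢ 0ℚ → Q k b ≢ 0ℚ →
  i ≡ k ⊎ Q i k ≢ 0ℚ ⊎ ∃ λ l → Q i l ≢ 0ℚ × Q l k ≢ 0ℚ

record SymmetricCubic (C : Fin n → Matrix n n) : Set where
  field
    swap₁₂ : ∀ i a b → C i a b ≡ C a i b
    swap₂₃ : ∀ i a b → C i a b ≡ C i b a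
    0≤C    : ∀ i a b → 0ℚ ≤ C i a b

module Laplacian (Q : Matrix n n) (Q-sym : ∀ i j → Q i j ≡ Q j i) (Q≥0 : ∀ i j → 0ℚ ≤ Q i j) where

  degree : Vect n
  degree i = sum (Q i)

  laplacian : Matrix n n
  laplacian i j = degree i * δ i j - Q i j

  laplacian-sym : ∀ i j → laplacian i j ≡ laplacian j i
  laplacian-sym i j = cong₂ _-_ (degree-δ {d = degree} i j) (Q-sym i j)
    where
    degree-δ : ∀ {m} {d : Vect m} (i j : Fin m) → d i * δ i j ≡ d j * δ j i
    degree-δ         zero    zero    = refl
    degree-δ {d = d} zero    (suc j) = trans (*-zeroʳ (d zero)) (sym (*-zeroʳ (d (suc j))))
    degree-δ {d = d} (suc i) zero    = trans (*-zeroʳ (d (suc i))) (sym (*-zeroʳ (d zero)))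
    degree-δ {d = d} (suc i) (suc j) = degree-δ {d = λ i → d (suc i)} i j

  app-laplacian : ∀ x i → app laplacian x i ≡ degree i * x i - app Q x i
  app-laplacian x i = trans
    (sum-cong-≗ λ j → solve 4 (λ d e q x → (d :* e :- q) :* x := d :* (e :* x) :- q :* x) refl (degree i) (δ i j) (Q i j) (x j))
    (trans (sum-minus (λ j → degree i * (δ i j * x j)) (λ j → Q i j * x j))
      (cong (_- app Q x i) (trans (sum-* (degree i) (λ j → δ i j * x j)) (cong (degree i *_) (sum-δ i x)))))

  bil-laplacian : ∀ x y → bil laplacian x y ≡ dot x (λ i → degree i * y i) - bil Q x y
  bil-laplacian x y = trans
    (sum-cong-≗ λ i → trans (cong (x i *_) (app-laplacian y i)) (solve 3 (λ x d q → x :* (d :- q) := x :* d :- x :* q) refl (x i) (degree i * y i) (app Q y i)))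
    (sum-minus (λ i → x i * (degree i * y i)) (λ i → x i * app Q y i))

  energy : Vect n → Fin n → Fin n → ℚ
  energy x i j = Q i j * ((x i - x j) * (x i - x j))

  0≤energy : ∀ x i j → 0ℚ ≤ energy x i j
  0≤energy x i j = 0≤* (Q≥0 i j) (0≤² (x i - x j))

  -- Each term splits into a part seen from `i` and a part seen from `j`; symmetry of `Q` makes the
  -- two double sums equal, whence the factor two.
  dirichlet : ∀ x → sum (λ i → sum (energy x i)) ≡ 2ℚ * bil laplacian x x
  dirichlet x = begin
    sum (λ i → sum (energy x i))
      ≡⟨ sum-cong-≗ (λ i → sum-cong-≗ λ j → trans (split (Q i j) (x i) (x j)) (cong (λ q → h i j + x j * (q * x j - q * x i)) (Q-sym i j))) ⟩
    sum (λ i → sum (λ j → h i j + h j i))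
      ≡⟨ trans (sum-cong-≗ λ i → sum-+ (h i) (λ j → h j i)) (sum-+ (λ i → sum (h i)) (λ i → sum (λ j → h j i))) ⟩
    sum (λ i → sum (h i)) + sum (λ i → sum (λ j → h j i))
      ≡⟨ cong (sum (λ i → sum (h i)) +_) (sym (sum-swap h)) ⟩
    sum (λ i → sum (h i)) + sum (λ i → sum (h i))
      ≡⟨ cong (λ b → b + b) (sum-cong-≗ λ i → trans (sum-* (x i) (λ j → Q i j * x i - Q i j * x j)) (cong (x i *_) (row i))) ⟩
    bil laplacian x x + bil laplacian x x
      ≡⟨ solve 1 (λ b → b :+ b := con 2ℚ :* b) refl (bil laplacian x x) ⟩
    2ℚ * bil laplacian x x ∎
    where
    open ≡-Reasoning
    h : Matrix n n
    h i j = x i * (Q i j * x i - Q i j * x j)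
    split : ∀ q a b → q * ((a - b) * (a - b)) ≡ a * (q * a - q * b) + b * (q * b - q * a)
    split = solve 3 (λ q a b → q :* ((a :- b) :* (a :- b)) := a :* (q :* a :- q :* b) :+ b :* (q :* b :- q :* a)) refl
    row : ∀ i → sum (λ j → Q i j * x i - Q i j * x j) ≡ app laplacian x i
    row i = trans (sum-minus (λ j → Q i j * x i) (λ j → Q i j * x j))
      (trans (cong (_- app Q x i) (sym (*-distribʳ-sum (x i) (Q i)))) (sym (app-laplacian x i)))

  0≤laplacian : ∀ x → 0ℚ ≤ bil laplacian x x
  0≤laplacian x = cancel-≤ {2ℚ} (positive⁻¹ 2ℚ) (subst (_≤ 2ℚ * bil laplacian x x) (sym (*-zeroʳ 2ℚ))
    (subst (0ℚ ≤_) (dirichlet x) (sum-0≤ λ i → sum-0≤ (0≤energy x i))))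

  kernel-edge : ∀ z → bil laplacian z z ≡ 0ℚ → ∀ i j → Q i j ≢ 0ℚ → z i ≡ z j
  kernel-edge z zLz≡0 i j Qij≢0 with z i ℚP.≟ z j
  ... | yes p = p
  ... | no zi≢zj = contradiction (sym e≡0) (<⇒≢ (0<* (≤∧≢⇒< (Q≥0 i j) (λ e → Qij≢0 (sym e))) (0<² {z i - z j} (λ e → zi≢zj (trans (solve 2 (λ a b → a := (a :- b) :+ b) refl (z i) (z j)) (trans (cong (_+ z j) e) (+-identityˡ (z j))))))))
    where
    e≡0 : energy z i j ≡ 0ℚ
    e≡0 = sum-0≤-≡0 (0≤energy z i) (sum-0≤-≡0 (λ i → sum-0≤ (0≤energy z i)) (trans (dirichlet z) (*-≡0ʳ 2ℚ zLz≡0)) i) j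

  degree≡0⇒ : ∀ i → degree i ≡ 0ℚ → ∀ j → Q i j ≡ 0ℚ
  degree≡0⇒ i = sum-0≤-≡0 (Q≥0 i)

  0≤degree : ∀ i → 0ℚ ≤ degree i
  0≤degree i = sum-0≤ (Q≥0 i)

  degree≡0⇒app : ∀ x i → degree i ≡ 0ℚ → app Q x i ≡ 0ℚ
  degree≡0⇒app x i d≡0 = sum-zero λ j → *-≡0ˡ (x j) (degree≡0⇒ i d≡0 j)

  module _ (conn : Connected Q)
    (expansive : ∀ x → bil Q x x ≤ sum (λ i → recip (degree i) * (app Q x i * app Q x i))) where

    kernel-constant : ∀ z → bil laplacian z z ≡ 0ℚ → ∀ i k → degree i ≢ 0ℚ → degree k ≢ 0ℚ → z i ≡ z k
    kernel-constant z zLz≡0 i k di≢0 dk≢0 with sum-≢0 (Q i) di≢0 | sum-≢0 (Q k) dk≢0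
    ... | _ , Qia≢0 | _ , Qkb≢0 with conn Qia≢0 Qkb≢0
    ... | inj₁ refl = refl
    ... | inj₂ (inj₁ Qik≢0) = kernel-edge z zLz≡0 i k Qik≢0
    ... | inj₂ (inj₂ (l , Qil≢0 , Qlk≢0)) = trans (kernel-edge z zLz≡0 i l Qil≢0) (kernel-edge z zLz≡0 l k Qlk≢0)

    -- With D the diagonal matrix of degrees, solve (D − Q) x = D y; expansiveness turns into
    -- ⟨x , (D − Q) x⟩ ≤ ⟨y , D y⟩, and positivity of D − Q at x − y gives ⟨y , Q y⟩ ≤ 0.
    negative : ∀ y → dot degree y ≡ 0ℚ → bil Q y y ≤ 0ℚ
    negative y dy≡0 with fredholm _ laplacian (λ i → degree i * y i)
    -- The alternative is void: `z` lies in the kernel of the Laplacian, so it is constant on the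
    -- vertices of nonzero degree, and its pairing with `D y` is a multiple of `dot degree y = 0`.
    ... | inj₂ (z , zL≡0 , zDy≢0) = contradiction zDy≡0 zDy≢0
      where
      Lz≡0 : ∀ i → app laplacian z i ≡ 0ℚ
      Lz≡0 i = trans (sum-cong-≗ (λ j → trans (*-comm (laplacian i j) (z j)) (cong (z j *_) (laplacian-sym i j)))) (zL≡0 i)
      zLz≡0 : bil laplacian z z ≡ 0ℚ
      zLz≡0 = sum-zero λ i → *-≡0ʳ (z i) (Lz≡0 i)
      zDy≡0 : dot z (λ i → degree i * y i) ≡ 0ℚ
      zDy≡0 with sum-≢0 (λ i → z i * (degree i * y i)) zDy≢0
      ... | o , p≢0 = trans (sum-cong-≗ λ i → constant i (degree i ℚP.≟ 0ℚ)) (trans (sum-* (z o) (λ i → degree i * y i)) (*-≡0ʳ (z o) dy≡0))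
        where
        do≢0 : degree o ≢ 0ℚ
        do≢0 e = p≢0 (trans (cong (λ d → z o * (d * y o)) e) (*-≡0ʳ (z o) (*-zeroˡ (y o))))
        constant : ∀ i → Dec (degree i ≡ 0ℚ) → z i * (degree i * y i) ≡ z o * (degree i * y i)
        constant i (yes d≡0) = trans (vanish (z i)) (sym (vanish (z o)))
          where
          vanish : ∀ c → c * (degree i * y i) ≡ 0ℚ
          vanish c = trans (cong (λ d → c * (d * y i)) d≡0) (*-≡0ʳ c (*-zeroˡ (y i)))
        constant i (no d≢0) = cong (_* (degree i * y i)) (kernel-constant z zLz≡0 i o d≢0 do≢0)
    ... | inj₁ (x , Lx≡Dy) = ≤-from (0≤+ P (≤⇒0≤- xLx≤d)) (solve 3 (λ xx d q → (con 1ℚ :* con 1ℚ :* xx :+ con 2ℚ :* (con 1ℚ :* (:- con 1ℚ) :* d) :+ (:- con 1ℚ) :* (:- con 1ℚ) :* (d :- q)) :+ (d :- xx) := con 0ℚ :- q) refl (bil laplacian x x) d (bil Q y y))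
      where
      d = dot y (λ i → degree i * y i)
      xLy≡d : bil laplacian x y ≡ d
      xLy≡d = trans (bil-comm laplacian-sym x y) (sum-cong-≗ λ i → cong (y i *_) (Lx≡Dy i))
      w : Vect n
      w i = recip (degree i)
      W = sum (λ i → w i * (app Q x i * app Q x i))
      -- Write `⟨y , D y⟩` as the `D⁻¹`-weighted square of `D y` and replace `D y` by `D x − Q x`:
      -- expanding leaves `⟨x , (D − Q) x⟩` plus the surplus in `expansive`. The junk value of
      -- `recip` is harmless, since every term vanishes at a vertex of degree zero.
      d≡ : d ≡ bil laplacian x x + (W - bil Q x x)
      d≡ = trans (sum-cong-≗ term) (trans (sum-+ (λ i → x i * app laplacian x i) (λ i → w i * (app Q x i * app Q x i) - x i * app Q x i))
        (cong (bil laplacian x x +_) (sum-minus (λ i → w i * (app Q x i * app Q x i)) (λ i → x i * app Q x i))))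
        where
        open ≡-Reasoning
        term : ∀ i → y i * (degree i * y i) ≡ x i * app laplacian x i + (w i * (app Q x i * app Q x i) - x i * app Q x i)
        term i = begin
          y i * (degree i * y i) ≡⟨ cong (y i *_) (sym (recip-cancel (degree i) (λ e → *-≡0ˡ (y i) e))) ⟩
          y i * (w i * degree i * (degree i * y i)) ≡⟨ solve 3 (λ y w d → y :* (w :* d :* (d :* y)) := w :* ((d :* y) :* (d :* y))) refl (y i) (w i) (degree i) ⟩
          w i * ((degree i * y i) * (degree i * y i)) ≡⟨ cong (λ s → w i * (s * s)) (trans (sym (Lx≡Dy i)) (app-laplacian x i)) ⟩
          w i * ((degree i * x i - q) * (degree i * x i - q)) ≡⟨ solve 4 (λ w d x q → w :* ((d :* x :- q) :* (d :* x :- q)) := w :* d :* (d :* x) :* x :- con 2ℚ :* (x :* (w :* d :* q)) :+ w :* (q :* q)) refl (w i) (degree i) (x i) q ⟩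
          w i * degree i * (degree i * x i) * x i - 2ℚ * (x i * (w i * degree i * q)) + w i * (q * q)
            ≡⟨ cong₂ (λ s t → s * x i - 2ℚ * (x i * t) + w i * (q * q)) (recip-cancel (degree i) (λ e → *-≡0ˡ (x i) e)) (recip-cancel (degree i) (degree≡0⇒app x i)) ⟩
          degree i * x i * x i - 2ℚ * (x i * q) + w i * (q * q)
            ≡⟨ solve 4 (λ w d x q → d :* x :* x :- con 2ℚ :* (x :* q) :+ w :* (q :* q) := x :* (d :* x :- q) :+ (w :* (q :* q) :- x :* q)) refl (w i) (degree i) (x i) q ⟩
          x i * (degree i * x i - q) + (w i * (q * q) - x i * q)
            ≡⟨ cong (λ s → x i * s + (w i * (q * q) - x i * q)) (sym (app-laplacian x i)) ⟩
          x i * app laplacian x i + (w i * (q * q) - x i * q) ∎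
          where q = app Q x i
      xLx≤d : bil laplacian x x ≤ d
      xLx≤d = ≤-from (≤⇒0≤- (expansive x)) (trans (solve 2 (λ l e → e := (l :+ e) :- l) refl (bil laplacian x x) (W - bil Q x x)) (cong (_- bil laplacian x x) (sym d≡)))
      P : 0ℚ ≤ 1ℚ * 1ℚ * bil laplacian x x + 2ℚ * (1ℚ * (- 1ℚ) * d) + (- 1ℚ) * (- 1ℚ) * (d - bil Q y y)
      P = subst (0ℚ ≤_) (trans (bil-square laplacian-sym 1ℚ (- 1ℚ) x y) (cong₂ (λ s t → 1ℚ * 1ℚ * bil laplacian x x + 2ℚ * (1ℚ * (- 1ℚ) * s) + (- 1ℚ) * (- 1ℚ) * t) xLy≡d (bil-laplacian y y))) (0≤laplacian (comb 1ℚ (- 1ℚ) x y))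

module _ {C : Fin n → Matrix n n} (C-sym : SymmetricCubic C) where
  open SymmetricCubic C-sym

  contract : Vect n → Matrix n n
  contract v a b = sum (λ i → v i * C i a b)

  contract-sym : ∀ v a b → contract v a b ≡ contract v b a
  contract-sym v a b = sum-cong-≗ λ i → cong (v i *_) (swap₂₃ i a b)

  0≤contract : ∀ {v} → (∀ i → 0ℚ ≤ v i) → ∀ a b → 0ℚ ≤ contract v a b
  0≤contract v≥0 a b = sum-0≤ λ i → 0≤* (v≥0 i) (0≤C i a b)

  app-contract : ∀ v x a → app (contract v) x a ≡ dot v (λ i → app (C i) x a)
  app-contract v x a = begin
    sum (λ b → sum (λ i → v i * C i a b) * x b)
      ≡⟨ sum-cong-≗ (λ b → trans (*-comm (contract v a b) (x b)) (sym (sum-* (x b) (λ i → v i * C i a b)))) ⟩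
    sum (λ b → sum (λ i → x b * (v i * C i a b)))
      ≡⟨ sum-swap (λ b i → x b * (v i * C i a b)) ⟩
    sum (λ i → sum (λ b → x b * (v i * C i a b)))
      ≡⟨ sum-cong-≗ (λ i → trans (sum-cong-≗ (λ b → solve 3 (λ x v c → x :* (v :* c) := v :* (c :* x)) refl (x b) (v i) (C i a b))) (sum-* (v i) (λ b → C i a b * x b))) ⟩
    sum (λ i → v i * app (C i) x a) ∎
    where open ≡-Reasoning

  bil-contract : ∀ v x y → bil (contract v) x y ≡ dot v (λ i → bil (C i) x y)
  bil-contract v x y = begin
    sum (λ a → x a * app (contract v) y a)
      ≡⟨ sum-cong-≗ (λ a → trans (cong (x a *_) (app-contract v y a)) (sym (sum-* (x a) (λ i → v i * app (C i) y a)))) ⟩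
    sum (λ a → sum (λ i → x a * (v i * app (C i) y a)))
      ≡⟨ sum-swap (λ a i → x a * (v i * app (C i) y a)) ⟩
    sum (λ i → sum (λ a → x a * (v i * app (C i) y a)))
      ≡⟨ sum-cong-≗ (λ i → trans (sum-cong-≗ (λ a → solve 3 (λ x v c → x :* (v :* c) := v :* (x :* c)) refl (x a) (v i) (app (C i) y a))) (sum-* (v i) (λ a → x a * app (C i) y a))) ⟩
    sum (λ i → v i * bil (C i) x y) ∎
    where open ≡-Reasoning

  -- Full symmetry lets `v` be inserted in any slot of the cubic form. This is how an inequality for
  -- each slice becomes one for the rows of the contraction.
  bil-slice : ∀ v x i → bil (C i) v x ≡ app (contract v) x i
  bil-slice v x i = sym (trans (app-contract v x i) (sum-cong-≗ λ a → cong (v a *_) (sum-cong-≗ λ b → cong (_* x b) (swap₁₂ a i b))))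

𝟙 : Vect n
𝟙 _ = 1ℚ

-- Hyperbolicity of C i at 𝟙 reads C i (x , x) · degree i ≤ (Q x)ᵢ²; summing over i makes Q expansive.
cubic-hyperbolic-𝟙 : {C : Fin n → Matrix n n} (C-sym : SymmetricCubic C) → (∀ i → Hyperbolic (C i)) →
  Connected (contract C-sym 𝟙) → Hyperbolic (contract C-sym 𝟙)
cubic-hyperbolic-𝟙 {C = C} C-sym hyp conn =
  hyperbolic-criterion Q Q-sym Q≥0 degree (negative conn expansive)
  where
  open SymmetricCubic C-sym
  Q = contract C-sym 𝟙
  Q-sym = contract-sym C-sym 𝟙
  Q≥0 : ∀ i j → 0ℚ ≤ Q i j
  Q≥0 = 0≤contract C-sym (λ _ → nonNegative⁻¹ 1ℚ)
  open Laplacian Q Q-sym Q≥0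
  app-𝟙 : ∀ i → app Q 𝟙 i ≡ degree i
  app-𝟙 i = sum-cong-≗ λ j → *-identityʳ (Q i j)
  slice≡0 : ∀ i → degree i ≡ 0ℚ → ∀ a b → C i a b ≡ 0ℚ
  slice≡0 i d≡0 a b = trans (sym (*-identityˡ (C i a b))) (trans (cong (1ℚ *_) (swap₁₂ i a b))
    (sum-0≤-≡0 {f = λ a → 1ℚ * C a i b} (λ a → 0≤* (nonNegative⁻¹ 1ℚ) (0≤C a i b)) (degree≡0⇒ i d≡0 b) a))
  slice : ∀ x i → bil (C i) x x ≤ recip (degree i) * (app Q x i * app Q x i)
  slice x i = go (degree i ℚP.≟ 0ℚ)
    where
    q = app Q x i
    go : Dec (degree i ≡ 0ℚ) → bil (C i) x x ≤ recip (degree i) * (q * q)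
    -- At an isolated vertex nonnegativity makes the whole slice vanish, so no division by the
    -- degree is called for.
    go (yes d≡0) = subst (_≤ recip (degree i) * (q * q)) (sym (sum-zero λ a → *-≡0ʳ (x a) (sum-zero λ b → *-≡0ˡ (x b) (slice≡0 i d≡0 a b))))
      (0≤* (recip-0≤ (0≤degree i)) (0≤² q))
    go (no d≢0) = subst (_≤ recip (degree i) * (q * q))
      (trans (solve 3 (λ w d X → w :* (X :* d) := w :* d :* X) refl (recip (degree i)) (degree i) (bil (C i) x x)) (trans (cong (_* bil (C i) x x) (recip-inverse d≢0)) (*-identityˡ (bil (C i) x x))))
      (ℚP.*-monoˡ-≤-nonNeg (recip (degree i)) {{nonNegative (recip-0≤ (0≤degree i))}}
        (subst₂ (λ s t → bil (C i) x x * s ≤ t * t) (trans (bil-slice C-sym 𝟙 𝟙 i) (app-𝟙 i))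
          (trans (bil-comm (swap₂₃ i) x 𝟙) (bil-slice C-sym 𝟙 x i))
          (hyp i x 𝟙 (λ _ → nonNegative⁻¹ 1ℚ))))
  expansive : ∀ x → bil Q x x ≤ sum (λ i → recip (degree i) * (app Q x i * app Q x i))
  expansive x = subst (_≤ sum (λ i → recip (degree i) * (app Q x i * app Q x i))) (sym (trans (bil-contract C-sym 𝟙 x x) (sum-cong-≗ λ i → *-identityˡ (bil (C i) x x))))
    (sum-mono (slice x))

-- The substitution of `v i * x i` for `x i`. It reduces contraction along a positive `v` to
-- contraction along `𝟙`, where the degrees are plain row sums.
rescale : Vect n → Matrix n n → Matrix n n
rescale v M a b = v a * v b * M a b

bil-rescale : (v : Vect n) (M : Matrix n n) (x y : Vect n) →
  bil (rescale v M) x y ≡ bil M (λ i → v i * x i) (λ i → v i * y i)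
bil-rescale v M x y = sum-cong-≗ λ a → begin
  x a * sum (λ b → v a * v b * M a b * y b) ≡⟨ cong (x a *_) (trans (sum-cong-≗ (λ b → solve 4 (λ p q m y → p :* q :* m :* y := p :* (m :* (q :* y))) refl (v a) (v b) (M a b) (y b))) (sum-* (v a) (λ b → M a b * (v b * y b)))) ⟩
  x a * (v a * sum (λ b → M a b * (v b * y b))) ≡⟨ solve 3 (λ x v s → x :* (v :* s) := v :* x :* s) refl (x a) (v a) (sum (λ b → M a b * (v b * y b))) ⟩
  v a * x a * sum (λ b → M a b * (v b * y b)) ∎
  where open ≡-Reasoning

bil-congˡ : {M N : Matrix n n} → (∀ a b → M a b ≡ N a b) → ∀ x y → bil M x y ≡ bil N x y
bil-congˡ M≡N x y = sum-cong-≗ λ a → cong (x a *_) (sum-cong-≗ λ b → cong (_* y b) (M≡N a b))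

hyperbolic-cong : {M N : Matrix n n} → (∀ a b → M a b ≡ N a b) → Hyperbolic M → Hyperbolic N
hyperbolic-cong M≡N hyp x y y≥0
  = subst₂ _≤_ (cong₂ _*_ (bil-congˡ M≡N x x) (bil-congˡ M≡N y y)) (cong₂ _*_ (bil-congˡ M≡N x y) (bil-congˡ M≡N x y)) (hyp x y y≥0)

bil-scale : (c : ℚ) (M : Matrix n n) (x y : Vect n) → bil (λ a b → c * M a b) x y ≡ c * bil M x y
bil-scale c M x y = trans (sum-cong-≗ λ a → trans (cong (x a *_) (trans (sum-cong-≗ λ b → *-assoc c (M a b) (y b)) (sum-* c (λ b → M a b * y b))))
  (solve 3 (λ x c s → x :* (c :* s) := c :* (x :* s)) refl (x a) c (app M y a))) (sum-* c (λ a → x a * app M y a))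

bil-linear : (p q : ℚ) (M N : Matrix n n) (x y : Vect n) → bil (λ a b → p * M a b + q * N a b) x y ≡ p * bil M x y + q * bil N x y
bil-linear p q M N x y = trans
  (sum-cong-≗ λ a → trans (cong (x a *_) (trans (sum-cong-≗ λ b → solve 5 (λ p m q n y → (p :* m :+ q :* n) :* y := p :* (m :* y) :+ q :* (n :* y)) refl p (M a b) q (N a b) (y b)) (sum-linear p q (λ b → M a b * y b) (λ b → N a b * y b))))
    (solve 5 (λ x p m q n → x :* (p :* m :+ q :* n) := p :* (x :* m) :+ q :* (x :* n)) refl (x a) p (app M y a) q (app N y a)))
  (sum-linear p q (λ a → x a * app M y a) (λ a → x a * app N y a))

bil-minus : (M N : Matrix n n) (x y : Vect n) → bil (λ a b → M a b - N a b) x y ≡ bil M x y - bil N x y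
bil-minus M N x y = trans
  (sum-cong-≗ λ a → trans (cong (x a *_) (trans (sum-cong-≗ λ b → distrib (M a b) (N a b) (y b)) (sum-minus (λ b → M a b * y b) (λ b → N a b * y b))))
    (solve 3 (λ x m n → x :* (m :- n) := x :* m :- x :* n) refl (x a) (app M y a) (app N y a)))
  (sum-minus (λ a → x a * app M y a) (λ a → x a * app N y a))
  where
  distrib : ∀ m n y → (m - n) * y ≡ m * y - n * y
  distrib = solve 3 (λ m n y → (m :- n) :* y := m :* y :- n :* y) refl

scale-≤ : ∀ c {X Y Z} → X * Y ≤ Z * Z → c * X * (c * Y) ≤ c * Z * (c * Z)
scale-≤ c {X} {Y} {Z} h = subst₂ _≤_
  (solve 3 (λ c X Y → c :* c :* (X :* Y) := c :* X :* (c :* Y)) refl c X Y) (solve 2 (λ c Z → c :* c :* (Z :* Z) := c :* Z :* (c :* Z)) refl c Z)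
  (ℚP.*-monoˡ-≤-nonNeg (c * c) {{nonNegative (0≤² c)}} h)

hyperbolic-scale : {M : Matrix n n} (c : ℚ) → Hyperbolic M → Hyperbolic (λ a b → c * M a b)
hyperbolic-scale {M = M} c hyp x y y≥0 = subst₂ _≤_
  (sym (cong₂ _*_ (bil-scale c M x x) (bil-scale c M y y))) (sym (cong₂ _*_ (bil-scale c M x y) (bil-scale c M x y)))
  (scale-≤ c (hyp x y y≥0))

hyperbolic-rescale : {M : Matrix n n} {v : Vect n} → (∀ i → 0ℚ ≤ v i) → Hyperbolic M → Hyperbolic (rescale v M)
hyperbolic-rescale {M = M} {v} v≥0 hyp x y y≥0 = subst₂ _≤_
  (sym (cong₂ _*_ (bil-rescale v M x x) (bil-rescale v M y y))) (sym (cong₂ _*_ (bil-rescale v M x y) (bil-rescale v M x y)))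
  (hyp (λ i → v i * x i) (λ i → v i * y i) (λ i → 0≤* (v≥0 i) (y≥0 i)))

hyperbolic-unscale : {M : Matrix n n} {v : Vect n} → (∀ i → 0ℚ < v i) → Hyperbolic (rescale v M) → Hyperbolic M
hyperbolic-unscale {n} {M} {v} v>0 hyp x y y≥0 = subst₂ _≤_ (cong₂ _*_ (back x x) (back y y)) (cong₂ _*_ (back x y) (back x y))
  (hyp (divide x) (divide y) (λ i → 0≤* (recip-0≤ (<⇒≤ (v>0 i))) (y≥0 i)))
  where
  divide : Vect n → Vect n
  divide x i = recip (v i) * x i
  undo : ∀ x i → v i * divide x i ≡ x i
  undo x i = trans (solve 3 (λ v r x → v :* (r :* x) := r :* v :* x) refl (v i) (recip (v i)) (x i)) (recip-cancel (v i) (λ e → contradiction (sym e) (<⇒≢ (v>0 i))))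
  back : ∀ x y → bil (rescale v M) (divide x) (divide y) ≡ bil M x y
  back x y = trans (bil-rescale v M (divide x) (divide y)) (dot-cong (undo x) (λ a → sum-cong-≗ λ b → cong (M a b *_) (undo y b)))

-- Written in the variables `v i * x i`, the cubic contracts along `𝟙` to the rescaled `Q`. Strict
-- positivity of `v` preserves the zero pattern, hence connectedness, and allows the rescaling to be
-- undone.
cubic-hyperbolic : {C : Fin n → Matrix n n} (C-sym : SymmetricCubic C) → (∀ i → Hyperbolic (C i)) →
  {v : Vect n} → (∀ i → 0ℚ < v i) → Connected (contract C-sym v) → Hyperbolic (contract C-sym v)
cubic-hyperbolic {n} {C} C-sym hyp {v} v>0 conn =
  hyperbolic-unscale {M = Q} v>0 (hyperbolic-cong {M = Q′} {N = rescale v Q} Q′≡ (cubic-hyperbolic-𝟙 C′-sym C′-hyp conn′))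
  where
  open SymmetricCubic C-sym
  v≥0 : ∀ i → 0ℚ ≤ v i
  v≥0 i = <⇒≤ (v>0 i)
  C′ : Fin n → Matrix n n
  C′ i a b = v i * rescale v (C i) a b
  C′-sym : SymmetricCubic C′
  C′-sym = record
    { swap₁₂ = λ i a b → trans (cong (λ c → v i * (v a * v b * c)) (swap₁₂ i a b)) (solve 4 (λ p q r c → p :* (q :* r :* c) := q :* (p :* r :* c)) refl (v i) (v a) (v b) (C a i b))
    ; swap₂₃ = λ i a b → trans (cong (λ c → v i * (v a * v b * c)) (swap₂₃ i a b)) (solve 4 (λ p q r c → p :* (q :* r :* c) := p :* (r :* q :* c)) refl (v i) (v a) (v b) (C i b a))
    ; 0≤C = λ i a b → 0≤* (v≥0 i) (0≤* (0≤* (v≥0 a) (v≥0 b)) (0≤C i a b)) }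
  C′-hyp : ∀ i → Hyperbolic (C′ i)
  C′-hyp i = hyperbolic-scale {M = rescale v (C i)} (v i) (hyperbolic-rescale {M = C i} v≥0 (hyp i))
  Q = contract C-sym v
  Q′ = contract C′-sym 𝟙
  Q′≡ : ∀ a b → Q′ a b ≡ rescale v Q a b
  Q′≡ a b = begin
    sum (λ i → 1ℚ * (v i * (v a * v b * C i a b))) ≡⟨ sum-cong-≗ (λ i → reorder (v i) (v a) (v b) (C i a b)) ⟩
    sum (λ i → v a * v b * (v i * C i a b))        ≡⟨ sum-* (v a * v b) (λ i → v i * C i a b) ⟩
    v a * v b * sum (λ i → v i * C i a b)          ∎
    where
    open ≡-Reasoning
    reorder : ∀ p q r c → 1ℚ * (p * (q * r * c)) ≡ q * r * (p * c)
    reorder = solve 4 (λ p q r c → con 1ℚ :* (p :* (q :* r :* c)) := q :* r :* (p :* c)) refl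
  from : ∀ a b → Q′ a b ≢ 0ℚ → Q a b ≢ 0ℚ
  from a b Q′≢0 Q≡0 = Q′≢0 (trans (Q′≡ a b) (*-≡0ʳ (v a * v b) Q≡0))
  to : ∀ a b → Q a b ≢ 0ℚ → Q′ a b ≢ 0ℚ
  to a b Q≢0 Q′≡0 = <⇒≢ (0<* (0<* (v>0 a) (v>0 b)) (≤∧≢⇒< (0≤contract C-sym v≥0 a b) (λ e → Q≢0 (sym e)))) (sym (trans (sym (Q′≡ a b)) Q′≡0))
  conn′ : Connected Q′
  conn′ {i} {k} {a} {b} p q = Sum.map₂ (Sum.map (to i k) (λ (l , e , f) → l , to i l e , to l k f)) (conn {i} {k} {a} {b} (from i a p) (from k b q))

-- Lorentzian polynomials

-- A homogeneous polynomial, represented by the values of its iterated partial derivatives.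
Tensor : ℕ → Set
Tensor n = List (Fin n) → ℚ

∂ : Fin n → Tensor n → Tensor n
∂ i T w = T (i ∷ w)

polar : List (Vect n) → Tensor n → ℚ
polar []       T = T []
polar (v ∷ vs) T = sum (λ i → v i * polar vs (∂ i T))

hessian : List (Vect n) → Tensor n → Matrix n n
hessian vs T a b = polar vs (∂ b (∂ a T))

Symmetric : Tensor n → Set
Symmetric T = ∀ u a b w → T (u ++ a ∷ b ∷ w) ≡ T (u ++ b ∷ a ∷ w)

-- By `homogeneous`, words of the wrong length have value zero: only the derivatives of full order
-- are kept, which are constants and determine the polynomial.
record Admissible (D : ℕ) (T : Tensor n) : Set where
  field
    symmetric   : Symmetric T
    nonnegative : ∀ w → 0ℚ ≤ T w
    homogeneous : ∀ w → T w ≢ 0ℚ → length w ≡ D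

open Admissible

∂-admissible : ∀ {D} {T : Tensor n} → Admissible (suc D) T → ∀ i → Admissible D (∂ i T)
∂-admissible adm i = record
  { symmetric   = λ u → symmetric adm (i ∷ u)
  ; nonnegative = λ w → nonnegative adm (i ∷ w)
  ; homogeneous = λ w ≢0 → suc-injective (homogeneous adm (i ∷ w) ≢0) }

Linked : Tensor n → Fin n → Fin n → Set
Linked T i k = ∃ λ w → T (i ∷ k ∷ w) ≢ 0ℚ

-- The graph behind this has the variables occurring in `T` as vertices and the nonzero mixed second
-- derivatives as edges. It stands in for an exchange condition on the support.
Indecomposable : Tensor n → Set
Indecomposable T = ∀ i u k w → T (i ∷ u) ≢ 0ℚ → T (k ∷ w) ≢ 0ℚ →
  i ≡ k ⊎ Linked T i k ⊎ ∃ λ l → Linked T i l × Linked T l k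

-- A local definition: signs are examined only in degree two and connectivity in each degree from
-- two on. The Bochner step recovers hyperbolicity in higher degrees, so a given family needs only
-- these two checks.
Lorentzian : ℕ → Tensor n → Set
Lorentzian 0 T = ⊤
Lorentzian 1 T = ⊤
Lorentzian 2 T = Indecomposable T × Hyperbolic (hessian [] T)
Lorentzian (suc (suc (suc d))) T = Indecomposable T × (∀ i → Lorentzian (suc (suc d)) (∂ i T))

polar-cong : (vs : List (Vect n)) {S T : Tensor n} → (∀ w → S w ≡ T w) → polar vs S ≡ polar vs T
polar-cong []       S≡T = S≡T []
polar-cong (v ∷ vs) S≡T = sum-cong-≗ λ i → cong (v i *_) (polar-cong vs (λ w → S≡T (i ∷ w)))

polar-≢0 : (vs : List (Vect n)) (T : Tensor n) → polar vs T ≢ 0ℚ → ∃ λ w → T w ≢ 0ℚ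
polar-≢0 []       T ≢0 = [] , ≢0
polar-≢0 (v ∷ vs) T ≢0 =
  let i , p≢0 = sum-≢0 (λ i → v i * polar vs (∂ i T)) ≢0
      w , q≢0 = polar-≢0 vs (∂ i T) (λ e → p≢0 (*-≡0ʳ (v i) e))
  in i ∷ w , q≢0

Pos NonNeg : Vect n → Set
Pos v = ∀ i → 0ℚ < v i
NonNeg v = ∀ i → 0ℚ ≤ v i

polar-0≤ : {vs : List (Vect n)} → All NonNeg vs → {T : Tensor n} → (∀ w → 0ℚ ≤ T w) → 0ℚ ≤ polar vs T
polar-0≤ []         T≥0 = T≥0 []
polar-0≤ (v≥0 ∷ ps) T≥0 = sum-0≤ λ i → 0≤* (v≥0 i) (polar-0≤ ps (λ w → T≥0 (i ∷ w)))

Pos⇒NonNeg : {vs : List (Vect n)} → All Pos vs → All NonNeg vs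
Pos⇒NonNeg []       = []
Pos⇒NonNeg (p ∷ ps) = (λ i → <⇒≤ (p i)) ∷ Pos⇒NonNeg ps

polar-0< : {vs : List (Vect n)} → All Pos vs → {T : Tensor n} → (∀ w → 0ℚ ≤ T w) →
  ∀ w → length w ≡ length vs → T w ≢ 0ℚ → 0ℚ < polar vs T
polar-0< []         T≥0 []      _ T≢0 = ≤∧≢⇒< (T≥0 []) (λ e → T≢0 (sym e))
polar-0< (v>0 ∷ ps) T≥0 (i ∷ w) e T≢0 = sum-0<
  (λ j → 0≤* (<⇒≤ (v>0 j)) (polar-0≤ (Pos⇒NonNeg ps) (λ w → T≥0 (j ∷ w)))) i
  (0<* (v>0 i) (polar-0< ps (λ w → T≥0 (i ∷ w)) w (suc-injective e) T≢0))

bil-hessian : (vs : List (Vect n)) (T : Tensor n) (x y : Vect n) → bil (hessian vs T) x y ≡ polar (x ∷ y ∷ vs) T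
bil-hessian vs T x y = sum-cong-≗ λ a → cong (x a *_) (sum-cong-≗ λ b → *-comm (hessian vs T a b) (y b))

slices-cubic : ∀ {D} {T : Tensor n} → Admissible D T → {vs : List (Vect n)} → All NonNeg vs →
  SymmetricCubic (λ i → hessian vs (∂ i T))
slices-cubic adm {vs} vs≥0 = record
  { swap₁₂ = λ i a b → polar-cong vs (λ w → symmetric adm [] i a (b ∷ w))
  ; swap₂₃ = λ i a b → polar-cong vs (λ w → symmetric adm (i ∷ []) a b w)
  ; 0≤C    = λ i a b → polar-0≤ vs≥0 (λ w → nonnegative adm (i ∷ a ∷ b ∷ w)) }

-- Along strictly positive directions nothing cancels, so an edge of the graph of `T` gives a
-- nonzero entry of the contraction. Homogeneity ensures that the word witnessing the edge has as
-- many letters as there are directions.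
contract-connected : ∀ {d} {T : Tensor n} (adm : Admissible (3 ℕ.+ d) T) → Indecomposable T →
  ∀ {v vs} → Pos v → (vs>0 : All Pos vs) → length vs ≡ d →
  Connected (contract (slices-cubic adm (Pos⇒NonNeg vs>0)) v)
contract-connected {n} {d} {T} adm indec {v} {vs} v>0 vs>0 len {i} {k} {a} {b} Qia≢0 Qkb≢0 =
  let u , Tu≢0 = active i a Qia≢0
      w , Tw≢0 = active k b Qkb≢0
  in Sum.map₂ (Sum.map (linked i k) (λ (l , e , f) → l , linked i l e , linked l k f)) (indec i u k w Tu≢0 Tw≢0)
  where
  Q : Matrix n n
  Q = contract (slices-cubic adm (Pos⇒NonNeg vs>0)) v
  active : ∀ i a → Q i a ≢ 0ℚ → ∃ λ u → T (i ∷ u) ≢ 0ℚ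
  active i a Q≢0 =
    let l , p≢0 = sum-≢0 (λ l → v l * hessian vs (∂ l T) i a) Q≢0
        w , T≢0 = polar-≢0 vs (λ w → T (l ∷ i ∷ a ∷ w)) (λ e → p≢0 (*-≡0ʳ (v l) e))
    in l ∷ a ∷ w , λ e → T≢0 (trans (symmetric adm [] l i (a ∷ w)) e)
  positive-at : ∀ i k w → length w ≡ suc d → T (i ∷ k ∷ w) ≢ 0ℚ → 0ℚ < Q i k
  positive-at i k (l ∷ w) e T≢0 = sum-0<
    (λ j → 0≤* (<⇒≤ (v>0 j)) (polar-0≤ (Pos⇒NonNeg vs>0) (λ w → nonnegative adm (j ∷ i ∷ k ∷ w)))) l
    (0<* (v>0 l) (polar-0< vs>0 (λ w → nonnegative adm (l ∷ i ∷ k ∷ w)) w (trans (suc-injective e) (sym len))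
      (λ e → T≢0 (trans (symmetric adm (i ∷ []) k l w) (trans (symmetric adm [] i l (k ∷ w)) e)))))
  linked : ∀ i k → Linked T i k → Q i k ≢ 0ℚ
  linked i k (w , T≢0) Q≡0 = <⇒≢ (positive-at i k w (suc-injective (suc-injective (homogeneous adm (i ∷ k ∷ w) T≢0))) T≢0) (sym Q≡0)

-- The Hessian in the directions `v ∷ vs` is the contraction along `v` of the Hessians of the
-- `∂ i T` in the directions `vs`, which are hyperbolic by induction.
hyperbolic-Pos : ∀ d {T : Tensor n} → Admissible (2 ℕ.+ d) T → Lorentzian (2 ℕ.+ d) T →
  ∀ {vs} → length vs ≡ d → All Pos vs → Hyperbolic (hessian vs T)
hyperbolic-Pos zero    {T} adm (_ , hyp) {[]} _ [] = hyp
hyperbolic-Pos (suc d) {T} adm (indec , lor) {v ∷ vs} len (v>0 ∷ vs>0) =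
  hyperbolic-cong {N = hessian (v ∷ vs) T} (λ a b → sum-cong-≗ λ i → cong (v i *_) (polar-cong vs λ w →
      trans (symmetric adm [] i a (b ∷ w)) (symmetric adm (a ∷ []) i b w)))
    (cubic-hyperbolic (slices-cubic adm (Pos⇒NonNeg vs>0)) (λ i → hyperbolic-Pos d (∂-admissible adm i) (lor i) (suc-injective len) vs>0) v>0
      (contract-connected adm indec v>0 vs>0 (suc-injective len)))

-- Nonnegative directions and the Alexandrov-Fenchel inequality

polar-shift : (us : List (Vect n)) (v : Vect n) (ws : List (Vect n)) {T : Tensor n} →
  Symmetric T → polar (us ++ v ∷ ws) T ≡ polar (v ∷ us ++ ws) T
polar-shift []       v ws     T-sym = refl
polar-shift (u ∷ us) v ws {T} T-sym = begin
  sum (λ i → u i * polar (us ++ v ∷ ws) (∂ i T))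
    ≡⟨ sum-cong-≗ (λ i → trans (cong (u i *_) (polar-shift us v ws (λ w → T-sym (i ∷ w)))) (sym (sum-* (u i) (λ j → v j * p i j)))) ⟩
  sum (λ i → sum (λ j → u i * (v j * p i j)))
    ≡⟨ sum-swap (λ i j → u i * (v j * p i j)) ⟩
  sum (λ j → sum (λ i → u i * (v j * p i j)))
    ≡⟨ sum-cong-≗ (λ j → trans (sum-cong-≗ (λ i → trans (cong (λ q → u i * (v j * q)) (polar-cong (us ++ ws) (T-sym [] i j))) (solve 3 (λ u v p → u :* (v :* p) := v :* (u :* p)) refl (u i) (v j) (p j i)))) (sum-* (v j) (λ i → u i * p j i))) ⟩
  sum (λ j → v j * sum (λ i → u i * p j i)) ∎
  where
  open ≡-Reasoning
  p : Matrix _ _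
  p i j = polar (us ++ ws) (∂ j (∂ i T))

-- With s = −c₀ and K ≥ |c₁| + |c₂|, a negative c₀ is refuted at ε = s / (s + K).
limit-0≤ : ∀ c₀ c₁ c₂ → (∀ ε → 0ℚ < ε → 0ℚ ≤ c₀ + ε * (c₁ + ε * c₂)) → 0ℚ ≤ c₀
limit-0≤ c₀ c₁ c₂ h = ℚP.≮⇒≥ impossible
  where
  bound : ∀ c → ∃ λ K → 0ℚ ≤ K × c ≤ K
  bound c with ℚP.≤-total c 0ℚ
  ... | inj₁ c≤0 = 0ℚ , ℚP.≤-refl , c≤0
  ... | inj₂ 0≤c = c , 0≤c , ℚP.≤-refl
  impossible : ¬ (c₀ < 0ℚ)
  impossible c₀<0 with bound c₁ | bound c₂
  ... | K₁ , K₁≥0 , c₁≤K₁ | K₂ , K₂≥0 , c₂≤K₂ = ℚP.<-irrefl refl (ℚP.<-≤-trans (0<* (0<* s>0 s>0) r>0) (≤-from (0≤+ (h ε ε>0) slack) eq))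
    where
    s K r ε : ℚ
    s = - c₀
    K = K₁ + K₂
    s>0 : 0ℚ < s
    s>0 = ℚP.neg-antimono-< c₀<0
    K≥0 : 0ℚ ≤ K
    K≥0 = 0≤+ K₁≥0 K₂≥0
    sK>0 : 0ℚ < s + K
    sK>0 = 0<+ s>0 K≥0
    sK≢0 : s + K ≢ 0ℚ
    sK≢0 e = <⇒≢ sK>0 (sym e)
    r = recip (s + K)
    r-inv : r * (s + K) ≡ 1ℚ
    r-inv = recip-inverse sK≢0
    r>0 : 0ℚ < r
    r>0 = ≤∧≢⇒< (recip-0≤ (<⇒≤ sK>0)) (λ e → ℚP.1≢0 (trans (sym r-inv) (*-≡0ˡ ((s + K)) (sym e))))
    ε = s * r
    ε>0 : 0ℚ < ε
    ε>0 = 0<* s>0 r>0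
    1-ε≥0 : 0ℚ ≤ r * (s + K) - ε
    1-ε≥0 = subst (0ℚ ≤_) (solve 3 (λ r s K → r :* K := r :* (s :+ K) :- s :* r) refl r s K) (0≤* (<⇒≤ r>0) K≥0)
    slack : 0ℚ ≤ ε * ((K₁ - c₁) + (ε * (K₂ - c₂) + (r * (s + K) - ε) * K₂))
    slack = 0≤* (<⇒≤ ε>0) (0≤+ (≤⇒0≤- c₁≤K₁) (0≤+ (0≤* (<⇒≤ ε>0) (≤⇒0≤- c₂≤K₂)) (0≤* 1-ε≥0 K₂≥0)))
    eq : (c₀ + ε * (c₁ + ε * c₂)) + ε * ((K₁ - c₁) + (ε * (K₂ - c₂) + (r * (s + K) - ε) * K₂)) ≡ 0ℚ - s * s * r
    eq = trans (cong (λ q → (c₀ + ε * (c₁ + ε * c₂)) + ε * ((K₁ - c₁) + (ε * (K₂ - c₂) + (q - ε) * K₂))) r-inv)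
      (trans (solve 6 (λ c₀ e c₁ c₂ K₁ K₂ → (c₀ :+ e :* (c₁ :+ e :* c₂)) :+ e :* ((K₁ :- c₁) :+ (e :* (K₂ :- c₂) :+ (con 1ℚ :- e) :* K₂)) := c₀ :+ e :* (K₁ :+ K₂)) refl c₀ ε c₁ c₂ K₁ K₂)
      (trans (solve 3 (λ c r K → c :+ (:- c) :* r :* K := c :+ (:- c) :* (r :* (:- c :+ K)) :- (:- c) :* (:- c) :* r) refl c₀ r K)
      (trans (cong (λ q → c₀ + s * q - s * s * r) r-inv)
      (solve 2 (λ c r → c :+ (:- c) :* con 1ℚ :- (:- c) :* (:- c) :* r := con 0ℚ :- (:- c) :* (:- c) :* r) refl c₀ r))))

-- For fixed `x` and `y` the discriminant of `M + ε N` is a quadratic polynomial in ε, and its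
-- constant term is the discriminant of `M`.
hyperbolic-limit : (M N : Matrix n n) → (∀ ε → 0ℚ < ε → Hyperbolic (λ a b → 1ℚ * M a b + ε * N a b)) → Hyperbolic M
hyperbolic-limit M N hyp x y y≥0 = ≤-from (limit-0≤ (Z₀ * Z₀ - X₀ * Y₀) (2ℚ * (Z₀ * Z₁) - (X₀ * Y₁ + X₁ * Y₀)) (Z₁ * Z₁ - X₁ * Y₁) λ ε ε>0 →
    subst (0ℚ ≤_)
      (trans (cong₂ _-_ (cong₂ _*_ (expand ε x y) (expand ε x y)) (cong₂ _*_ (expand ε x x) (expand ε y y)))
        (solve 7 (λ X₀ X₁ Y₀ Y₁ Z₀ Z₁ e → (Z₀ :+ e :* Z₁) :* (Z₀ :+ e :* Z₁) :- (X₀ :+ e :* X₁) :* (Y₀ :+ e :* Y₁)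
            := (Z₀ :* Z₀ :- X₀ :* Y₀) :+ e :* ((con 2ℚ :* (Z₀ :* Z₁) :- (X₀ :* Y₁ :+ X₁ :* Y₀)) :+ e :* (Z₁ :* Z₁ :- X₁ :* Y₁))) refl X₀ X₁ Y₀ Y₁ Z₀ Z₁ ε))
      (≤⇒0≤- (hyp ε ε>0 x y y≥0))) refl
  where
  X₀ = bil M x x
  X₁ = bil N x x
  Y₀ = bil M y y
  Y₁ = bil N y y
  Z₀ = bil M x y
  Z₁ = bil N x y
  expand : ∀ ε x y → bil (λ a b → 1ℚ * M a b + ε * N a b) x y ≡ bil M x y + ε * bil N x y
  expand ε x y = trans (bil-linear 1ℚ ε M N x y) (cong (_+ ε * bil N x y) (*-identityˡ (bil M x y)))

-- Directions are made positive one at a time: `u` is replaced by `u + ε 𝟙` and moves from `us` to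
-- `ws`. By multilinearity the Hessian is affine in ε, so the limit applies.
hyperbolic-mixed : ∀ {d} {T : Tensor n} → Admissible (2 ℕ.+ d) T → Lorentzian (2 ℕ.+ d) T →
  ∀ {us} → All NonNeg us → ∀ {ws} → All Pos ws → length (us ++ ws) ≡ d → Hyperbolic (hessian (us ++ ws) T)
hyperbolic-mixed {d = d} adm lor {[]} [] ws>0 len = hyperbolic-Pos d adm lor len ws>0
hyperbolic-mixed {n} {d} {T} adm lor {u ∷ us} (u≥0 ∷ us≥0) {ws} ws>0 len =
  hyperbolic-limit (hessian (u ∷ us ++ ws) T) (hessian (𝟙 ∷ us ++ ws) T) λ ε ε>0 →
    hyperbolic-cong {M = hessian (us ++ comb 1ℚ ε u 𝟙 ∷ ws) T} {N = λ a b → 1ℚ * hessian (u ∷ us ++ ws) T a b + ε * hessian (𝟙 ∷ us ++ ws) T a b} (perturbed ε)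
      (hyperbolic-mixed adm lor us≥0 {comb 1ℚ ε u 𝟙 ∷ ws} (perturbed>0 ε ε>0 ∷ ws>0) (trans (length-shift us) len))
  where
  length-shift : ∀ us {v} → length (us ++ v ∷ ws) ≡ suc (length (us ++ ws))
  length-shift []       = refl
  length-shift (_ ∷ us) = cong suc (length-shift us)
  perturbed>0 : ∀ ε → 0ℚ < ε → Pos (comb 1ℚ ε u 𝟙)
  perturbed>0 ε ε>0 i = subst (0ℚ <_) (solve 2 (λ e u → e :* con 1ℚ :+ con 1ℚ :* u := con 1ℚ :* u :+ e :* con 1ℚ) refl ε (u i))
    (0<+ (0<* ε>0 (positive⁻¹ 1ℚ)) (0≤* (nonNegative⁻¹ 1ℚ) (u≥0 i)))
  perturbed : ∀ ε a b → hessian (us ++ comb 1ℚ ε u 𝟙 ∷ ws) T a b ≡ 1ℚ * hessian (u ∷ us ++ ws) T a b + ε * hessian (𝟙 ∷ us ++ ws) T a b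
  perturbed ε a b = trans (polar-shift us (comb 1ℚ ε u 𝟙) ws (λ v → symmetric adm (a ∷ b ∷ v)))
    (dot-combˡ 1ℚ ε u 𝟙 (λ i → polar (us ++ ws) (∂ i (∂ b (∂ a T)))))

alexandrov–fenchel : ∀ {d} {T : Tensor n} → Admissible (2 ℕ.+ d) T → Lorentzian (2 ℕ.+ d) T →
  ∀ {vs} → All NonNeg vs → length vs ≡ d → ∀ x {y} → NonNeg y →
  polar (x ∷ x ∷ vs) T * polar (y ∷ y ∷ vs) T ≤ polar (x ∷ y ∷ vs) T * polar (x ∷ y ∷ vs) T
alexandrov–fenchel {T = T} adm lor {vs} vs≥0 len x {y} y≥0 = subst₂ _≤_
  (cong₂ _*_ (bil-hessian vs T x x) (bil-hessian vs T y y)) (cong₂ _*_ (bil-hessian vs T x y) (bil-hessian vs T x y))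
  (subst (λ ws → Hyperbolic (hessian ws T)) (++-identityʳ vs) (hyperbolic-mixed adm lor vs≥0 {[]} [] (trans (cong length (++-identityʳ vs)) len)) x y y≥0)

-- Products in disjoint variables

-- In disjoint variables a letter differentiates exactly one factor, so reading a word merely sorts
-- its letters and no Leibniz sum appears. `branch` takes the result of `splitAt` as an argument so
-- that proofs can split on it.
mutual
  _⊠_ : Tensor m → Tensor n → Tensor (m ℕ.+ n)
  (f ⊠ g) []      = f [] * g []
  _⊠_ {m} f g (i ∷ w) = branch f g (splitAt m i) w

  branch : Tensor m → Tensor n → Fin m ⊎ Fin n → Tensor (m ℕ.+ n)
  branch f g (inj₁ a) w = (∂ a f ⊠ g) w
  branch f g (inj₂ b) w = (f ⊠ ∂ b g) w

branch₂ : Tensor m → Tensor n → Fin m ⊎ Fin n → Fin m ⊎ Fin n → Tensor (m ℕ.+ n)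
branch₂ f g (inj₁ a) t = branch (∂ a f) g t
branch₂ f g (inj₂ b) t = branch f (∂ b g) t

⊠-∷∷ : (f : Tensor m) (g : Tensor n) → ∀ i k w → (f ⊠ g) (i ∷ k ∷ w) ≡ branch₂ f g (splitAt m i) (splitAt m k) w
⊠-∷∷ {m} f g i k w = unfold (splitAt m i)
  where
  unfold : ∀ s → branch f g s (k ∷ w) ≡ branch₂ f g s (splitAt m k) w
  unfold (inj₁ a) = refl
  unfold (inj₂ b) = refl

⊠-cong : {f f′ : Tensor m} {g g′ : Tensor n} → (∀ w → f w ≡ f′ w) → (∀ w → g w ≡ g′ w) → ∀ w → (f ⊠ g) w ≡ (f′ ⊠ g′) w
⊠-cong f≡ g≡ [] = cong₂ _*_ (f≡ []) (g≡ [])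
⊠-cong {m} {f = f} {f′} {g} {g′} f≡ g≡ (i ∷ w) = go (splitAt m i)
  where
  go : ∀ s → branch f g s w ≡ branch f′ g′ s w
  go (inj₁ a) = ⊠-cong (λ w → f≡ (a ∷ w)) g≡ w
  go (inj₂ b) = ⊠-cong f≡ (λ w → g≡ (b ∷ w)) w

⊠-split : (f : Tensor m) (g : Tensor n) → ∀ w → (f ⊠ g) w ≢ 0ℚ →
  ∃ λ u → ∃ λ v → f u ≢ 0ℚ × g v ≢ 0ℚ × length w ≡ length u ℕ.+ length v
⊠-split f g [] ≢0 = [] , [] , (λ e → ≢0 (*-≡0ˡ (g []) e)) , (λ e → ≢0 (*-≡0ʳ (f []) e)) , refl
⊠-split {m} f g (i ∷ w) = go (splitAt m i)
  where
  go : ∀ s → branch f g s w ≢ 0ℚ → ∃ λ u → ∃ λ v → f u ≢ 0ℚ × g v ≢ 0ℚ × suc (length w) ≡ length u ℕ.+ length v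
  go (inj₁ a) ≢0 = let u , v , p , q , e = ⊠-split (∂ a f) g w ≢0 in a ∷ u , v , p , q , cong suc e
  go (inj₂ b) ≢0 = let u , v , p , q , e = ⊠-split f (∂ b g) w ≢0 in u , b ∷ v , p , q , trans (cong suc e) (sym (+-suc (length u) (length v)))

⊠-join : (f : Tensor m) (g : Tensor n) → ∀ u v → f u ≢ 0ℚ → g v ≢ 0ℚ → ∃ λ w → (f ⊠ g) w ≢ 0ℚ
⊠-join f g [] [] p q = [] , product≢0
  where
  product≢0 : f [] * g [] ≢ 0ℚ
  product≢0 e = p (trans (sym (trans (solve 3 (λ a b c → a :* b :* c := c :* b :* a) refl (f []) (g []) (recip (g []))) (trans (cong (_* f []) (recip-inverse q)) (*-identityˡ (f []))))) (*-≡0ˡ (recip (g [])) e))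
⊠-join {m} {n} f g [] (b ∷ v) p q = let w , ≢0 = ⊠-join f (∂ b g) [] v p q in
  (m ↑ʳ b) ∷ w , λ e → ≢0 (trans (sym (cong (λ s → branch f g s w) (splitAt-↑ʳ m n b))) e)
⊠-join {m} {n} f g (a ∷ u) v p q = let w , ≢0 = ⊠-join (∂ a f) g u v p q in
  (a ↑ˡ n) ∷ w , λ e → ≢0 (trans (sym (cong (λ s → branch f g s w) (splitAt-↑ˡ m a n))) e)

⊠-symmetric : {f : Tensor m} {g : Tensor n} → Symmetric f → Symmetric g → Symmetric (f ⊠ g)
⊠-symmetric {m} {f = f} {g} f-sym g-sym [] i k w =
  trans (⊠-∷∷ f g i k w) (trans (swap (splitAt m i) (splitAt m k)) (sym (⊠-∷∷ f g k i w)))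
  where
  swap : ∀ s t → branch₂ f g s t w ≡ branch₂ f g t s w
  swap (inj₁ a) (inj₁ b) = ⊠-cong (f-sym [] a b) (λ _ → refl) w
  swap (inj₁ a) (inj₂ b) = refl
  swap (inj₂ a) (inj₁ b) = refl
  swap (inj₂ a) (inj₂ b) = ⊠-cong {f = f} (λ _ → refl) (g-sym [] a b) w
⊠-symmetric {m} {f = f} {g} f-sym g-sym (l ∷ u) i k w = go (splitAt m l)
  where
  go : ∀ s → branch f g s (u ++ i ∷ k ∷ w) ≡ branch f g s (u ++ k ∷ i ∷ w)
  go (inj₁ a) = ⊠-symmetric (λ u → f-sym (a ∷ u)) g-sym u i k w
  go (inj₂ b) = ⊠-symmetric f-sym (λ u → g-sym (b ∷ u)) u i k w

⊠-nonnegative : {f : Tensor m} {g : Tensor n} → (∀ w → 0ℚ ≤ f w) → (∀ w → 0ℚ ≤ g w) → ∀ w → 0ℚ ≤ (f ⊠ g) w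
⊠-nonnegative f≥0 g≥0 [] = 0≤* (f≥0 []) (g≥0 [])
⊠-nonnegative {m} {f = f} {g} f≥0 g≥0 (i ∷ w) = go (splitAt m i)
  where
  go : ∀ s → 0ℚ ≤ branch f g s w
  go (inj₁ a) = ⊠-nonnegative (λ u → f≥0 (a ∷ u)) g≥0 w
  go (inj₂ b) = ⊠-nonnegative f≥0 (λ u → g≥0 (b ∷ u)) w

⊠-admissible : ∀ {D E} {f : Tensor m} {g : Tensor n} → Admissible D f → Admissible E g → Admissible (D ℕ.+ E) (f ⊠ g)
⊠-admissible {f = f} {g} F G = record
  { symmetric   = ⊠-symmetric (symmetric F) (symmetric G)
  ; nonnegative = ⊠-nonnegative (nonnegative F) (nonnegative G)
  ; homogeneous = λ w ≢0 → let u , v , p , q , e = ⊠-split f g w ≢0 in trans e (cong₂ ℕ._+_ (homogeneous F u p) (homogeneous G v q)) }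

vanishes : ∀ {D} {T : Tensor n} → Admissible D T → ∀ w → length w ≢ D → T w ≡ 0ℚ
vanishes {T = T} adm w len = decidable-stable (T w ℚP.≟ 0ℚ) λ T≢0 → len (homogeneous adm w T≢0)

Lorentzian-∂ : ∀ D {T : Tensor n} → Lorentzian (suc D) T → ∀ i → Lorentzian D (∂ i T)
Lorentzian-∂ 0             _         i = tt
Lorentzian-∂ 1             _         i = tt
Lorentzian-∂ (suc (suc D)) (_ , lor) i = lor i

bil-zero : {M : Matrix n n} → (∀ a b → M a b ≡ 0ℚ) → ∀ x y → bil M x y ≡ 0ℚ
bil-zero {M = M} M≡0 x y = sum-zero λ a → *-≡0ʳ (x a) (sum-zero λ b → *-≡0ˡ (y b) (M≡0 a b))

hyperbolic-zero : {M : Matrix n n} → (∀ a b → M a b ≡ 0ℚ) → Hyperbolic M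
hyperbolic-zero {M = M} M≡0 x y _ = subst (_≤ bil M x y * bil M x y) (sym (*-≡0ˡ (bil M y y) (bil-zero M≡0 x x))) (0≤² (bil M x y))

-- Derivatives may vanish, along a repeated letter or a letter of an exhausted factor, so the zero
-- polynomial has to count as Lorentzian.
Lorentzian-zero : ∀ D {T : Tensor n} → (∀ w → T w ≡ 0ℚ) → Lorentzian D T
Lorentzian-zero 0 _ = tt
Lorentzian-zero 1 _ = tt
Lorentzian-zero 2 T≡0 = (λ i u k w T≢0 _ → contradiction (T≡0 (i ∷ u)) T≢0) , hyperbolic-zero (λ a b → T≡0 (a ∷ b ∷ []))
Lorentzian-zero (suc (suc (suc D))) T≡0 = (λ i u k w T≢0 _ → contradiction (T≡0 (i ∷ u)) T≢0) , λ i → Lorentzian-zero (suc (suc D)) (λ w → T≡0 (i ∷ w))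

Lorentzian⇒Indecomposable : ∀ {D} {T : Tensor n} → 2 ℕ.≤ D → Lorentzian D T → Indecomposable T
Lorentzian⇒Indecomposable {D = 2}                 _ = proj₁
Lorentzian⇒Indecomposable {D = suc (suc (suc D))} _ = proj₁
Lorentzian⇒Indecomposable {D = 1} (ℕ.s≤s ())

module _ {f : Tensor m} {g : Tensor n} where

  private
    Link : Fin m ⊎ Fin n → Fin m ⊎ Fin n → Set
    Link s t = ∃ λ w → branch₂ f g s t w ≢ 0ℚ

    Joined : Fin m ⊎ Fin n → Fin m ⊎ Fin n → Set
    Joined s t = s ≡ t ⊎ Link s t ⊎ ∃ λ r → Link s r × Link r t

    cross : ∀ a u b v → f (a ∷ u) ≢ 0ℚ → g (b ∷ v) ≢ 0ℚ → Link (inj₁ a) (inj₂ b)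
    cross a u b v p q = ⊠-join (∂ a f) (∂ b g) u v p q

    linkˡ : ∀ v → g v ≢ 0ℚ → ∀ {a b} → Linked f a b → Link (inj₁ a) (inj₁ b)
    linkˡ v q {a} {b} (u , p) = ⊠-join (∂ b (∂ a f)) g u v p q

    linkʳ : ∀ u → f u ≢ 0ℚ → ∀ {a b} → Linked g a b → Link (inj₂ a) (inj₂ b)
    linkʳ u p {a} {b} (v , q) = ⊠-join f (∂ b (∂ a g)) u v p q

  module _ {D E : ℕ} (2≤D+E : 2 ℕ.≤ D ℕ.+ E) (F : Admissible D f) (G : Admissible E g) (lorF : Lorentzian D f) (lorG : Lorentzian E g) where

    private
      2≤-left : ∀ {A B} → 2 ℕ.≤ A ℕ.+ B → 0 ≡ B → 2 ℕ.≤ A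
      2≤-left {A} le refl = subst (2 ℕ.≤_) (ℕP.+-identityʳ A) le

      linked : ∀ s t w w′ → branch f g s w ≢ 0ℚ → branch f g t w′ ≢ 0ℚ → Joined s t
      linked (inj₁ a) (inj₂ b) w w′ p q =
        let u , _ , fu , _ = ⊠-split (∂ a f) g w p
            _ , v , _ , gv , _ = ⊠-split f (∂ b g) w′ q
        in inj₂ (inj₁ (cross a u b v fu gv))
      linked (inj₂ b) (inj₁ a) w w′ p q =
        let _ , v , _ , gv , _ = ⊠-split f (∂ b g) w p
            u , _ , fu , _ = ⊠-split (∂ a f) g w′ q
        in inj₂ (inj₁ (cross a u b v fu gv))
      linked (inj₁ a) (inj₁ b) w w′ p q =
        let u , v , fu , gv , _ = ⊠-split (∂ a f) g w p
            u′ , _ , fu′ , _ = ⊠-split (∂ b f) g w′ q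
        in go u u′ v fu fu′ gv (homogeneous G v gv)
        where
        go : ∀ u u′ v → f (a ∷ u) ≢ 0ℚ → f (b ∷ u′) ≢ 0ℚ → g v ≢ 0ℚ → length v ≡ E → Joined (inj₁ a) (inj₁ b)
        -- A variable `c` still left in `g` is adjacent to both `a` and `b`. If there is none, `g`
        -- has degree zero, `f` has degree at least two, and the indecomposability of `f` itself
        -- applies.
        go u u′ (c ∷ v) fu fu′ gv _ = inj₂ (inj₂ (inj₂ c , cross a u c v fu gv , cross b u′ c v fu′ gv))
        go u u′ []      fu fu′ gv e = Sum.map (cong inj₁) (Sum.map (linkˡ [] gv) (λ (l , i , j) → inj₁ l , linkˡ [] gv i , linkˡ [] gv j))
          (Lorentzian⇒Indecomposable (2≤-left 2≤D+E e) lorF a u b u′ fu fu′)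
      linked (inj₂ a) (inj₂ b) w w′ p q =
        let u , v , fu , gv , _ = ⊠-split f (∂ a g) w p
            _ , v′ , _ , gv′ , _ = ⊠-split f (∂ b g) w′ q
        in go v v′ u gv gv′ fu (homogeneous F u fu)
        where
        go : ∀ v v′ u → g (a ∷ v) ≢ 0ℚ → g (b ∷ v′) ≢ 0ℚ → f u ≢ 0ℚ → length u ≡ D → Joined (inj₂ a) (inj₂ b)
        go v v′ (c ∷ u) gv gv′ fu _ = inj₂ (inj₂ (inj₁ c , cross c u a v fu gv , cross c u b v′ fu gv′))
        go v v′ []      gv gv′ fu e = Sum.map (cong inj₂) (Sum.map (linkʳ [] fu) (λ (l , i , j) → inj₂ l , linkʳ [] fu i , linkʳ [] fu j))
          (Lorentzian⇒Indecomposable (2≤-left (subst (2 ℕ.≤_) (ℕP.+-comm D E) 2≤D+E) e) lorG a v b v′ gv gv′)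

    ⊠-indecomposable : Indecomposable (f ⊠ g)
    ⊠-indecomposable i u k w p q = Sum.map
      (λ e → trans (sym (join-splitAt m n i)) (trans (cong (join m n) e) (join-splitAt m n k)))
      (Sum.map (λ (w , ≢0) → w , λ e → ≢0 (trans (sym (⊠-∷∷ f g i k w)) e))
        λ (r , (w , ≢0) , (w′ , ≢0′)) → join m n r
          , (w , λ e → ≢0 (trans (cong (λ s → branch₂ f g (splitAt m i) s w) (sym (splitAt-join m n r))) (trans (sym (⊠-∷∷ f g i (join m n r) w)) e)))
          , (w′ , λ e → ≢0′ (trans (cong (λ s → branch₂ f g s (splitAt m k) w′) (sym (splitAt-join m n r))) (trans (sym (⊠-∷∷ f g (join m n r) k w′)) e))))
      (linked (splitAt m i) (splitAt m k) u w p q)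

sum-↑ : ∀ m {n} (F : Fin (m ℕ.+ n) → ℚ) → sum F ≡ sum (λ a → F (a ↑ˡ n)) + sum (λ b → F (m ↑ʳ b))
sum-↑ zero    F = sym (+-identityˡ (sum F))
sum-↑ (suc m) F = trans (cong (F zero +_) (sum-↑ m (λ i → F (suc i)))) (sym (ℚP.+-assoc (F zero) _ _))

module _ (H : Matrix (m ℕ.+ n) (m ℕ.+ n)) (x y : Vect (m ℕ.+ n)) where
  private
    xˡ yˡ : Vect m
    xˡ a = x (a ↑ˡ n)
    yˡ a = y (a ↑ˡ n)
    xʳ yʳ : Vect n
    xʳ b = x (m ↑ʳ b)
    yʳ b = y (m ↑ʳ b)

  bil-blocks : {A : Matrix m m} {B : Matrix m n} {C : Matrix n m} {D : Matrix n n} →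
    (∀ a b → H (a ↑ˡ n) (b ↑ˡ n) ≡ A a b) → (∀ a b → H (a ↑ˡ n) (m ↑ʳ b) ≡ B a b) →
    (∀ a b → H (m ↑ʳ a) (b ↑ˡ n) ≡ C a b) → (∀ a b → H (m ↑ʳ a) (m ↑ʳ b) ≡ D a b) →
    bil H x y ≡ (bil A xˡ yˡ + dot xˡ (app B yʳ)) + (dot xʳ (app C yˡ) + bil D xʳ yʳ)
  bil-blocks {A} {B} {C} {D} A≡ B≡ C≡ D≡ = trans (sum-↑ m (λ i → x i * app H y i)) (cong₂ _+_
    (trans (sum-cong-≗ λ a → trans (cong (xˡ a *_) (trans (sum-↑ m (λ i → H (a ↑ˡ n) i * y i))
        (cong₂ _+_ (sum-cong-≗ λ b → cong (_* yˡ b) (A≡ a b)) (sum-cong-≗ λ b → cong (_* yʳ b) (B≡ a b)))))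
      (*-distribˡ-+ (xˡ a) (app A yˡ a) (app B yʳ a))) (sum-+ (λ a → xˡ a * app A yˡ a) (λ a → xˡ a * app B yʳ a)))
    (trans (sum-cong-≗ λ a → trans (cong (xʳ a *_) (trans (sum-↑ m (λ i → H (m ↑ʳ a) i * y i))
        (cong₂ _+_ (sum-cong-≗ λ b → cong (_* yˡ b) (C≡ a b)) (sum-cong-≗ λ b → cong (_* yʳ b) (D≡ a b)))))
      (*-distribˡ-+ (xʳ a) (app C yˡ a) (app D yʳ a))) (sum-+ (λ a → xʳ a * app C yˡ a) (λ a → xʳ a * app D yʳ a))))

dot-app-rank-one : (p x : Vect m) (q y : Vect n) → dot x (app (λ a b → p a * q b) y) ≡ dot p x * dot q y
dot-app-rank-one p x q y = trans
  (sum-cong-≗ λ a → trans (cong (x a *_) (trans (sum-cong-≗ λ b → *-assoc (p a) (q b) (y b)) (sum-* (p a) (λ b → q b * y b))))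
    (solve 3 (λ x p s → x :* (p :* s) := s :* (p :* x)) refl (x a) (p a) (dot q y)))
  (trans (sum-* (dot q y) (λ a → p a * x a)) (*-comm (dot q y) (dot p x)))

module _ {f : Tensor m} {g : Tensor n} where

  private
    H : Matrix (m ℕ.+ n) (m ℕ.+ n)
    H = hessian [] (f ⊠ g)

    _ˡ : Vect (m ℕ.+ n) → Vect m
    (x ˡ) a = x (a ↑ˡ n)

    _ʳ : Vect (m ℕ.+ n) → Vect n
    (x ʳ) b = x (m ↑ʳ b)

    p q : Vect (m ℕ.+ n) → ℚ
    p x = dot (λ a → f (a ∷ [])) (x ˡ)
    q x = dot (λ b → g (b ∷ [])) (x ʳ)

    entry : ∀ s t → H (join m n s) (join m n t) ≡ branch₂ f g s t []
    entry s t = trans (⊠-∷∷ f g (join m n s) (join m n t) [])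
      (cong₂ (λ s t → branch₂ f g s t []) (splitAt-join m n s) (splitAt-join m n t))

    bil-⊠ : ∀ x y → bil H x y ≡ (g [] * bil (hessian [] f) (x ˡ) (y ˡ) + p x * q y) + (p y * q x + f [] * bil (hessian [] g) (x ʳ) (y ʳ))
    bil-⊠ x y = trans
      (bil-blocks H x y {λ a b → g [] * f (a ∷ b ∷ [])} {λ a b → f (a ∷ []) * g (b ∷ [])} {λ b a → g (b ∷ []) * f (a ∷ [])} {λ a b → f [] * g (a ∷ b ∷ [])}
        (λ a b → trans (entry (inj₁ a) (inj₁ b)) (*-comm (f (a ∷ b ∷ [])) (g [])))
        (λ a b → entry (inj₁ a) (inj₂ b))
        (λ a b → trans (entry (inj₂ a) (inj₁ b)) (*-comm (f (b ∷ [])) (g (a ∷ []))))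
        (λ a b → entry (inj₂ a) (inj₂ b)))
      (cong₂ _+_
        (cong₂ _+_ (bil-scale (g []) (hessian [] f) (x ˡ) (y ˡ)) (dot-app-rank-one (λ a → f (a ∷ [])) (x ˡ) (λ b → g (b ∷ [])) (y ʳ)))
        (cong₂ _+_ (trans (dot-app-rank-one (λ b → g (b ∷ [])) (x ʳ) (λ a → f (a ∷ [])) (y ˡ)) (*-comm (q x) (p y))) (bil-scale (f []) (hessian [] g) (x ʳ) (y ʳ))))

    zero-dot : ∀ {k} {u : Vect k} (z : Vect k) → (∀ a → u a ≡ 0ℚ) → dot u z ≡ 0ℚ
    zero-dot z u≡0 = sum-zero λ a → *-≡0ˡ (z a) (u≡0 a)

  -- Homogeneity of `f` removes the mixed blocks and the block of `g`; what remains is the Hessian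
  -- of `f` scaled by the constant `g []`.
  ⊠-hyperbolic-2-0 : Admissible 2 f → Hyperbolic (hessian [] f) → Hyperbolic H
  ⊠-hyperbolic-2-0 F hyp x y y≥0 = subst₂ _≤_ (sym (cong₂ _*_ (value x x) (value y y))) (sym (cong₂ _*_ (value x y) (value x y)))
    (scale-≤ (g []) (hyp (x ˡ) (y ˡ) (λ a → y≥0 (a ↑ˡ n))))
    where
    p≡0 : ∀ x → p x ≡ 0ℚ
    p≡0 x = zero-dot (x ˡ) λ a → vanishes F (a ∷ []) (λ ())
    value : ∀ x y → bil H x y ≡ g [] * bil (hessian [] f) (x ˡ) (y ˡ)
    value x y = trans (bil-⊠ x y) (trans
      (cong₂ (λ s t → (v + s * q y) + (t * q x + f [] * w)) (p≡0 x) (p≡0 y)) (trans (cong (λ s → (v + 0ℚ * q y) + (0ℚ * q x + s * w)) (vanishes F [] (λ ())))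
      (solve 4 (λ v a b w → (v :+ con 0ℚ :* a) :+ (con 0ℚ :* b :+ con 0ℚ :* w) := v) refl v (q y) (q x) w)))
      where
      v = g [] * bil (hessian [] f) (x ˡ) (y ˡ)
      w = bil (hessian [] g) (x ʳ) (y ʳ)

  ⊠-hyperbolic-0-2 : Admissible 2 g → Hyperbolic (hessian [] g) → Hyperbolic H
  ⊠-hyperbolic-0-2 G hyp x y y≥0 = subst₂ _≤_ (sym (cong₂ _*_ (value x x) (value y y))) (sym (cong₂ _*_ (value x y) (value x y)))
    (scale-≤ (f []) (hyp (x ʳ) (y ʳ) (λ a → y≥0 (m ↑ʳ a))))
    where
    q≡0 : ∀ x → q x ≡ 0ℚ
    q≡0 x = zero-dot (x ʳ) λ a → vanishes G (a ∷ []) (λ ())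
    value : ∀ x y → bil H x y ≡ f [] * bil (hessian [] g) (x ʳ) (y ʳ)
    value x y = trans (bil-⊠ x y) (trans
      (cong₂ (λ s t → (g [] * w + p x * s) + (p y * t + v)) (q≡0 y) (q≡0 x)) (trans (cong (λ s → (s * w + p x * 0ℚ) + (p y * 0ℚ + v)) (vanishes G [] (λ ())))
      (solve 4 (λ v a b w → (con 0ℚ :* w :+ a :* con 0ℚ) :+ (b :* con 0ℚ :+ v) := v) refl v (p x) (p y) w)))
      where
      v = f [] * bil (hessian [] g) (x ʳ) (y ʳ)
      w = bil (hessian [] f) (x ˡ) (y ˡ)

  -- For a product of two linear forms the discriminant is the perfect square
  -- `(p x * q y − p y * q x)²`.
  ⊠-hyperbolic-1-1 : Admissible 1 f → Admissible 1 g → Hyperbolic H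
  ⊠-hyperbolic-1-1 F G x y y≥0 = ≤-from (0≤² (p x * q y - p y * q x))
      (trans (solve 4 (λ px py qx qy → (px :* qy :- py :* qx) :* (px :* qy :- py :* qx)
          := (px :* qy :+ py :* qx) :* (px :* qy :+ py :* qx) :- (px :* qx :+ px :* qx) :* (py :* qy :+ py :* qy)) refl (p x) (p y) (q x) (q y))
        (sym (cong₂ _-_ (cong₂ _*_ (value x y) (value x y)) (cong₂ _*_ (value x x) (value y y)))))
    where
    value : ∀ x y → bil H x y ≡ p x * q y + p y * q x
    value x y = trans (bil-⊠ x y) (trans
      (cong₂ (λ s t → (s * v + p x * q y) + (p y * q x + t * w)) (vanishes G [] (λ ())) (vanishes F [] (λ ())))
      (solve 4 (λ a b v w → (con 0ℚ :* v :+ a) :+ (b :+ con 0ℚ :* w) := a :+ b) refl (p x * q y) (p y * q x) v w))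
      where
      v = bil (hessian [] f) (x ˡ) (y ˡ)
      w = bil (hessian [] g) (x ʳ) (y ʳ)

⊠-hyperbolic : ∀ D E → D ℕ.+ E ≡ 2 → {f : Tensor m} {g : Tensor n} → Admissible D f → Admissible E g →
  Lorentzian D f → Lorentzian E g → Hyperbolic (hessian [] (f ⊠ g))
⊠-hyperbolic 0 .2 refl F G _ lorG = ⊠-hyperbolic-0-2 G (proj₂ lorG)
⊠-hyperbolic 1 .1 refl F G _ _    = ⊠-hyperbolic-1-1 F G
⊠-hyperbolic 2 .0 refl F G lorF _ = ⊠-hyperbolic-2-0 F (proj₂ lorF)
⊠-hyperbolic (suc (suc (suc D))) E ()

zero-⊠ : {f : Tensor m} {g : Tensor n} → (∀ w → f w ≡ 0ℚ) ⊎ (∀ w → g w ≡ 0ℚ) → ∀ w → (f ⊠ g) w ≡ 0ℚ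
zero-⊠ {f = f} {g} z w = decidable-stable ((f ⊠ g) w ℚP.≟ 0ℚ) λ ≢0 →
  let u , v , p , q , _ = ⊠-split f g w ≢0 in Sum.[ (λ f≡0 → p (f≡0 u)) , (λ g≡0 → q (g≡0 v)) ] z

⊠-Lorentzian : ∀ D {D₁ D₂} → D₁ ℕ.+ D₂ ≡ D → {f : Tensor m} {g : Tensor n} → Admissible D₁ f → Admissible D₂ g →
  Lorentzian D₁ f → Lorentzian D₂ g → Lorentzian D (f ⊠ g)
⊠-Lorentzian 0 _ _ _ _ _ = tt
⊠-Lorentzian 1 _ _ _ _ _ = tt
⊠-Lorentzian 2 {D₁} {D₂} e F G lorF lorG =
  ⊠-indecomposable (ℕP.≤-reflexive (sym e)) F G lorF lorG , ⊠-hyperbolic D₁ D₂ e F G lorF lorG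
⊠-Lorentzian {m} (suc (suc (suc D))) {D₁} {D₂} e {f} {g} F G lorF lorG =
  ⊠-indecomposable (subst (2 ℕ.≤_) (sym e) (ℕ.s≤s (ℕ.s≤s ℕ.z≤n))) F G lorF lorG , λ i → go D₁ D₂ e F G lorF lorG (splitAt m i)
  where
  go : ∀ D₁ D₂ → D₁ ℕ.+ D₂ ≡ suc (suc (suc D)) → Admissible D₁ f → Admissible D₂ g → Lorentzian D₁ f → Lorentzian D₂ g →
    ∀ s → Lorentzian (suc (suc D)) (branch f g s)
  go zero     D₂ e F G lorF lorG (inj₁ a) = Lorentzian-zero (suc (suc D)) (zero-⊠ {f = ∂ a f} {g} (inj₁ λ w → vanishes F (a ∷ w) (λ ())))
  go (suc D₁) D₂ e F G lorF lorG (inj₁ a) = ⊠-Lorentzian (suc (suc D)) (suc-injective e) (∂-admissible F a) G (Lorentzian-∂ D₁ lorF a) lorG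
  go D₁ zero     e F G lorF lorG (inj₂ b) = Lorentzian-zero (suc (suc D)) (zero-⊠ {f = f} {∂ b g} (inj₂ λ w → vanishes G (b ∷ w) (λ ())))
  go D₁ (suc D₂) e F G lorF lorG (inj₂ b) = ⊠-Lorentzian (suc (suc D)) (suc-injective (trans (sym (+-suc D₁ D₂)) e)) F (∂-admissible G b) lorF (Lorentzian-∂ D₂ lorG b)

-- Quadratic forms of equivalence relations and multipartite graphs

ι : ℕ → ℚ
ι k = k · 1ℚ

0≤ι : ∀ k → 0ℚ ≤ ι k
0≤ι zero    = ℚP.≤-refl
0≤ι (suc k) = 0≤+ (nonNegative⁻¹ 1ℚ) (0≤ι k)

0<ι : ∀ k → 0ℚ < ι (suc k)
0<ι k = 0<+ (positive⁻¹ 1ℚ) (0≤ι k)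

𝕀 : {P : Set} → Dec P → ℚ
𝕀 (yes _) = 1ℚ
𝕀 (no _)  = 0ℚ

𝕀-yes : {P : Set} (d : Dec P) → P → 𝕀 d ≡ 1ℚ
𝕀-yes (yes _) p = refl
𝕀-yes (no ¬p) p = contradiction p ¬p

𝕀-no : {P : Set} (d : Dec P) → ¬ P → 𝕀 d ≡ 0ℚ
𝕀-no (yes p) ¬p = contradiction p ¬p
𝕀-no (no _)  ¬p = refl

0≤𝕀 : {P : Set} (d : Dec P) → 0ℚ ≤ 𝕀 d
0≤𝕀 (yes _) = nonNegative⁻¹ 1ℚ
0≤𝕀 (no _)  = ℚP.≤-refl

𝕀-mono : {P Q : Set} (p : Dec P) (q : Dec Q) → (P → Q) → 𝕀 p ≤ 𝕀 q
𝕀-mono (no _)  q       f = 0≤𝕀 q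
𝕀-mono (yes p) (yes _) f = ℚP.≤-refl
𝕀-mono (yes p) (no ¬q) f = contradiction (f p) ¬q

𝕀-cong : {P Q : Set} (p : Dec P) (q : Dec Q) → (P → Q) → (Q → P) → 𝕀 p ≡ 𝕀 q
𝕀-cong p q f g = ℚP.≤-antisym (𝕀-mono p q f) (𝕀-mono q p g)

-- Elements unrelated to themselves, such as loops, lie in no class. Sums over classes are written
-- as sums over elements weighted by the inverse class size, which avoids choosing representatives.
module PartialEquivalence {n : ℕ} {E : Fin n → Fin n → Set} (E? : ∀ e f → Dec (E e f))
  (E-sym : ∀ {e f} → E e f → E f e) (E-trans : ∀ {e f g} → E e f → E f g → E e g) where

  rel : Matrix n n
  rel e f = 𝕀 (E? e f)

  active : Vect n
  active e = rel e e

  class-size class-weight : Vect n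
  class-size e = sum (rel e)
  class-weight e = recip (class-size e)

  rel-sym : ∀ e f → rel e f ≡ rel f e
  rel-sym e f = 𝕀-cong (E? e f) (E? f e) E-sym E-sym

  rel-row : ∀ {e g} → E g e → ∀ f → rel g f ≡ rel e f
  rel-row {e} {g} ge f = 𝕀-cong (E? g f) (E? e f) (E-trans (E-sym ge)) (E-trans ge)

  0≤size : ∀ e → 0ℚ ≤ class-size e
  0≤size e = sum-0≤ λ f → 0≤𝕀 (E? e f)

  inactive-row : ∀ {e} → ¬ E e e → ∀ f → rel e f ≡ 0ℚ
  inactive-row {e} ¬ee f = 𝕀-no (E? e f) λ ef → ¬ee (E-trans ef (E-sym ef))

  active-size : ∀ {e} → E e e → 0ℚ < class-size e
  active-size {e} ee = sum-0< (λ f → 0≤𝕀 (E? e f)) e (subst (0ℚ <_) (sym (𝕀-yes (E? e e) ee)) (positive⁻¹ 1ℚ))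

  size-inverse : ∀ e → class-weight e * class-size e ≡ active e
  size-inverse e = go (E? e e)
    where
    go : (d : Dec (E e e)) → class-weight e * class-size e ≡ 𝕀 d
    go (yes ee) = recip-inverse (λ s≡0 → <⇒≢ (active-size ee) (sym s≡0))
    go (no ¬ee) = *-≡0ʳ (class-weight e) (sum-zero (inactive-row ¬ee))

  0≤weight : ∀ e → 0ℚ ≤ class-weight e
  0≤weight e = recip-0≤ (0≤size e)

  weight≤active : ∀ e → class-weight e ≤ active e
  weight≤active e = go (E? e e)
    where
    go : (d : Dec (E e e)) → class-weight e ≤ 𝕀 d
    go (no ¬ee) = ℚP.≤-reflexive (cong recip (sum-zero (inactive-row ¬ee)))
    go (yes ee) = cancel-≤ (active-size ee) (subst₂ _≤_ (sym (trans (*-comm (class-size e) (class-weight e)) (recip-inverse λ s≡0 → <⇒≢ (active-size ee) (sym s≡0)))) (sym (*-identityʳ (class-size e)))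
      (subst (_≤ class-size e) (𝕀-yes (E? e e) ee) (term≤sum (λ f → 0≤𝕀 (E? e f)) e)))

  class-sum : Vect n → Vect n
  class-sum z e = app rel z e

  -- Weight and `h` are constant on classes, so inside the double sum they move from `g` to `e`;
  -- summing over `g` then gives weight times class size, which is one on active elements.
  weighted : (h z : Vect n) → (∀ {e g} → E g e → h g ≡ h e) →
    sum (λ g → class-weight g * h g * class-sum z g) ≡ sum (λ e → active e * (h e * z e))
  weighted h z h-class = begin
    sum (λ g → w g * h g * sum (λ e → rel g e * z e))
      ≡⟨ sum-cong-≗ (λ g → sym (sum-* (w g * h g) (λ e → rel g e * z e))) ⟩
    sum (λ g → sum (λ e → w g * h g * (rel g e * z e)))
      ≡⟨ sum-swap (λ g e → w g * h g * (rel g e * z e)) ⟩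
    sum (λ e → sum (λ g → w g * h g * (rel g e * z e)))
      ≡⟨ sum-cong-≗ (λ e → trans (sum-cong-≗ (λ g → trans (transport g e (E? g e)) (cong (λ r → w e * h e * (r * z e)) (rel-sym g e)))) (trans (sum-cong-≗ (λ g → solve 4 (λ w h r z → w :* h :* (r :* z) := (w :* (h :* z)) :* r) refl (w e) (h e) (rel e g) (z e))) (trans (sum-* (w e * (h e * z e)) (rel e))
          (trans (solve 4 (λ w h z c → (w :* (h :* z)) :* c := w :* c :* (h :* z)) refl (w e) (h e) (z e) (class-size e)) (cong (_* (h e * z e)) (size-inverse e)))))) ⟩
    sum (λ e → active e * (h e * z e)) ∎
    where
    open ≡-Reasoning
    w = class-weight
    transport : ∀ g e (d : Dec (E g e)) → w g * h g * (𝕀 d * z e) ≡ w e * h e * (𝕀 d * z e)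
    transport g e (yes ge) = cong₂ (λ p q → p * q * (1ℚ * z e)) (cong recip (sum-cong-≗ (rel-row ge))) (h-class ge)
    transport g e (no _)   = trans (vanish (w g * h g)) (sym (vanish (w e * h e)))
      where
      vanish : ∀ c → c * (0ℚ * z e) ≡ 0ℚ
      vanish c = *-≡0ʳ c (*-zeroˡ (z e))

  class-sum-class : ∀ z {e g} → E g e → class-sum z g ≡ class-sum z e
  class-sum-class z ge = sum-cong-≗ λ f → cong (_* z f) (rel-row ge f)

  rel-form : ∀ z → bil rel z z ≡ sum (λ g → class-weight g * class-sum z g * class-sum z g)
  rel-form z = sym (trans (weighted (class-sum z) z (class-sum-class z)) (sum-cong-≗ λ e → term e (E? e e)))
    where
    term : ∀ e (d : Dec (E e e)) → 𝕀 d * (class-sum z e * z e) ≡ z e * class-sum z e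
    term e (yes _)  = trans (*-identityˡ (class-sum z e * z e)) (*-comm (class-sum z e) (z e))
    term e (no ¬ee) = trans (*-zeroˡ (class-sum z e * z e)) (sym (*-≡0ʳ (z e) (sum-zero λ f → *-≡0ˡ (z f) (inactive-row ¬ee f))))

  rel-form-0≤ : ∀ z → 0ℚ ≤ bil rel z z
  rel-form-0≤ z = subst (0ℚ ≤_) (sym (rel-form z)) (sum-0≤ λ g →
    subst (0ℚ ≤_) (sym (*-assoc (class-weight g) (class-sum z g) (class-sum z g))) (0≤* (0≤weight g) (0≤² (class-sum z g))))

  -- Cauchy–Schwarz over the classes; weighting each element by the inverse of its class size counts classes.
  rel-form-bound : ∀ {c} → 0ℚ < c → sum active ≤ c → ∀ z → dot active z * dot active z ≤ c * bil rel z z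
  rel-form-bound {c} c>0 size≤c z = cancel-≤ c>0 (≤-from (0≤+ variance (0≤* (0≤² Z) (≤⇒0≤- W≤c)))
      (solve 4 (λ c R Z W → (c :* c :* R :+ (:- con 2ℚ :* c :* Z) :* Z :+ Z :* Z :* W) :+ Z :* Z :* (c :- W) := c :* (c :* R) :- c :* (Z :* Z)) refl c R Z W))
    where
    w = class-weight
    s = class-sum z
    R = bil rel z z
    Z = dot active z
    W = sum w
    W≤c : W ≤ c
    W≤c = ℚP.≤-trans (sum-mono weight≤active) size≤c
    Z≡ : sum (λ g → w g * s g) ≡ Z
    Z≡ = trans (sum-cong-≗ λ g → cong (_* s g) (sym (*-identityʳ (w g)))) (trans (weighted 𝟙 z (λ _ → refl)) (sum-cong-≗ λ e → cong (active e *_) (*-identityˡ (z e))))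
    variance : 0ℚ ≤ c * c * R + (- 2ℚ * c * Z) * Z + Z * Z * W
    variance = subst (0ℚ ≤_) expand (sum-0≤ {f = λ g → w g * ((c * s g - Z) * (c * s g - Z))} λ g → 0≤* (0≤weight g) (0≤² (c * s g - Z)))
      where
      open ≡-Reasoning
      expand : sum (λ g → w g * ((c * s g - Z) * (c * s g - Z))) ≡ c * c * R + (- 2ℚ * c * Z) * Z + Z * Z * W
      expand = begin
        sum (λ g → w g * ((c * s g - Z) * (c * s g - Z)))
          ≡⟨ sum-cong-≗ (λ g → solve 4 (λ w c s Z → w :* ((c :* s :- Z) :* (c :* s :- Z)) := con 1ℚ :* (c :* c :* (w :* s :* s) :+ (:- con 2ℚ :* c :* Z) :* (w :* s)) :+ Z :* Z :* w) refl (w g) c (s g) Z) ⟩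
        sum (λ g → 1ℚ * (c * c * (w g * s g * s g) + (- 2ℚ * c * Z) * (w g * s g)) + Z * Z * w g)
          ≡⟨ sum-linear 1ℚ (Z * Z) (λ g → c * c * (w g * s g * s g) + (- 2ℚ * c * Z) * (w g * s g)) w ⟩
        1ℚ * sum (λ g → c * c * (w g * s g * s g) + (- 2ℚ * c * Z) * (w g * s g)) + Z * Z * W
          ≡⟨ cong (_+ Z * Z * W) (trans (*-identityˡ _) (sum-linear (c * c) (- 2ℚ * c * Z) (λ g → w g * s g * s g) (λ g → w g * s g))) ⟩
        c * c * sum (λ g → w g * s g * s g) + (- 2ℚ * c * Z) * sum (λ g → w g * s g) + Z * Z * W
          ≡⟨ cong₂ (λ p q → c * c * p + (- 2ℚ * c * Z) * q + Z * Z * W) (sym (rel-form z)) Z≡ ⟩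
        c * c * R + (- 2ℚ * c * Z) * Z + Z * Z * W ∎

bil-bordered : (M : Matrix (suc n) (suc n)) {a : ℚ} {b : Vect n} {G : Matrix n n} →
  M zero zero ≡ a → (∀ e → M zero (suc e) ≡ b e) → (∀ e → M (suc e) zero ≡ b e) → (∀ e f → M (suc e) (suc f) ≡ G e f) →
  ∀ x → let s = x zero; z = λ e → x (suc e) in
  bil M x x ≡ a * s * s + 2ℚ * s * dot b z + bil G z z
bil-bordered M {a} {b} {G} a≡ b≡ b≡′ G≡ x = begin
  s * (M zero zero * s + dot (λ e → M zero (suc e)) z) + sum (λ e → z e * (M (suc e) zero * s + sum (λ f → M (suc e) (suc f) * z f)))
    ≡⟨ cong₂ (λ p q → s * p + q) (cong₂ (λ p q → p * s + q) a≡ (sum-cong-≗ λ e → cong (_* z e) (b≡ e)))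
        (sum-cong-≗ λ e → trans (cong (z e *_) (cong₂ (λ p q → p * s + q) (b≡′ e) (sum-cong-≗ λ f → cong (_* z f) (G≡ e f))))
          (solve 4 (λ z b s g → z :* (b :* s :+ g) := s :* (b :* z) :+ con 1ℚ :* (z :* g)) refl (z e) (b e) s (app G z e))) ⟩
  s * (a * s + dot b z) + sum (λ e → s * (b e * z e) + 1ℚ * (z e * app G z e))
    ≡⟨ cong (s * (a * s + dot b z) +_) (sum-linear s 1ℚ (λ e → b e * z e) (λ e → z e * app G z e)) ⟩
  s * (a * s + dot b z) + (s * dot b z + 1ℚ * bil G z z)
    ≡⟨ solve 4 (λ s a b g → s :* (a :* s :+ b) :+ (s :* b :+ con 1ℚ :* g) := a :* s :* s :+ con 2ℚ :* s :* b :+ g) refl s a (dot b z) (bil G z z) ⟩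
  a * s * s + 2ℚ * s * dot b z + bil G z z ∎
  where
  open ≡-Reasoning
  s = x zero
  z : Vect _
  z e = x (suc e)

infixr 5 _◂_

_◂_ : ℚ → Vect n → Vect (suc n)
(c ◂ v) zero    = c
(c ◂ v) (suc i) = v i

-- The complement of G on the vertices satisfying A is an equivalence relation, so that
-- G is complete multipartite.
module Multipartite {n : ℕ} {A : Fin n → Set} (A? : ∀ e → Dec (A e)) {G : Fin n → Fin n → Set} (G? : ∀ e f → Dec (G e f))
  (G-irrefl : ∀ {e} → ¬ G e e) (G-sym : ∀ {e f} → G e f → G f e) (G⇒A : ∀ {e f} → G e f → A e)
  (G-cotrans : ∀ {e f g} → A e → A f → A g → ¬ G e f → ¬ G f g → ¬ G e g) where

  E? : ∀ e f → Dec (A e × A f × ¬ G e f)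
  E? e f = A? e ×-dec A? f ×-dec ¬? (G? e f)

  open PartialEquivalence E?
    (λ (a , b , ¬g) → b , a , λ g → ¬g (G-sym g))
    (λ (a , b , ¬g) (_ , c , ¬g′) → a , c , G-cotrans a b c ¬g ¬g′) public

  active≡ : ∀ e → active e ≡ 𝕀 (A? e)
  active≡ e = 𝕀-cong (E? e e) (A? e) proj₁ (λ a → a , a , G-irrefl)

  -- Among the vertices of `A` non-adjacency is the equivalence relation, so the adjacency matrix is
  -- a rank-one matrix minus a positive semidefinite one. The rank-one term is the only source of a
  -- positive direction.
  adjacency : ∀ e f → 𝕀 (G? e f) ≡ active e * active f - rel e f
  adjacency e f = trans (go (A? e) (A? f) (G? e f)) (cong (_- rel e f) (sym (cong₂ _*_ (active≡ e) (active≡ f))))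
    where
    go : (a : Dec (A e)) (b : Dec (A f)) (g : Dec (G e f)) → 𝕀 g ≡ 𝕀 a * 𝕀 b - 𝕀 (a ×-dec b ×-dec ¬? g)
    go (yes _) (yes _) (yes _) = refl
    go (yes _) (yes _) (no _)  = refl
    go (yes a) (no ¬b) (yes g) = contradiction (G⇒A (G-sym g)) ¬b
    go (yes _) (no _)  (no _)  = refl
    go (no ¬a) b       (yes g) = contradiction (G⇒A g) ¬a
    go (no _)  (yes _) (no _)  = refl
    go (no _)  (no _)  (no _)  = refl

  bil-adjacency : ∀ z → bil (λ e f → 𝕀 (G? e f)) z z ≡ dot active z * dot active z - bil rel z z
  bil-adjacency z = trans (bil-congˡ adjacency z z)
    (trans (bil-minus (λ e f → active e * active f) rel z z) (cong (_- bil rel z z) (dot-app-rank-one active z active z)))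

  hyperbolic-adjacency : Hyperbolic (λ e f → 𝕀 (G? e f))
  hyperbolic-adjacency = hyperbolic-criterion (λ e f → 𝕀 (G? e f)) (λ e f → 𝕀-cong (G? e f) (G? f e) G-sym G-sym) (λ e f → 0≤𝕀 (G? e f)) active
    λ z Z≡0 → ≤-from (rel-form-0≤ z) (trans (solve 1 (λ R → R := con 0ℚ :- (con 0ℚ :* con 0ℚ :- R)) refl (bil rel z z))
      (cong (λ q → 0ℚ - q) (trans (cong (λ Z → Z * Z - bil rel z z) (sym Z≡0)) (sym (bil-adjacency z)))))

  -- Multiplying by `1 + t` and completing the square in the border variable gives
  -- `c (t P² + Z² − (1 + t) R)`. Here `P` vanishes by assumption, and Cauchy-Schwarz over at most
  -- `1 + t` classes bounds `Z²`. The vector defining the hyperplane comes from the first row of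
  -- `M`, to which it is proportional up to the factor `c t`.
  negative-cone : ∀ {c t} → 0ℚ ≤ c → 0ℚ ≤ t → sum active ≤ 1ℚ + t → (M : Matrix (suc n) (suc n)) →
    M zero zero ≡ c * ((1ℚ + t) * t) → (∀ e → M zero (suc e) ≡ c * t * active e) → (∀ e → M (suc e) zero ≡ c * t * active e) →
    (∀ e f → M (suc e) (suc f) ≡ c * 𝕀 (G? e f)) →
    ∀ x → dot ((1ℚ + t) ◂ active) x ≡ 0ℚ → bil M x x ≤ 0ℚ
  negative-cone {c} {t} c≥0 t≥0 size M M₀₀ M₀ M₀′ M₁ x P≡0 = cancel-≤ 1+t>0 (≤-from (0≤* c≥0 (≤⇒0≤- (rel-form-bound 1+t>0 size z))) (begin
    c * ((1ℚ + t) * R - Z * Z)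
      ≡⟨ solve 5 (λ c t R Z s → c :* ((con 1ℚ :+ t) :* R :- Z :* Z) := ((con 1ℚ :+ t) :* con 0ℚ :- (con 1ℚ :+ t) :* (c :* ((con 1ℚ :+ t) :* t) :* s :* s :+ con 2ℚ :* s :* (c :* t :* Z) :+ c :* (Z :* Z :- R))) :+ c :* t :* (((con 1ℚ :+ t) :* s :+ Z) :* ((con 1ℚ :+ t) :* s :+ Z))) refl c t R Z s ⟩
    ((1ℚ + t) * 0ℚ - (1ℚ + t) * (c * ((1ℚ + t) * t) * s * s + 2ℚ * s * (c * t * Z) + c * (Z * Z - R))) + c * t * (((1ℚ + t) * s + Z) * ((1ℚ + t) * s + Z))
      ≡⟨ cong₂ (λ q p → ((1ℚ + t) * 0ℚ - (1ℚ + t) * q) + c * t * (p * p)) form P≡0 ⟩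
    ((1ℚ + t) * 0ℚ - (1ℚ + t) * bil M x x) + c * t * (0ℚ * 0ℚ)
      ≡⟨ solve 2 (λ a d → a :+ d :* (con 0ℚ :* con 0ℚ) := a) refl ((1ℚ + t) * 0ℚ - (1ℚ + t) * bil M x x) (c * t) ⟩
    (1ℚ + t) * 0ℚ - (1ℚ + t) * bil M x x ∎))
    where
    open ≡-Reasoning
    1+t>0 : 0ℚ < 1ℚ + t
    1+t>0 = 0<+ (positive⁻¹ 1ℚ) t≥0
    s = x zero
    z : Vect n
    z e = x (suc e)
    R = bil rel z z
    Z = dot active z
    form : c * ((1ℚ + t) * t) * s * s + 2ℚ * s * (c * t * Z) + c * (Z * Z - R) ≡ bil M x x
    form = sym (trans (bil-bordered M M₀₀ M₀ M₀′ M₁ x) (cong₂ (λ p q → c * ((1ℚ + t) * t) * s * s + 2ℚ * s * p + q)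
      (trans (sum-cong-≗ λ e → *-assoc (c * t) (active e) (z e)) (sum-* (c * t) (λ e → active e * z e)))
      (trans (bil-scale c (λ e f → 𝕀 (G? e f)) z z) (cong (c *_) (bil-adjacency z)))))

-- Polynomials of set systems

∣∪⁅⁆∣ : ∀ {n} {S : Subset n} {e} → e ∉ S → ∣ S ∪ ⁅ e ⁆ ∣ ≡ suc ∣ S ∣
∣∪⁅⁆∣ {S = inside  ∷ S} {zero}  e∉S = contradiction here e∉S
∣∪⁅⁆∣ {S = outside ∷ S} {zero}  e∉S = cong (λ p → suc ∣ p ∣) (∪-identityʳ S)
∣∪⁅⁆∣ {S = inside  ∷ S} {suc e} e∉S = cong suc (∣∪⁅⁆∣ (drop-not-there e∉S))
∣∪⁅⁆∣ {S = outside ∷ S} {suc e} e∉S = ∣∪⁅⁆∣ (drop-not-there e∉S)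

∣∪∣≤ : ∀ {n} (p q : Subset n) → ∣ p ∪ q ∣ ℕ.≤ ∣ p ∣ ℕ.+ ∣ q ∣
∣∪∣≤ [] [] = ℕ.z≤n
∣∪∣≤ (outside ∷ p) (outside ∷ q) = ∣∪∣≤ p q
∣∪∣≤ (outside ∷ p) (inside  ∷ q) = subst (suc ∣ p ∪ q ∣ ℕ.≤_) (sym (+-suc ∣ p ∣ ∣ q ∣)) (ℕ.s≤s (∣∪∣≤ p q))
∣∪∣≤ (inside  ∷ p) (outside ∷ q) = ℕ.s≤s (∣∪∣≤ p q)
∣∪∣≤ (inside  ∷ p) (inside  ∷ q) = ℕ.s≤s (ℕP.≤-trans (∣∪∣≤ p q) (ℕP.+-monoʳ-≤ ∣ p ∣ (n≤1+n ∣ q ∣)))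

module _ {n : ℕ} where

  ∈∪⁅⁆⁻ : ∀ {S : Subset n} {e x} → x ∈ S ∪ ⁅ e ⁆ → x ∈ S ⊎ x ≡ e
  ∈∪⁅⁆⁻ {S} {e} x∈ = Sum.map₂ (x∈⁅y⁆⇒x≡y e) (x∈p∪q⁻ S ⁅ e ⁆ x∈)

  ∈∪⁅⁆ˡ : ∀ {S : Subset n} {e x} → x ∈ S → x ∈ S ∪ ⁅ e ⁆
  ∈∪⁅⁆ˡ x∈S = x∈p∪q⁺ (inj₁ x∈S)

  ∈∪⁅⁆ʳ : ∀ {S : Subset n} {e} → e ∈ S ∪ ⁅ e ⁆
  ∈∪⁅⁆ʳ {e = e} = x∈p∪q⁺ (inj₂ (x∈⁅x⁆ e))

  ∉∪⁅⁆ : ∀ {S : Subset n} {e x} → x ∉ S → x ≢ e → x ∉ S ∪ ⁅ e ⁆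
  ∉∪⁅⁆ x∉S x≢e x∈ = Sum.[ x∉S , x≢e ] (∈∪⁅⁆⁻ x∈)

  ∪⁅⁆-swap : ∀ (S : Subset n) e f → (S ∪ ⁅ e ⁆) ∪ ⁅ f ⁆ ≡ (S ∪ ⁅ f ⁆) ∪ ⁅ e ⁆
  ∪⁅⁆-swap S e f = trans (∪-assoc S ⁅ e ⁆ ⁅ f ⁆) (trans (cong (S ∪_) (∪-comm ⁅ e ⁆ ⁅ f ⁆)) (sym (∪-assoc S ⁅ f ⁆ ⁅ e ⁆)))

  outsider : ∀ {p : Subset n} → ∣ p ∣ ℕ.< n → ∃ λ x → x ∉ p
  outsider {p} ∣p∣<n with any? (λ x → ¬? (x ∈? p))
  ... | yes q = q
  ... | no ∄ = contradiction (ℕP.≤-trans ∣p∣<n (ℕP.≤-trans (ℕP.≤-reflexive (sym (∣⊤∣≡n n))) (p⊆q⇒∣p∣≤∣q∣ {p = ⊤ˢ} {q = p} λ {x} _ → full x))) (ℕP.<-irrefl refl)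
    where
    full : ∀ x → x ∈ p
    full x with x ∈? p
    ... | yes x∈p = x∈p
    ... | no x∉p  = contradiction (x , x∉p) ∄

sum-𝕀-∈ : ∀ {n} (S : Subset n) → sum (λ e → 𝕀 (e ∈? S)) ≡ ι ∣ S ∣
sum-𝕀-∈ [] = refl
sum-𝕀-∈ (inside  ∷ S) = cong₂ _+_ (𝕀-yes (zero ∈? (inside ∷ S)) here) (trans (sum-cong-≗ λ e → 𝕀-cong (suc e ∈? (inside ∷ S)) (e ∈? S) drop-there there) (sum-𝕀-∈ S))
sum-𝕀-∈ (outside ∷ S) = trans (cong₂ _+_ (𝕀-no (zero ∈? (outside ∷ S)) λ ()) (trans (sum-cong-≗ λ e → 𝕀-cong (suc e ∈? (outside ∷ S)) (e ∈? S) drop-there there) (sum-𝕀-∈ S))) (+-identityˡ (ι ∣ S ∣))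

ι-* : ∀ a b → ι (a ℕ.* b) ≡ ι a * ι b
ι-* = ×1-homo-*

0<ι! : ∀ k → 0ℚ < ι (k !)
0<ι! zero    = positive⁻¹ 1ℚ
0<ι! (suc k) = subst (0ℚ <_) (sym (ι-* (suc k) (k !))) (0<* (0<ι k) (0<ι! k))

ι-+ : ∀ a b → ι (a ℕ.+ b) ≡ ι a + ι b
ι-+ = ×-homo-+ 1ℚ

-- The polynomial Σ y^(n−|S|) x^S over the sets S satisfying φ; letter 0 is y and letter e + 1 is x_e.
-- A state records the set of letters x_e and the number of letters y read so far.
module SubsetPolynomial {n : ℕ} {φ : Subset n → Set} (φ? : ∀ S → Dec (φ S)) where

  State : Set
  State = Maybe (Subset n × ℕ)

  -- A constant arises only from the monomial `y^j x^S`, whose exponent of `y` is `n − |S|`;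
  -- differentiating `y^j` completely yields `j !`.
  value : State → ℚ
  value nothing        = 0ℚ
  value (just (S , j)) = 𝕀 (∣ S ∣ ℕ.+ j ℕP.≟ n) * 𝕀 (φ? S) * ι (j !)

  -- Each x_e occurs at most to the first power, so a repeated letter annihilates. The membership
  -- decision is an argument so that proofs can split on it.
  adjoin : ∀ S e → Dec (e ∈ S) → ℕ → State
  adjoin S e (yes _) j = nothing
  adjoin S e (no _)  j = just (S ∪ ⁅ e ⁆ , j)

  step : State → Fin (suc n) → State
  step nothing        _       = nothing
  step (just (S , j)) zero    = just (S , suc j)
  step (just (S , j)) (suc e) = adjoin S e (e ∈? S) j

  run : State → Tensor (suc n)
  run s []      = value s
  run s (i ∷ w) = run (step s i) w

  polynomial : Tensor (suc n)
  polynomial = run (just (∅ , 0))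

  adjoin-∈ : ∀ {S e j} (d : Dec (e ∈ S)) → e ∈ S → adjoin S e d j ≡ nothing
  adjoin-∈ (yes _) e∈S = refl
  adjoin-∈ (no e∉S) e∈S = contradiction e∈S e∉S

  adjoin-∉ : ∀ {S e j} (d : Dec (e ∈ S)) → e ∉ S → adjoin S e d j ≡ just (S ∪ ⁅ e ⁆ , j)
  adjoin-∉ (yes e∈S) e∉S = contradiction e∈S e∉S
  adjoin-∉ (no _)    e∉S = refl

  step-comm : ∀ s a b → step (step s a) b ≡ step (step s b) a
  step-comm nothing a b = refl
  step-comm (just (S , j)) zero zero = refl
  step-comm (just (S , j)) zero (suc e) = go (e ∈? S)
    where
    go : ∀ d → adjoin S e d (suc j) ≡ step (adjoin S e d j) zero
    go (yes _) = refl
    go (no _)  = refl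
  step-comm (just (S , j)) (suc e) zero = go (e ∈? S)
    where
    go : ∀ d → step (adjoin S e d j) zero ≡ adjoin S e d (suc j)
    go (yes _) = refl
    go (no _)  = refl
  step-comm (just (S , j)) (suc e) (suc f) = go (e ∈? S) (f ∈? S) (e FinP.≟ f)
    where
    go : ∀ d d′ → Dec (e ≡ f) → step (adjoin S e d j) (suc f) ≡ step (adjoin S f d′ j) (suc e)
    go (yes _)   (yes _)   _ = refl
    go (yes e∈S) (no _)    _ = sym (adjoin-∈ (e ∈? (S ∪ ⁅ f ⁆)) (∈∪⁅⁆ˡ e∈S))
    go (no _)    (yes f∈S) _ = adjoin-∈ (f ∈? (S ∪ ⁅ e ⁆)) (∈∪⁅⁆ˡ f∈S)
    go (no _)    (no _)    (yes refl) = refl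
    go (no e∉S)  (no f∉S)  (no e≢f) = trans (adjoin-∉ (f ∈? (S ∪ ⁅ e ⁆)) (∉∪⁅⁆ f∉S (λ p → e≢f (sym p))))
      (trans (cong (λ p → just (p , j)) (∪⁅⁆-swap S e f)) (sym (adjoin-∉ (e ∈? (S ∪ ⁅ f ⁆)) (∉∪⁅⁆ e∉S e≢f))))

  run-symmetric : ∀ s → Symmetric (run s)
  run-symmetric s []      a b w = cong (λ t → run t w) (step-comm s a b)
  run-symmetric s (i ∷ u) a b w = run-symmetric (step s i) u a b w

  0≤value : ∀ s → 0ℚ ≤ value s
  0≤value nothing        = ℚP.≤-refl
  0≤value (just (S , j)) = 0≤* (0≤* (0≤𝕀 (∣ S ∣ ℕ.+ j ℕP.≟ n)) (0≤𝕀 (φ? S))) (0≤ι (j !))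

  0≤run : ∀ s w → 0ℚ ≤ run s w
  0≤run s []      = 0≤value s
  0≤run s (i ∷ w) = 0≤run (step s i) w

  run-nothing : ∀ w → run nothing w ≡ 0ℚ
  run-nothing []      = refl
  run-nothing (i ∷ w) = run-nothing w

  value-≢0 : ∀ S j → value (just (S , j)) ≢ 0ℚ → ∣ S ∣ ℕ.+ j ≡ n × φ S
  value-≢0 S j = go (∣ S ∣ ℕ.+ j ℕP.≟ n) (φ? S)
    where
    go : (d : Dec (∣ S ∣ ℕ.+ j ≡ n)) (d′ : Dec (φ S)) → 𝕀 d * 𝕀 d′ * ι (j !) ≢ 0ℚ → ∣ S ∣ ℕ.+ j ≡ n × φ S
    go (yes p) (yes q) _  = p , q
    go (yes _) (no _)  ≢0 = contradiction (*-zeroˡ (ι (j !))) ≢0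
    go (no _)  (yes _) ≢0 = contradiction (*-zeroˡ (ι (j !))) ≢0
    go (no _)  (no _)  ≢0 = contradiction (*-zeroˡ (ι (j !))) ≢0

  value-zero : ∀ S j → ∣ S ∣ ℕ.+ j ≢ n → value (just (S , j)) ≡ 0ℚ
  value-zero S j ne = decidable-stable (value (just (S , j)) ℚP.≟ 0ℚ) λ ≢0 → ne (proj₁ (value-≢0 S j ≢0))

  value-full : ∀ S j → ∣ S ∣ ℕ.+ j ≡ n → value (just (S , j)) ≡ 𝕀 (φ? S) * ι (j !)
  value-full S j e = cong (_* ι (j !)) (trans (cong (_* 𝕀 (φ? S)) (𝕀-yes (∣ S ∣ ℕ.+ j ℕP.≟ n) e)) (*-identityˡ (𝕀 (φ? S))))

  private
    count-y : ∀ {S : Subset n} {j D} → ∣ S ∣ ℕ.+ j ℕ.+ suc D ≡ n → ∣ S ∣ ℕ.+ suc j ℕ.+ D ≡ n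
    count-y {S} {j} {D} e = trans (cong (ℕ._+ D) (+-suc ∣ S ∣ j)) (trans (sym (+-suc (∣ S ∣ ℕ.+ j) D)) e)

    count-x : ∀ {S : Subset n} {j D e} → e ∉ S → ∣ S ∣ ℕ.+ j ℕ.+ suc D ≡ n → ∣ S ∪ ⁅ e ⁆ ∣ ℕ.+ j ℕ.+ D ≡ n
    count-x {S} {j} {D} e∉S e = trans (cong (λ k → k ℕ.+ j ℕ.+ D) (∣∪⁅⁆∣ e∉S)) (trans (sym (+-suc (∣ S ∣ ℕ.+ j) D)) e)

  run-size : ∀ w {S j} → run (just (S , j)) w ≢ 0ℚ → ∣ S ∣ ℕ.+ j ℕ.+ length w ≡ n
  run-size [] {S} {j} ≢0 = trans (ℕP.+-identityʳ (∣ S ∣ ℕ.+ j)) (proj₁ (value-≢0 S j ≢0))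
  run-size (zero ∷ w) {S} {j} ≢0 = trans (+-suc (∣ S ∣ ℕ.+ j) (length w)) (trans (cong (ℕ._+ length w) (sym (+-suc ∣ S ∣ j))) (run-size w ≢0))
  run-size (suc e ∷ w) {S} {j} = go (e ∈? S)
    where
    go : ∀ d → run (adjoin S e d j) w ≢ 0ℚ → ∣ S ∣ ℕ.+ j ℕ.+ suc (length w) ≡ n
    go (yes _)  ≢0 = contradiction (run-nothing w) ≢0
    go (no e∉S) ≢0 = trans (+-suc (∣ S ∣ ℕ.+ j) (length w)) (trans (cong (λ k → k ℕ.+ j ℕ.+ length w) (sym (∣∪⁅⁆∣ e∉S))) (run-size w ≢0))

  run-overfull : ∀ w {S j} → n ℕ.< ∣ S ∣ ℕ.+ j → run (just (S , j)) w ≡ 0ℚ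
  run-overfull w {S} {j} lt = decidable-stable (run (just (S , j)) w ℚP.≟ 0ℚ) λ ≢0 →
    ℕP.<-irrefl refl (ℕP.<-≤-trans lt (ℕP.≤-trans (m≤m+n (∣ S ∣ ℕ.+ j) (length w)) (ℕP.≤-reflexive (run-size w ≢0))))

  run-admissible : ∀ {S j D} → ∣ S ∣ ℕ.+ j ℕ.+ D ≡ n → Admissible D (run (just (S , j)))
  run-admissible {S} {j} e = record
    { symmetric   = run-symmetric (just (S , j))
    ; nonnegative = 0≤run (just (S , j))
    ; homogeneous = λ w ≢0 → +-cancelˡ-≡ (∣ S ∣ ℕ.+ j) (length w) _ (trans (run-size w ≢0) (sym e)) }

  -- Nonvanishing of the derivative, expressed by sets instead of words: the monomial of `S′`
  -- survives if `S′` contains the letters read and its exponent of `y`, namely `n − |S′|`, is at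
  -- least `j`.
  Live : State → Set
  Live nothing        = ⊥
  Live (just (S , j)) = ∃ λ S′ → S ⊆ S′ × φ S′ × ∣ S′ ∣ ℕ.+ j ℕ.≤ n

  live-∷ : ∀ {S j} i → Live (step (just (S , j)) i) → Live (just (S , j))
  live-∷ {S} {j} zero (S′ , S⊆S′ , φS′ , le) = S′ , S⊆S′ , φS′ , ℕP.≤-trans (ℕP.+-monoʳ-≤ ∣ S′ ∣ (n≤1+n j)) le
  live-∷ {S} {j} (suc e) = go (e ∈? S)
    where
    go : ∀ d → Live (adjoin S e d j) → Live (just (S , j))
    go (no _) (S′ , S⊆S′ , rest) = S′ , (λ x∈S → S⊆S′ (∈∪⁅⁆ˡ x∈S)) , rest

  word⇒live : ∀ w s → run s w ≢ 0ℚ → Live s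
  word⇒live w nothing ≢0 = ≢0 (run-nothing w)
  word⇒live [] (just (S , j)) ≢0 = let e , φS = value-≢0 S j ≢0 in S , (λ x∈S → x∈S) , φS , ℕP.≤-reflexive e
  word⇒live (i ∷ w) (just (S , j)) ≢0 = live-∷ i (word⇒live w (step (just (S , j)) i) ≢0)

  adjoin-live⁻ : ∀ {S e j} → Live (step (just (S , j)) (suc e)) → e ∉ S × Live (just (S ∪ ⁅ e ⁆ , j))
  adjoin-live⁻ {S} {e} {j} = go (e ∈? S)
    where
    go : ∀ d → Live (adjoin S e d j) → e ∉ S × Live (just (S ∪ ⁅ e ⁆ , j))
    go (no e∉S) l = e∉S , l

  adjoin-live⁺ : ∀ {S e j} → e ∉ S → Live (just (S ∪ ⁅ e ⁆ , j)) → Live (step (just (S , j)) (suc e))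
  adjoin-live⁺ {S} {e} e∉S = subst Live (sym (adjoin-∉ (e ∈? S) e∉S))

  -- The word spells the elements of `S′` missing from `S` and is then padded with `y`. The size
  -- bound on `S′` keeps the budget `D` from running out before `S′` is reached.
  live⇒word′ : ∀ D {S j} → ∣ S ∣ ℕ.+ j ℕ.+ D ≡ n → Live (just (S , j)) → ∃ λ w → run (just (S , j)) w ≢ 0ℚ
  live⇒word′ D {S} {j} e (S′ , S⊆S′ , φS′ , le) = go (any? λ x → x ∈? S′ ×-dec ¬? (x ∈? S)) D e
    where
    go : Dec (∃ λ x → x ∈ S′ × x ∉ S) → ∀ D → ∣ S ∣ ℕ.+ j ℕ.+ D ≡ n → ∃ λ w → run (just (S , j)) w ≢ 0ℚ
    go (yes (x , x∈S′ , x∉S)) zero e = contradiction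
      (ℕP.<-≤-trans (ℕP.+-monoˡ-< j (p⊂q⇒∣p∣<∣q∣ {p = S} {q = S′} (S⊆S′ , x , x∈S′ , x∉S))) (ℕP.≤-trans le (ℕP.≤-reflexive (trans (sym e) (ℕP.+-identityʳ (∣ S ∣ ℕ.+ j))))))
      (ℕP.<-irrefl refl)
    go (yes (x , x∈S′ , x∉S)) (suc D) e =
      let w , ≢0 = live⇒word′ D {S ∪ ⁅ x ⁆} {j} (count-x {S} x∉S e) (S′ , (λ y∈ → Sum.[ S⊆S′ , (λ y≡x → subst (_∈ S′) (sym y≡x) x∈S′) ] (∈∪⁅⁆⁻ y∈)) , φS′ , le)
      in suc x ∷ w , λ ≡0 → ≢0 (trans (cong (λ t → run t w) (sym (adjoin-∉ (x ∈? S) x∉S))) ≡0)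
    go (no ∄) D e = padding D e
      where
      S′⊆S : S′ ⊆ S
      S′⊆S {x} x∈S′ with x ∈? S
      ... | yes x∈S = x∈S
      ... | no x∉S  = contradiction (x , x∈S′ , x∉S) ∄
      φS : φ S
      φS = subst φ (⊆-antisym S′⊆S S⊆S′) φS′
      padding : ∀ D {j} → ∣ S ∣ ℕ.+ j ℕ.+ D ≡ n → ∃ λ w → run (just (S , j)) w ≢ 0ℚ
      padding zero {j} e = [] , λ ≡0 → <⇒≢ (subst (0ℚ <_) (sym (trans (value-full S j (trans (sym (ℕP.+-identityʳ _)) e)) (trans (cong (_* ι (j !)) (𝕀-yes (φ? S) φS)) (*-identityˡ (ι (j !)))))) (0<ι! j)) (sym ≡0)
      padding (suc D) {j} e = let w , ≢0 = padding D {suc j} (count-y {S} e) in zero ∷ w , ≢0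

  live⇒word : ∀ s → Live s → ∃ λ w → run s w ≢ 0ℚ
  live⇒word (just (S , j)) l@(S′ , S⊆S′ , _ , le) = live⇒word′ (n ℕ.∸ (∣ S ∣ ℕ.+ j))
    (m+[n∸m]≡n (ℕP.≤-trans (ℕP.+-monoˡ-≤ j (p⊆q⇒∣p∣≤∣q∣ S⊆S′)) le)) l

  Live₂ : State → Fin (suc n) → Fin (suc n) → Set
  Live₂ s i k = Live (step (step s i) k)

  Live₂-sym : ∀ s {i k} → Live₂ s i k → Live₂ s k i
  Live₂-sym s {i} {k} = subst Live (step-comm s i k)

  AllJoined : State → Set
  AllJoined s = ∀ i k → Live (step s i) → Live (step s k) → i ≡ k ⊎ Live₂ s i k ⊎ ∃ λ l → Live₂ s i l × Live₂ s l k

  module _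
    (linked : ∀ S j → 2 ℕ.+ (∣ S ∣ ℕ.+ j) ℕ.≤ n → AllJoined (just (S , j)))
    (hyp : ∀ S j → ∣ S ∣ ℕ.+ j ℕ.+ 2 ≡ n → Hyperbolic (hessian [] (run (just (S , j)))))
    where

    run-indecomposable : ∀ D {S j} → ∣ S ∣ ℕ.+ j ℕ.+ suc (suc D) ≡ n → Indecomposable (run (just (S , j)))
    run-indecomposable D {S} {j} e i u k w p q = Sum.map₂ (Sum.map (word i k) (λ (l , a , b) → l , word i l a , word l k b))
      (linked S j (ℕP.≤-trans (ℕP.≤-reflexive (ℕP.+-comm 2 (∣ S ∣ ℕ.+ j))) (ℕP.≤-trans (ℕP.+-monoʳ-≤ (∣ S ∣ ℕ.+ j) (ℕ.s≤s (ℕ.s≤s (ℕ.z≤n {D})))) (ℕP.≤-reflexive e)))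
        i k (word⇒live u (step s i) p) (word⇒live w (step s k) q))
      where
      s = just (S , j)
      word : ∀ i k → Live₂ s i k → Linked (run s) i k
      word i k = live⇒word (step (step s i) k)

    -- A derivative of a set polynomial is again `run` from some state, or zero after a repeated
    -- letter, so the recursive definition reduces to `linked` and `hyp` at all states.
    run-Lorentzian : ∀ D {S j} → ∣ S ∣ ℕ.+ j ℕ.+ D ≡ n → Lorentzian D (run (just (S , j)))
    run-Lorentzian 0 e = tt
    run-Lorentzian 1 e = tt
    run-Lorentzian 2 {S} {j} e = run-indecomposable 0 e , hyp S j e
    run-Lorentzian (suc (suc (suc D))) {S} {j} e = run-indecomposable (suc D) e , next (run-Lorentzian (suc (suc D)))
      where
      next : (∀ {S j} → ∣ S ∣ ℕ.+ j ℕ.+ suc (suc D) ≡ n → Lorentzian (suc (suc D)) (run (just (S , j)))) →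
        ∀ i → Lorentzian (suc (suc D)) (run (step (just (S , j)) i))
      next rec zero    = rec (count-y {S} e)
      next rec (suc x) = go (x ∈? S)
        where
        go : ∀ d → Lorentzian (suc (suc D)) (run (adjoin S x d j))
        go (yes _)  = Lorentzian-zero (suc (suc D)) run-nothing
        go (no x∉S) = rec (count-x {S} x∉S e)

module QuadraticPart {n : ℕ} {φ : Subset n → Set} (φ? : ∀ S → Dec (φ S)) {S : Subset n} {j : ℕ} (full : ∣ S ∣ ℕ.+ j ℕ.+ 2 ≡ n) where
  open SubsetPolynomial φ?

  B : Fin n → Set
  B e = e ∉ S × φ (S ∪ ⁅ e ⁆)

  G : Fin n → Fin n → Set
  G e f = e ≢ f × e ∉ S × f ∉ S × φ ((S ∪ ⁅ e ⁆) ∪ ⁅ f ⁆)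

  B? : ∀ e → Dec (B e)
  B? e = ¬? (e ∈? S) ×-dec φ? (S ∪ ⁅ e ⁆)

  G? : ∀ e f → Dec (G e f)
  G? e f = ¬? (e FinP.≟ f) ×-dec ¬? (e ∈? S) ×-dec ¬? (f ∈? S) ×-dec φ? ((S ∪ ⁅ e ⁆) ∪ ⁅ f ⁆)

  G-irrefl : ∀ {e} → ¬ G e e
  G-irrefl (e≢e , _) = e≢e refl

  G-sym : ∀ {e f} → G e f → G f e
  G-sym {e} {f} (e≢f , e∉S , f∉S , p) = e≢f ∘ sym , f∉S , e∉S , subst φ (∪⁅⁆-swap S e f) p

  M : Matrix (suc n) (suc n)
  M = hessian [] (run (just (S , j)))

  M-sym : ∀ a b → M a b ≡ M b a
  M-sym a b = run-symmetric (just (S , j)) [] a b []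

  0≤M : ∀ a b → 0ℚ ≤ M a b
  0≤M a b = 0≤run (just (S , j)) (a ∷ b ∷ [])

  -- The entries at `y y`, `y x_e` and `x_e x_f` carry `(j+2)!`, `(j+1)!` and `j!`, which are
  -- `c (1 + t) t`, `c t` and `c`.
  c t : ℚ
  c = ι (j !)
  t = ι (suc j)

  0≤c : 0ℚ ≤ c
  0≤c = 0≤ι (j !)

  size₀ : ∣ S ∣ ℕ.+ suc (suc j) ≡ n
  size₀ = trans (+-suc ∣ S ∣ (suc j)) (trans (cong suc (+-suc ∣ S ∣ j)) (trans (sym (trans (+-suc (∣ S ∣ ℕ.+ j) 1) (cong suc (trans (+-suc (∣ S ∣ ℕ.+ j) 0) (cong suc (ℕP.+-identityʳ (∣ S ∣ ℕ.+ j))))))) full))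

  size₁ : ∀ {e} → e ∉ S → ∣ S ∪ ⁅ e ⁆ ∣ ℕ.+ suc j ≡ n
  size₁ e∉S = trans (cong (ℕ._+ suc j) (∣∪⁅⁆∣ e∉S)) (trans (sym (+-suc ∣ S ∣ (suc j))) size₀)

  size₂ : ∀ {e f} → e ∉ S → f ∉ S ∪ ⁅ e ⁆ → ∣ (S ∪ ⁅ e ⁆) ∪ ⁅ f ⁆ ∣ ℕ.+ j ≡ n
  size₂ {e} e∉S f∉ = trans (cong (ℕ._+ j) (∣∪⁅⁆∣ f∉)) (trans (sym (+-suc ∣ S ∪ ⁅ e ⁆ ∣ j)) (size₁ e∉S))

  entry₀₀ : M zero zero ≡ 𝕀 (φ? S) * (c * ((1ℚ + t) * t))
  entry₀₀ = trans (value-full S (suc (suc j)) size₀) (cong (𝕀 (φ? S) *_)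
    (trans (ι-* (suc (suc j)) (suc j !)) (trans (cong (ι (suc (suc j)) *_) (ι-* (suc j) (j !))) (solve 2 (λ c t → (con 1ℚ :+ t) :* (t :* c) := c :* ((con 1ℚ :+ t) :* t)) refl c t))))

  entry₀ : ∀ e → M zero (suc e) ≡ c * t * 𝕀 (B? e)
  entry₀ e = go (e ∈? S) (B? e)
    where
    go : (d : Dec (e ∈ S)) (b : Dec (B e)) → value (adjoin S e d (suc j)) ≡ c * t * 𝕀 b
    go (yes e∈S) b = sym (*-≡0ʳ (c * t) (𝕀-no b (λ (e∉S , _) → e∉S e∈S)))
    go (no e∉S) b = trans (value-full (S ∪ ⁅ e ⁆) (suc j) (size₁ e∉S)) (trans (cong₂ _*_ (𝕀-cong (φ? (S ∪ ⁅ e ⁆)) b (λ p → e∉S , p) proj₂) (ι-* (suc j) (j !)))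
      (solve 3 (λ b t c → b :* (t :* c) := c :* t :* b) refl (𝕀 b) t c))

  entry₀′ : ∀ e → M (suc e) zero ≡ c * t * 𝕀 (B? e)
  entry₀′ e = trans (M-sym (suc e) zero) (entry₀ e)

  entry : ∀ e f → M (suc e) (suc f) ≡ c * 𝕀 (G? e f)
  entry e f = go (e ∈? S) (f ∈? (S ∪ ⁅ e ⁆)) (G? e f)
    where
    vanish : (g : Dec (G e f)) → ¬ G e f → 0ℚ ≡ c * 𝕀 g
    vanish g ¬g = sym (*-≡0ʳ c (𝕀-no g ¬g))
    go : (d : Dec (e ∈ S)) (d′ : Dec (f ∈ S ∪ ⁅ e ⁆)) (g : Dec (G e f)) → value (step (adjoin S e d j) (suc f)) ≡ c * 𝕀 g
    go (yes e∈S) d′ g = vanish g (λ (_ , e∉S , _) → e∉S e∈S)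
    go (no e∉S) (yes f∈) g = trans (cong value (adjoin-∈ (f ∈? (S ∪ ⁅ e ⁆)) f∈))
      (vanish g (λ (e≢f , _ , f∉S , _) → Sum.[ f∉S , e≢f ∘ sym ] (∈∪⁅⁆⁻ f∈)))
    go (no e∉S) (no f∉) g = trans (cong value (adjoin-∉ (f ∈? (S ∪ ⁅ e ⁆)) f∉))
      (trans (value-full ((S ∪ ⁅ e ⁆) ∪ ⁅ f ⁆) j (size₂ e∉S f∉))
      (trans (cong (_* c) (𝕀-cong (φ? ((S ∪ ⁅ e ⁆) ∪ ⁅ f ⁆)) g (λ p → (λ e≡f → f∉ (subst (_∈ S ∪ ⁅ e ⁆) e≡f ∈∪⁅⁆ʳ)) , e∉S , f∉ ∘ ∈∪⁅⁆ˡ , p) (proj₂ ∘ proj₂ ∘ proj₂)))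
        (*-comm (𝕀 g) c)))

  hyperbolic-cone : φ S → (∀ {e f} → G e f → B e) →
    (∀ {e f g} → B e → B f → B g → ¬ G e f → ¬ G f g → ¬ G e g) → Hyperbolic M
  hyperbolic-cone φS G⇒B cotrans = hyperbolic-criterion M M-sym 0≤M ((1ℚ + t) ◂ active)
    (negative-cone 0≤c (0≤ι (suc j)) size M
      (trans entry₀₀ (trans (cong (_* (c * ((1ℚ + t) * t))) (𝕀-yes (φ? S) φS)) (*-identityˡ (c * ((1ℚ + t) * t)))))
      (λ e → trans (entry₀ e) (cong (c * t *_) (sym (active≡ e)))) (λ e → trans (entry₀′ e) (cong (c * t *_) (sym (active≡ e)))) entry)
    where
    open Multipartite B? G? G-irrefl G-sym G⇒B cotrans
    ∣∁S∣ : ∣ ∁ S ∣ ≡ suc (suc j)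
    ∣∁S∣ = trans (∣∁p∣≡n∸∣p∣ S) (trans (cong (ℕ._∸ ∣ S ∣) (sym size₀)) (m+n∸m≡n ∣ S ∣ (suc (suc j))))
    -- In a state with two letters to go, `S` misses exactly `j + 2 = 1 + t` elements, which is the
    -- number of classes that `negative-cone` tolerates.
    size : sum active ≤ 1ℚ + t
    size = ℚP.≤-trans (sum-mono λ e → subst (_≤ 𝕀 (e ∈? ∁ S)) (sym (active≡ e)) (𝕀-mono (B? e) (e ∈? ∁ S) (x∉p⇒x∈∁p ∘ proj₁)))
      (ℚP.≤-reflexive (trans (sum-𝕀-∈ (∁ S)) (cong ι ∣∁S∣)))

  -- When φ S fails, the quadratic form is a rescaled adjacency form in which y is one more vertex.
  G⁺ : Fin (suc n) → Fin (suc n) → Set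
  G⁺ zero    zero    = ⊥
  G⁺ zero    (suc f) = B f
  G⁺ (suc e) zero    = B e
  G⁺ (suc e) (suc f) = G e f

  G⁺? : ∀ a b → Dec (G⁺ a b)
  G⁺? zero    zero    = no λ ()
  G⁺? zero    (suc f) = B? f
  G⁺? (suc e) zero    = B? e
  G⁺? (suc e) (suc f) = G? e f

  G⁺-irrefl : ∀ {a} → ¬ G⁺ a a
  G⁺-irrefl {suc e} = G-irrefl

  G⁺-sym : ∀ {a b} → G⁺ a b → G⁺ b a
  G⁺-sym {zero}  {suc f} b = b
  G⁺-sym {suc e} {zero}  b = b
  G⁺-sym {suc e} {suc f} g = G-sym g

  hyperbolic-multipartite : ¬ φ S → (∀ {a b d} → (∃ λ h → G⁺ b h) → ¬ G⁺ a b → ¬ G⁺ b d → ¬ G⁺ a d) → Hyperbolic M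
  hyperbolic-multipartite ¬φS cotrans = hyperbolic-cong {M = λ a b → c * rescale w A a b} {N = M} entries
    (hyperbolic-scale {M = rescale w A} c (hyperbolic-rescale {M = A} w≥0 hyperbolic-adjacency))
    where
    open Multipartite (λ a → any? (G⁺? a)) G⁺? (λ {a} → G⁺-irrefl {a}) (λ {a} {b} → G⁺-sym {a} {b}) (λ {_} {b} g → b , g) (λ {a} {b} {d} _ b′ _ → cotrans {a} {b} {d} b′)
    A : Matrix (suc n) (suc n)
    A a b = 𝕀 (G⁺? a b)
    w : Vect (suc n)
    -- Weight `t` at the vertex `y` supplies the factor `j + 1` of the mixed entries; the entry at
    -- `y y` is zero because `φ S` fails.
    w = t ◂ 𝟙
    w≥0 : ∀ i → 0ℚ ≤ w i
    w≥0 zero    = 0≤ι (suc j)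
    w≥0 (suc e) = nonNegative⁻¹ 1ℚ
    entries : ∀ a b → c * rescale w A a b ≡ M a b
    entries zero zero = trans (solve 2 (λ c t → c :* (t :* t :* con 0ℚ) := con 0ℚ :* (c :* ((con 1ℚ :+ t) :* t))) refl c t)
      (trans (cong (_* (c * ((1ℚ + t) * t))) (sym (𝕀-no (φ? S) ¬φS))) (sym entry₀₀))
    entries zero (suc f) = trans (solve 3 (λ c t b → c :* (t :* con 1ℚ :* b) := c :* t :* b) refl c t (𝕀 (B? f))) (sym (entry₀ f))
    entries (suc e) zero = trans (solve 3 (λ c t b → c :* (con 1ℚ :* t :* b) := c :* t :* b) refl c t (𝕀 (B? e))) (sym (entry₀′ e))
    entries (suc e) (suc f) = trans (solve 2 (λ c g → c :* (con 1ℚ :* con 1ℚ :* g) := c :* g) refl c (𝕀 (G? e f))) (sym (entry e f))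

-- The two matroid polynomials

∣∁∣-+ : ∀ {n} (p : Subset n) → ∣ ∁ p ∣ ℕ.+ ∣ p ∣ ≡ n
∣∁∣-+ p = trans (cong (ℕ._+ ∣ p ∣) (∣∁p∣≡n∸∣p∣ p)) (ℕP.m∸n+n≡m (∣p∣≤n p))

∁-antitone-< : ∀ {n} {p q : Subset n} → ∣ p ∣ ℕ.< ∣ q ∣ → ∣ ∁ q ∣ ℕ.< ∣ ∁ p ∣
∁-antitone-< {n} {p} {q} p<q = subst₂ ℕ._<_ (sym (∣∁p∣≡n∸∣p∣ q)) (sym (∣∁p∣≡n∸∣p∣ p)) (∸-monoʳ-< p<q (∣p∣≤n q))

module IndependenceLorentzian {n : ℕ} (𝑀 : Matroid n) where
  open SubsetPolynomial (independent? 𝑀)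

  private
    smaller : ∀ {S : Subset n} {e} → Independent 𝑀 (S ∪ ⁅ e ⁆) → Independent 𝑀 S
    smaller = hereditary 𝑀 ∈∪⁅⁆ˡ

  -- The vertex `y` is a common neighbour: if x_e still occurs, then `S ∪ ⁅ e ⁆` is independent, and
  -- with two letters to go its exponent of `y` exceeds `j`.
  independence-linked : ∀ S j → 2 ℕ.+ (∣ S ∣ ℕ.+ j) ℕ.≤ n → AllJoined (just (S , j))
  independence-linked S j 2+≤n = go
    where
    s = just (S , j)
    via-y : ∀ e → Live (step s (suc e)) → Live₂ s zero (suc e)
    via-y e l = let e∉S , S′ , S+e⊆S′ , ind , _ = adjoin-live⁻ l in
      adjoin-live⁺ e∉S (S ∪ ⁅ e ⁆ , (λ x∈ → x∈) , hereditary 𝑀 S+e⊆S′ ind ,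
        subst (λ k → k ℕ.+ suc j ℕ.≤ n) (sym (∣∪⁅⁆∣ e∉S)) (subst (λ k → suc k ℕ.≤ n) (sym (+-suc ∣ S ∣ j)) 2+≤n))
    go : AllJoined s
    go zero    zero    _ _ = inj₁ refl
    go zero    (suc f) _ l = inj₂ (inj₁ (via-y f l))
    go (suc e) zero    l _ = inj₂ (inj₁ (Live₂-sym s {zero} {suc e} (via-y e l)))
    go (suc e) (suc f) l m = inj₂ (inj₂ (zero , Live₂-sym s {zero} {suc e} (via-y e l) , via-y f m))

  -- After contracting `S`, distinct non-loops are non-adjacent when parallel, and parallelism is
  -- transitive: augmenting `S + f` from an independent `S + e + g` pairs `f` with `e` or `g`. If
  -- `S` is dependent, the quadratic form vanishes.
  independence-hyperbolic : ∀ S j → ∣ S ∣ ℕ.+ j ℕ.+ 2 ≡ n → Hyperbolic (hessian [] (run (just (S , j))))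
  independence-hyperbolic S j full = go (independent? 𝑀 S)
    where
    open QuadraticPart (independent? 𝑀) {S} {j} full
    cotrans : ∀ {e f g} → B e → B f → B g → ¬ G e f → ¬ G f g → ¬ G e g
    cotrans {e} {f} {g} (e∉S , _) (f∉S , indf) (g∉S , _) ¬ef ¬fg (e≢g , _ , _ , indeg)
      with augmentation 𝑀 indf indeg (ℕP.≤-reflexive (trans (cong suc (trans (∣∪⁅⁆∣ f∉S) (sym (∣∪⁅⁆∣ e∉S)))) (sym (∣∪⁅⁆∣ (∉∪⁅⁆ g∉S (e≢g ∘ sym))))))
    ... | x , x∈ , x∉ , ind with ∈∪⁅⁆⁻ x∈
    ... | inj₂ refl = ¬fg ((λ { refl → x∉ ∈∪⁅⁆ʳ }) , f∉S , g∉S , ind)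
    ... | inj₁ x∈S+e with ∈∪⁅⁆⁻ x∈S+e
    ... | inj₁ x∈S = x∉ (∈∪⁅⁆ˡ x∈S)
    ... | inj₂ refl = ¬ef (G-sym ((λ { refl → x∉ ∈∪⁅⁆ʳ }) , f∉S , e∉S , ind))
    go : Dec (Independent 𝑀 S) → Hyperbolic M
    go (yes indS) = hyperbolic-cone indS (λ (_ , e∉S , _ , ind) → e∉S , smaller ind) cotrans
    go (no depS) = hyperbolic-multipartite depS (λ {a} {b} {d} _ _ _ → edgeless a d)
      where
      edgeless : ∀ a b → ¬ G⁺ a b
      edgeless zero    (suc f) (_ , ind)         = depS (smaller ind)
      edgeless (suc e) zero    (_ , ind)         = depS (smaller ind)
      edgeless (suc e) (suc f) (_ , _ , _ , ind) = depS (smaller (smaller ind))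

  independence-Lorentzian : Lorentzian n polynomial
  independence-Lorentzian = run-Lorentzian independence-linked independence-hyperbolic n
    (cong (λ k → k ℕ.+ 0 ℕ.+ n) (∣⊥∣≡0 n))

module CospanningLorentzian {n : ℕ} (𝑀 : Matroid n) where

  -- These are the spanning sets of the dual matroid, a family closed under supersets.
  φ : Subset n → Set
  φ S = Independent 𝑀 (∁ S)

  φ? : ∀ S → Dec (φ S)
  φ? S = independent? 𝑀 (∁ S)

  open SubsetPolynomial φ?

  φ-mono : ∀ {S T : Subset n} → S ⊆ T → φ S → φ T
  φ-mono S⊆T = hereditary 𝑀 (λ x∈∁T → x∉p⇒x∈∁p (x∈∁p⇒x∉p x∈∁T ∘ S⊆T))

  -- Liveness read on the complement `I` of `S′`. The bound on the exponent of `y` becomes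
  -- `j ≤ |I|`, which makes it a question about the rank of `∁ S`.
  Free : Subset n → ℕ → Set
  Free S j = ∃ λ I → Independent 𝑀 I × (∀ {x} → x ∈ I → x ∉ S) × j ℕ.≤ ∣ I ∣

  live⇒free : ∀ {S j} → Live (just (S , j)) → Free S j
  live⇒free {S} {j} (S′ , S⊆S′ , ind , le) = ∁ S′ , ind , (λ x∈ x∈S → x∈∁p⇒x∉p x∈ (S⊆S′ x∈S)) ,
    +-cancelʳ-≤ (∣ S′ ∣) j (∣ ∁ S′ ∣) (subst₂ ℕ._≤_ (ℕP.+-comm ∣ S′ ∣ j) (sym (∣∁∣-+ S′)) le)

  free⇒live : ∀ {S j} → Free S j → Live (just (S , j))
  free⇒live {S} {j} (I , ind , disjoint , j≤) = ∁ I , (λ x∈S → x∉p⇒x∈∁p (λ x∈I → disjoint x∈I x∈S)) ,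
    hereditary 𝑀 (λ x∈ → x∉∁p⇒x∈p (x∈∁p⇒x∉p x∈)) ind ,
    ℕP.≤-trans (ℕP.+-monoʳ-≤ ∣ ∁ I ∣ j≤) (ℕP.≤-reflexive (∣∁∣-+ I))

  private
    free-∪ : ∀ {S e} {I : Subset n} → (∀ {x} → x ∈ I → x ∉ S) → e ∉ I → ∀ {x} → x ∈ I → x ∉ S ∪ ⁅ e ⁆
    free-∪ disjoint e∉I x∈I = ∉∪⁅⁆ (disjoint x∈I) (λ { refl → e∉I x∈I })

    ∪-free : ∀ {S e} {I : Subset n} → (∀ {x} → x ∈ I → x ∉ S) → e ∉ S → ∀ {x} → x ∈ I ∪ ⁅ e ⁆ → x ∉ S
    ∪-free disjoint e∉S x∈ x∈S with ∈∪⁅⁆⁻ x∈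
    ... | inj₁ x∈I  = disjoint x∈I x∈S
    ... | inj₂ refl = e∉S x∈S

    drop : ∀ {S e} {I : Subset n} → (∀ {x} → x ∈ I → x ∉ S ∪ ⁅ e ⁆) → (∀ {x} → x ∈ I → x ∉ S) × e ∉ I
    drop disjoint = (λ x∈I x∈S → disjoint x∈I (∈∪⁅⁆ˡ x∈S)) , (λ e∈I → disjoint e∈I ∈∪⁅⁆ʳ)

    remove : ∀ {I : Subset n} {f} → f ∈ I → ∃ λ I′ → I′ ⊆ I × f ∉ I′ × (∀ {x} → x ∈ I → x ≢ f → x ∈ I′) × suc ∣ I′ ∣ ≡ ∣ I ∣
    remove {I} {f} f∈I = I′ , proj₁ ∘ x∈p∩q⁻ I (∁ ⁅ f ⁆) , f∉I′ , stays ,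
      trans (sym (∣∪⁅⁆∣ f∉I′)) (cong ∣_∣ (⊆-antisym
        (λ x∈ → Sum.[ proj₁ ∘ x∈p∩q⁻ I (∁ ⁅ f ⁆) , (λ { refl → f∈I }) ] (∈∪⁅⁆⁻ x∈))
        (λ {x} x∈I → back x (x FinP.≟ f) x∈I)))
      where
      I′ = I ∩ ∁ ⁅ f ⁆
      f∉I′ : f ∉ I′
      f∉I′ f∈ = x∈∁p⇒x∉p (proj₂ (x∈p∩q⁻ I (∁ ⁅ f ⁆) f∈)) (x∈⁅x⁆ f)
      stays : ∀ {x} → x ∈ I → x ≢ f → x ∈ I′
      stays x∈I x≢f = x∈p∩q⁺ (x∈I , x∉p⇒x∈∁p (x≢f ∘ x∈⁅y⁆⇒x≡y f))
      back : ∀ x → Dec (x ≡ f) → x ∈ I → x ∈ I′ ∪ ⁅ f ⁆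
      back x (yes refl) _ = ∈∪⁅⁆ʳ
      back x (no x≢f) x∈I = ∈∪⁅⁆ˡ (stays x∈I x≢f)

  cospanning-linked : ∀ S j → 2 ℕ.+ (∣ S ∣ ℕ.+ j) ℕ.≤ n → AllJoined (just (S , j))
  cospanning-linked S j 2+≤n = go
    where
    s = just (S , j)

    live-y : ∀ {e} → e ∉ S → Free (S ∪ ⁅ e ⁆) (suc j) → Live₂ s zero (suc e)
    live-y e∉S free = adjoin-live⁺ e∉S (free⇒live free)

    live-x : ∀ {e f} → e ≢ f → e ∉ S → f ∉ S → Free ((S ∪ ⁅ e ⁆) ∪ ⁅ f ⁆) j → Live₂ s (suc e) (suc f)
    live-x {e} {f} e≢f e∉S f∉S free = subst (λ t → Live (step t (suc f))) (sym (adjoin-∉ (e ∈? S) e∉S)) (adjoin-live⁺ (∉∪⁅⁆ f∉S (e≢f ∘ sym)) (free⇒live free))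

    -- Two letters to go leave room: `S`, `I` and `e` account for at most `|S| + j + 1 < n`
    -- elements. The element found serves as intermediate vertex.
    outside-both : ∀ {I : Subset n} {e} → ∣ I ∣ ℕ.≤ j → ∃ λ g → g ∉ S × g ∉ I × g ≢ e
    outside-both {I} {e} le =
      let g , g∉ = outsider {p = S ∪ (I ∪ ⁅ e ⁆)} (ℕP.≤-<-trans (∣∪∣≤ S (I ∪ ⁅ e ⁆)) (ℕP.≤-<-trans (ℕP.+-monoʳ-≤ ∣ S ∣ (ℕP.≤-trans (∣∪∣≤ I ⁅ e ⁆)
            (subst (λ k → ∣ I ∣ ℕ.+ k ℕ.≤ suc j) (sym (∣⁅x⁆∣≡1 e)) (subst (ℕ._≤ suc j) (sym (ℕP.+-comm ∣ I ∣ 1)) (ℕ.s≤s le)))))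
            (subst (λ k → suc k ℕ.≤ n) (sym (+-suc ∣ S ∣ j)) 2+≤n)))
      in g , (λ g∈S → g∉ (x∈p∪q⁺ (inj₁ g∈S))) , (λ g∈I → g∉ (x∈p∪q⁺ (inj₂ (∈∪⁅⁆ˡ g∈I)))) , (λ g≡e → g∉ (x∈p∪q⁺ {q = I ∪ ⁅ e ⁆} (inj₂ (subst (_∈ I ∪ ⁅ e ⁆) (sym g≡e) ∈∪⁅⁆ʳ))))

    y–x : ∀ e → Live (step s zero) → Live (step s (suc e)) → Live₂ s zero (suc e) ⊎ ∃ λ l → Live₂ s zero l × Live₂ s l (suc e)
    y–x e ly lx with adjoin-live⁻ lx
    ... | e∉S , le with live⇒free ly | live⇒free le
    ... | I₀ , ind₀ , dis₀ , size₀ | I , ind , dis , size with suc j ℕP.≤? ∣ I ∣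
    ... | yes big = inj₁ (live-y e∉S (I , ind , dis , big))
    ... | no ¬big with augmentation 𝑀 ind ind₀ (ℕP.<-≤-trans (≰⇒> ¬big) size₀)
    ... | x , x∈I₀ , x∉I , ind′ with x FinP.≟ e
    ... | no x≢e = inj₁ (live-y e∉S (I ∪ ⁅ x ⁆ , ind′ , ∪-free dis (∉∪⁅⁆ (dis₀ x∈I₀) x≢e) , subst (suc j ℕ.≤_) (sym (∣∪⁅⁆∣ x∉I)) (ℕ.s≤s size)))
    -- The augmenting element is `e` itself. The enlarged set avoids `S` and `f`, giving the edge
    -- from `y` to x_f, while `I` avoids `S`, `f` and `e`, giving the edge from x_f to x_e.
    ... | yes refl with outside-both {I} {x} (ℕ.s≤s⁻¹ (≰⇒> ¬big))
    ... | f , f∉S , f∉I , f≢e = let dis′ , e∉I = drop {S} {x} {I} dis in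
      inj₂ (suc f
        , live-y f∉S (I ∪ ⁅ x ⁆ , ind′ , free-∪ (∪-free dis′ e∉S) (∉∪⁅⁆ f∉I f≢e) , subst (suc j ℕ.≤_) (sym (∣∪⁅⁆∣ x∉I)) (ℕ.s≤s size))
        , live-x f≢e f∉S e∉S (I , ind , free-∪ (free-∪ dis′ f∉I) e∉I , size))

    x–x : ∀ e f → e ≢ f → Live (step s (suc e)) → Live (step s (suc f)) → Live₂ s (suc e) (suc f) ⊎ ∃ λ l → Live₂ s (suc e) l × Live₂ s l (suc f)
    x–x e f e≢f le lf with adjoin-live⁻ le | adjoin-live⁻ lf
    ... | e∉S , le′ | f∉S , lf′ with live⇒free le′ | live⇒free lf′
    ... | I , indI , disI , sizeI | K , indK , disK , sizeK with drop {S} {e} {I} disI | drop {S} {f} {K} disK | f ∈? I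
    ... | dI , e∉I | dK , f∉K | no f∉I = inj₁ (live-x e≢f e∉S f∉S (I , indI , free-∪ disI f∉I , sizeI))
    ... | dI , e∉I | dK , f∉K | yes f∈I with remove f∈I | suc j ℕP.≤? ∣ I ∣
    ... | I′ , I′⊆I , f∉I′ , stays , size′ | yes big = inj₁ (live-x e≢f e∉S f∉S (I′ , hereditary 𝑀 I′⊆I indI , free-∪ (disI ∘ I′⊆I) f∉I′ , ℕ.s≤s⁻¹ (subst (suc j ℕ.≤_) (sym size′) big)))
    -- `I` has just `j` elements, one of them `f`; the loss of `f` is made good by an element `x` of
    -- `K`, a set avoiding `f`. Then `I` avoids `e` and `g`, and `I′ ∪ ⁅ x ⁆` avoids `g` and `f`,
    -- unless `x = g`, when the latter set avoids `e` and `f` at once.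
    ... | I′ , I′⊆I , f∉I′ , stays , size′ | no ¬big with augmentation 𝑀 (hereditary 𝑀 I′⊆I indI) indK (ℕP.<-≤-trans (subst (ℕ._≤ j) (sym size′) (ℕ.s≤s⁻¹ (≰⇒> ¬big))) sizeK)
    ... | x , x∈K , x∉I′ , ind″ with outside-both {I} {e} (ℕ.s≤s⁻¹ (≰⇒> ¬big))
    ... | g , g∉S , g∉I , g≢e = result (x FinP.≟ g)
      where
      x≢f : x ≢ f
      x≢f refl = f∉K x∈K
      g≢f : g ≢ f
      g≢f refl = g∉I f∈I
      size″ : j ℕ.≤ ∣ I′ ∪ ⁅ x ⁆ ∣
      size″ = subst (j ℕ.≤_) (sym (trans (∣∪⁅⁆∣ x∉I′) size′)) sizeI
      dis″ : ∀ {z} → z ∈ I′ ∪ ⁅ x ⁆ → z ∉ S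
      dis″ = ∪-free (dI ∘ I′⊆I) (dK x∈K)
      f∉I″ : f ∉ I′ ∪ ⁅ x ⁆
      f∉I″ = ∉∪⁅⁆ f∉I′ (x≢f ∘ sym)
      result : Dec (x ≡ g) → Live₂ s (suc e) (suc f) ⊎ ∃ λ l → Live₂ s (suc e) l × Live₂ s l (suc f)
      result (yes x≡g) = inj₁ (live-x e≢f e∉S f∉S (I′ ∪ ⁅ x ⁆ , ind″ , free-∪ (free-∪ dis″ (∉∪⁅⁆ (e∉I ∘ I′⊆I) (λ e≡x → g≢e (sym (trans e≡x x≡g))))) f∉I″ , size″))
      result (no x≢g) = inj₂ (suc g
        , live-x (g≢e ∘ sym) e∉S g∉S (I , indI , free-∪ disI g∉I , sizeI)
        , live-x g≢f g∉S f∉S (I′ ∪ ⁅ x ⁆ , ind″ , free-∪ (free-∪ dis″ (∉∪⁅⁆ (g∉I ∘ I′⊆I) (x≢g ∘ sym))) f∉I″ , size″))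

    go : AllJoined s
    go zero    zero    _ _ = inj₁ refl
    go zero    (suc f) l m = inj₂ (y–x f l m)
    go (suc e) zero    l m = inj₂ (Sum.map (Live₂-sym s {zero} {suc e}) (λ (h , a , b) → h , Live₂-sym s {h} {suc e} b , Live₂-sym s {zero} {h} a) (y–x e m l))
    go (suc e) (suc f) l m with e FinP.≟ f
    ... | yes e≡f = inj₁ (cong suc e≡f)
    ... | no e≢f  = inj₂ (x–x e f e≢f l m)

  cospanning-hyperbolic : ∀ S j → ∣ S ∣ ℕ.+ j ℕ.+ 2 ≡ n → Hyperbolic (hessian [] (run (just (S , j))))
  cospanning-hyperbolic S j full = go (φ? S)
    where
    open QuadraticPart φ? {S} {j} full
    -- Augmentation applied to the complements: the element entering `∁ T` is one that `T` can
    -- spare.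
    exchange : ∀ {T U : Subset n} → φ T → φ U → ∣ U ∣ ℕ.< ∣ T ∣ → ∃ λ x → x ∈ T × x ∉ U × φ (T ∩ ∁ ⁅ x ⁆)
    exchange {T} {U} φT φU U<T =
      let x , x∈ , x∉ , ind = augmentation 𝑀 φT φU (∁-antitone-< {p = U} {q = T} U<T)
      in x , x∉∁p⇒x∈p x∉ , x∈∁p⇒x∉p x∈ , hereditary 𝑀 (λ {y} y∈ → back x y (y FinP.≟ x) y∈) ind
      where
      back : ∀ x y → Dec (y ≡ x) → y ∈ ∁ (T ∩ ∁ ⁅ x ⁆) → y ∈ ∁ T ∪ ⁅ x ⁆
      back x y (yes refl) _ = ∈∪⁅⁆ʳ
      back x y (no y≢x) y∈ = ∈∪⁅⁆ˡ (x∉p⇒x∈∁p λ y∈T → x∈∁p⇒x∉p y∈ (x∈p∩q⁺ (y∈T , x∉p⇒x∈∁p (y≢x ∘ x∈⁅y⁆⇒x≡y x))))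
    removal : ∀ {T T′ : Subset n} {x} → (∀ {y} → y ∈ T → y ∈ T′ ⊎ y ≡ x) → φ (T ∩ ∁ ⁅ x ⁆) → φ T′
    removal {T} {T′} {x} T⊆ = φ-mono λ {y} y∈ → Sum.[ (λ y∈T′ → y∈T′) , (λ { refl → contradiction (x∈⁅x⁆ y) (x∈∁p⇒x∉p (proj₂ (x∈p∩q⁻ T (∁ ⁅ x ⁆) y∈))) }) ] (T⊆ (proj₁ (x∈p∩q⁻ T (∁ ⁅ x ⁆) y∈)))
    ∣+∣ : ∀ {e f} → e ≢ f → e ∉ S → f ∉ S → ∣ (S ∪ ⁅ e ⁆) ∪ ⁅ f ⁆ ∣ ≡ suc (suc ∣ S ∣)
    ∣+∣ e≢f e∉S f∉S = trans (∣∪⁅⁆∣ (∉∪⁅⁆ f∉S (e≢f ∘ sym))) (cong suc (∣∪⁅⁆∣ e∉S))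
    swap : ∀ {T : Subset n} {e f y} → y ∈ (T ∪ ⁅ e ⁆) ∪ ⁅ f ⁆ → y ∈ T ∪ ⁅ f ⁆ ⊎ y ≡ e
    swap y∈ with ∈∪⁅⁆⁻ y∈
    ... | inj₂ refl = inj₁ ∈∪⁅⁆ʳ
    ... | inj₁ y∈T+e = Sum.map₁ ∈∪⁅⁆ˡ (∈∪⁅⁆⁻ y∈T+e)
    -- Exchange between `S + e + f` and `S + e₀` drops an element outside `S`, hence `e` or `f`, and
    -- the other one is then in `B`.
    G⇒B : ∀ {e₀} → B e₀ → ∀ {e f} → G e f → B e ⊎ B f
    G⇒B (e₀∉S , φe₀) {e} {f} (e≢f , e∉S , f∉S , φef)
      with exchange φef φe₀ (ℕP.≤-reflexive (trans (cong suc (∣∪⁅⁆∣ e₀∉S)) (sym (∣+∣ e≢f e∉S f∉S))))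
    ... | x , x∈ , x∉ , φ′ with ∈∪⁅⁆⁻ x∈
    ... | inj₂ refl = inj₁ (e∉S , removal ∈∪⁅⁆⁻ φ′)
    ... | inj₁ x∈S+e with ∈∪⁅⁆⁻ x∈S+e
    ... | inj₁ x∈S  = contradiction (∈∪⁅⁆ˡ x∈S) x∉
    ... | inj₂ refl = inj₂ (f∉S , removal swap φ′)
    B⇒G : ∀ {e f} → e ≢ f → e ∉ S → f ∉ S → B e ⊎ B f → G e f
    B⇒G e≢f e∉S f∉S (inj₁ (_ , φe)) = e≢f , e∉S , f∉S , φ-mono ∈∪⁅⁆ˡ φe
    B⇒G {e} {f} e≢f e∉S f∉S (inj₂ (_ , φf)) = e≢f , e∉S , f∉S , subst φ (∪⁅⁆-swap S f e) (φ-mono ∈∪⁅⁆ˡ φf)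
    -- The edge `f h` provides `S + f + h`, against which `S + e + g + f` can spare `e` or `g`; what
    -- is left is an edge at `f`.
    cotrans : ∀ {e f g} → (∃ λ h → G f h) → ¬ G e f → ¬ G f g → ¬ G e g
    cotrans {e} {f} {g} (h , f≢h , f∉S , h∉S , φfh) ¬ef ¬fg (e≢g , e∉S , g∉S , φeg) with e FinP.≟ f | f FinP.≟ g
    ... | yes refl | _ = ¬fg (e≢g , e∉S , g∉S , φeg)
    ... | no _ | yes refl = ¬ef (e≢g , e∉S , g∉S , φeg)
    ... | no e≢f | no f≢g
      with exchange {T = ((S ∪ ⁅ e ⁆) ∪ ⁅ g ⁆) ∪ ⁅ f ⁆} (φ-mono ∈∪⁅⁆ˡ φeg) φfh
        (ℕP.≤-reflexive (trans (cong suc (trans (∣+∣ f≢h f∉S h∉S) (sym (∣+∣ e≢g e∉S g∉S)))) (sym (∣∪⁅⁆∣ (∉∪⁅⁆ (∉∪⁅⁆ f∉S (e≢f ∘ sym)) f≢g)))))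
    ... | x , x∈ , x∉ , φ′ with ∈∪⁅⁆⁻ x∈
    ... | inj₂ refl = x∉ (∈∪⁅⁆ˡ ∈∪⁅⁆ʳ)
    ... | inj₁ x∈S+e+g with ∈∪⁅⁆⁻ x∈S+e+g
    ... | inj₂ refl = ¬ef (e≢f , e∉S , f∉S , removal swap φ′)
    ... | inj₁ x∈S+e with ∈∪⁅⁆⁻ x∈S+e
    ... | inj₁ x∈S  = x∉ (∈∪⁅⁆ˡ (∈∪⁅⁆ˡ x∈S))
    ... | inj₂ refl = ¬fg (G-sym (f≢g ∘ sym , g∉S , f∉S , removal (λ y∈ → Sum.[ (λ y∈S+e+g → Sum.map₁ ∈∪⁅⁆ˡ (swap y∈S+e+g)) , (λ { refl → inj₁ ∈∪⁅⁆ʳ }) ] (∈∪⁅⁆⁻ y∈)) φ′))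
    cotrans-full : φ S → ∀ {e f g} → B e → B f → B g → ¬ G e f → ¬ G f g → ¬ G e g
    cotrans-full φS {e} {f} {g} (e∉S , φe) (f∉S , φf) (g∉S , _) ¬ef ¬fg (e≢g , _) with e FinP.≟ f
    ... | no e≢f   = ¬ef (B⇒G e≢f e∉S f∉S (inj₁ (e∉S , φe)))
    ... | yes refl = ¬fg (B⇒G e≢g f∉S g∉S (inj₁ (f∉S , φf)))
    inactive : ∀ {f g} → (∃ λ h → G⁺ (suc f) h) → ¬ B f → ¬ G f g → ¬ B g
    inactive (zero , Bf) ¬Bf _ _ = ¬Bf Bf
    inactive {f} {g} (suc h , _ , f∉S , _) ¬Bf ¬fg Bg with f FinP.≟ g
    ... | yes refl = ¬Bf Bg
    ... | no f≢g   = ¬fg (B⇒G f≢g f∉S (proj₁ Bg) (inj₂ Bg))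
    -- If `B` is inhabited, its members are singleton parts and `y` forms one part with the other
    -- non-isolated vertices. If it is empty, `y` is isolated and `cotrans` covers the rest.
    cotrans⁺ : ∀ {a b d} → (∃ λ h → G⁺ b h) → ¬ G⁺ a b → ¬ G⁺ b d → ¬ G⁺ a d
    cotrans⁺ {zero}  {zero}  {suc g} _ _ ¬bd ad = ¬bd ad
    cotrans⁺ {suc e} {zero}  {zero}  _ ¬ab _ ad = ¬ab ad
    cotrans⁺ {suc e} {zero}  {suc g} (suc h , Bh) ¬Be ¬Bg eg = Sum.[ ¬Be , ¬Bg ] (G⇒B Bh eg)
    cotrans⁺ {zero}  {suc f} {suc g} act ¬Bf ¬fg Bg = inactive act ¬Bf ¬fg Bg
    cotrans⁺ {suc e} {suc f} {zero}  act ¬ef ¬Bf Be = inactive act ¬Bf (λ g → ¬ef (G-sym g)) Be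
    cotrans⁺ {suc e} {suc f} {suc g} (suc h , fh) ¬ef ¬fg eg = cotrans (h , fh) ¬ef ¬fg eg
    cotrans⁺ {suc e} {suc f} {suc g} (zero , Bf) ¬ef ¬fg eg@(_ , e∉S , _) with e FinP.≟ f
    ... | yes refl = ¬fg eg
    ... | no e≢f   = ¬ef (B⇒G e≢f e∉S (proj₁ Bf) (inj₂ Bf))
    go : Dec (φ S) → Hyperbolic M
    go (yes φS) = hyperbolic-cone φS (λ (_ , e∉S , _) → e∉S , φ-mono ∈∪⁅⁆ˡ φS) (cotrans-full φS)
    go (no ¬φS) = hyperbolic-multipartite ¬φS (λ {a} {b} {d} → cotrans⁺ {a} {b} {d})

  cospanning-Lorentzian : Lorentzian n polynomial
  cospanning-Lorentzian = run-Lorentzian cospanning-linked cospanning-hyperbolic n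
    (cong (λ k → k ℕ.+ 0 ℕ.+ n) (∣⊥∣≡0 n))

-- Counting nested pairs

Σ⊆ : ∀ {n} → (Subset n → ℚ) → ℚ
Σ⊆ {zero}  g = g []
Σ⊆ {suc n} g = Σ⊆ (λ A → g (outside ∷ A)) + Σ⊆ (λ A → g (inside ∷ A))

Σ⊆-cong : ∀ {n} {f g : Subset n → ℚ} → (∀ A → f A ≡ g A) → Σ⊆ f ≡ Σ⊆ g
Σ⊆-cong {zero}  f≡g = f≡g []
Σ⊆-cong {suc n} f≡g = cong₂ _+_ (Σ⊆-cong λ A → f≡g (outside ∷ A)) (Σ⊆-cong λ A → f≡g (inside ∷ A))

Σ⊆-* : ∀ {n} (c : ℚ) (f : Subset n → ℚ) → Σ⊆ (λ A → c * f A) ≡ c * Σ⊆ f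
Σ⊆-* {zero}  c f = refl
Σ⊆-* {suc n} c f = trans (cong₂ _+_ (Σ⊆-* c (λ A → f (outside ∷ A))) (Σ⊆-* c (λ A → f (inside ∷ A)))) (sym (*-distribˡ-+ c (Σ⊆ λ A → f (outside ∷ A)) (Σ⊆ λ A → f (inside ∷ A))))

Σ⊆-+ : ∀ {n} (f g : Subset n → ℚ) → Σ⊆ (λ A → f A + g A) ≡ Σ⊆ f + Σ⊆ g
Σ⊆-+ {zero}  f g = refl
Σ⊆-+ {suc n} f g = trans
  (cong₂ _+_ (Σ⊆-+ (λ A → f (outside ∷ A)) (λ A → g (outside ∷ A))) (Σ⊆-+ (λ A → f (inside ∷ A)) (λ A → g (inside ∷ A))))
  (solve 4 (λ x y z w → (x :+ y) :+ (z :+ w) := (x :+ z) :+ (y :+ w)) refl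
    (Σ⊆ λ A → f (outside ∷ A)) (Σ⊆ λ A → g (outside ∷ A)) (Σ⊆ λ A → f (inside ∷ A)) (Σ⊆ λ A → g (inside ∷ A)))

Σ⊆-zero : ∀ {n} {f : Subset n → ℚ} → (∀ A → f A ≡ 0ℚ) → Σ⊆ f ≡ 0ℚ
Σ⊆-zero {zero}  f≡0 = f≡0 []
Σ⊆-zero {suc n} f≡0 = cong₂ _+_ (Σ⊆-zero λ A → f≡0 (outside ∷ A)) (Σ⊆-zero λ A → f≡0 (inside ∷ A))

Σ⊆-sum : ∀ {m n} (f : Fin m → Subset n → ℚ) → sum (λ i → Σ⊆ (f i)) ≡ Σ⊆ (λ A → sum (λ i → f i A))
Σ⊆-sum {n = zero}  f = refl
Σ⊆-sum {n = suc n} f = trans (sum-+ (λ i → Σ⊆ λ A → f i (outside ∷ A)) (λ i → Σ⊆ λ A → f i (inside ∷ A)))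
  (cong₂ _+_ (Σ⊆-sum λ i A → f i (outside ∷ A)) (Σ⊆-sum λ i A → f i (inside ∷ A)))

Σ⊆-swap : ∀ {m n} (f : Subset m → Subset n → ℚ) → Σ⊆ (λ A → Σ⊆ (f A)) ≡ Σ⊆ (λ B → Σ⊆ (λ A → f A B))
Σ⊆-swap {zero}  f = refl
Σ⊆-swap {suc m} f = trans (cong₂ _+_ (Σ⊆-swap λ A → f (outside ∷ A)) (Σ⊆-swap λ A → f (inside ∷ A)))
  (sym (Σ⊆-+ (λ B → Σ⊆ λ A → f (outside ∷ A) B) (λ B → Σ⊆ λ A → f (inside ∷ A) B)))

Σ⊆-∁ : ∀ {n} (f : Subset n → ℚ) → Σ⊆ (λ A → f (∁ A)) ≡ Σ⊆ f
Σ⊆-∁ {zero}  f = refl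
Σ⊆-∁ {suc n} f = trans (cong₂ _+_ (Σ⊆-∁ λ A → f (inside ∷ A)) (Σ⊆-∁ λ A → f (outside ∷ A))) (ℚP.+-comm (Σ⊆ λ A → f (inside ∷ A)) (Σ⊆ λ A → f (outside ∷ A)))

Σ⊆-single : ∀ {n} (S : Subset n) {f : Subset n → ℚ} → (∀ A → A ≢ S → f A ≡ 0ℚ) → Σ⊆ f ≡ f S
Σ⊆-single [] f≡0 = refl
Σ⊆-single (outside ∷ S) {f} f≡0 = trans (cong₂ _+_ (Σ⊆-single S λ A A≢S → f≡0 (outside ∷ A) λ { refl → A≢S refl }) (Σ⊆-zero λ A → f≡0 (inside ∷ A) λ ())) (+-identityʳ (f (outside ∷ S)))
Σ⊆-single (inside ∷ S) {f} f≡0 = trans (cong₂ _+_ (Σ⊆-zero λ A → f≡0 (outside ∷ A) λ ()) (Σ⊆-single S λ A A≢S → f≡0 (inside ∷ A) λ { refl → A≢S refl })) (+-identityˡ (f (inside ∷ S)))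

module _ {A : Set} where

  sumL : List A → (A → ℚ) → ℚ
  sumL []       g = 0ℚ
  sumL (x ∷ xs) g = g x + sumL xs g

  sumL-++ : ∀ xs ys g → sumL (xs ++ ys) g ≡ sumL xs g + sumL ys g
  sumL-++ []       ys g = sym (+-identityˡ (sumL ys g))
  sumL-++ (x ∷ xs) ys g = trans (cong (g x +_) (sumL-++ xs ys g)) (sym (ℚP.+-assoc (g x) (sumL xs g) (sumL ys g)))

  sumL-cong : ∀ xs {f g : A → ℚ} → (∀ x → f x ≡ g x) → sumL xs f ≡ sumL xs g
  sumL-cong []       f≡g = refl
  sumL-cong (x ∷ xs) f≡g = cong₂ _+_ (f≡g x) (sumL-cong xs f≡g)

  length-filter : ∀ {P : A → Set} (P? : Decidable P) xs → ι (length (filter P? xs)) ≡ sumL xs (λ x → 𝕀 (P? x))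
  length-filter P? []       = refl
  length-filter P? (x ∷ xs) with P? x
  ... | yes _ = cong (1ℚ +_) (length-filter P? xs)
  ... | no _  = trans (length-filter P? xs) (sym (+-identityˡ _))

sumL-map : ∀ {A B : Set} (f : A → B) xs g → sumL (map f xs) g ≡ sumL xs (λ x → g (f x))
sumL-map f []       g = refl
sumL-map f (x ∷ xs) g = cong (g (f x) +_) (sumL-map f xs g)

sumL-cartesianProduct : ∀ {A B : Set} (xs : List A) (ys : List B) g →
  sumL (cartesianProduct xs ys) g ≡ sumL xs (λ x → sumL ys (λ y → g (x , y)))
sumL-cartesianProduct []       ys g = refl
sumL-cartesianProduct (x ∷ xs) ys g = trans (sumL-++ (map (x ,_) ys) (cartesianProduct xs ys) g)
  (cong₂ _+_ (sumL-map (x ,_) ys g) (sumL-cartesianProduct xs ys g))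

sumL-subsets : ∀ n g → sumL (subsets n) g ≡ Σ⊆ g
sumL-subsets zero    g = +-identityʳ (g [])
sumL-subsets (suc n) g = trans (sumL-++ (map (outside ∷_) (subsets n)) (map (inside ∷_) (subsets n)) g) (cong₂ _+_
  (trans (sumL-map (outside ∷_) (subsets n) g) (sumL-subsets n (λ A → g (outside ∷ A))))
  (trans (sumL-map (inside ∷_) (subsets n) g) (sumL-subsets n (λ A → g (inside ∷ A)))))

ι-J : ∀ {n} (M₁ M₂ : Matroid n) k → ι (J M₁ M₂ k) ≡ Σ⊆ (λ I → Σ⊆ (λ U → 𝕀 (nestedPair? M₁ M₂ k (I , U))))
ι-J {n} M₁ M₂ k = begin
  ι (J M₁ M₂ k) ≡⟨ length-filter (nestedPair? M₁ M₂ k) (cartesianProduct (subsets n) (subsets n)) ⟩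
  sumL (cartesianProduct (subsets n) (subsets n)) (λ p → 𝕀 (nestedPair? M₁ M₂ k p)) ≡⟨ sumL-cartesianProduct (subsets n) (subsets n) (λ p → 𝕀 (nestedPair? M₁ M₂ k p)) ⟩
  sumL (subsets n) (λ I → sumL (subsets n) (λ U → 𝕀 (nestedPair? M₁ M₂ k (I , U)))) ≡⟨ sumL-cong (subsets n) (λ I → sumL-subsets n (λ U → 𝕀 (nestedPair? M₁ M₂ k (I , U)))) ⟩
  sumL (subsets n) (λ I → Σ⊆ (λ U → 𝕀 (nestedPair? M₁ M₂ k (I , U)))) ≡⟨ sumL-subsets n (λ I → Σ⊆ (λ U → 𝕀 (nestedPair? M₁ M₂ k (I , U)))) ⟩
  Σ⊆ (λ I → Σ⊆ (λ U → 𝕀 (nestedPair? M₁ M₂ k (I , U)))) ∎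
  where open ≡-Reasoning

-- Each element of `U ─ I` is free to lie in `A` or not: the origin of the powers of two.
sum-between : ∀ {n} (I U : Subset n) → Σ⊆ (λ A → 𝕀 (I ⊆? A) * 𝕀 (A ⊆? U)) ≡ 𝕀 (I ⊆? U) * ι (2 ^ ∣ U ─ I ∣)
sum-between [] [] = refl
sum-between {suc n} (i ∷ I) (u ∷ U) = go i u
  where
  open ≡-Reasoning
  ⊆-out : ∀ q (A B : Subset n) → 𝕀 (outside ∷ A ⊆? q ∷ B) ≡ 𝕀 (A ⊆? B)
  ⊆-out q A B = 𝕀-cong (outside ∷ A ⊆? q ∷ B) (A ⊆? B) drop-∷-⊆ out⊆
  ⊆-in : ∀ (A B : Subset n) → 𝕀 (inside ∷ A ⊆? inside ∷ B) ≡ 𝕀 (A ⊆? B)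
  ⊆-in A B = 𝕀-cong (inside ∷ A ⊆? inside ∷ B) (A ⊆? B) drop-∷-⊆ in⊆in
  in⊈out : ∀ (A B : Subset n) → 𝕀 (inside ∷ A ⊆? outside ∷ B) ≡ 0ℚ
  in⊈out A B = 𝕀-no (inside ∷ A ⊆? outside ∷ B) λ A⊆B → zero∉ (A⊆B here)
    where
    zero∉ : ∀ {C : Subset n} → ¬ (zero ∈ outside ∷ C)
    zero∉ ()
  c = ι (2 ^ ∣ U ─ I ∣)
  rec : Σ⊆ (λ A → 𝕀 (I ⊆? A) * 𝕀 (A ⊆? U)) ≡ 𝕀 (I ⊆? U) * ι (2 ^ ∣ U ─ I ∣)
  rec = sum-between I U
  go : ∀ i u → Σ⊆ (λ A → 𝕀 (i ∷ I ⊆? outside ∷ A) * 𝕀 (outside ∷ A ⊆? u ∷ U)) + Σ⊆ (λ A → 𝕀 (i ∷ I ⊆? inside ∷ A) * 𝕀 (inside ∷ A ⊆? u ∷ U))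
    ≡ 𝕀 (i ∷ I ⊆? u ∷ U) * ι (2 ^ ∣ (u ∷ U) ─ (i ∷ I) ∣)
  go outside outside = trans (cong₂ _+_ (trans (Σ⊆-cong λ A → cong₂ _*_ (⊆-out outside I A) (⊆-out outside A U)) rec) (Σ⊆-zero λ A → *-≡0ʳ (𝕀 (outside ∷ I ⊆? inside ∷ A)) (in⊈out A U)))
    (trans (+-identityʳ (𝕀 (I ⊆? U) * c)) (cong (_* c) (sym (⊆-out outside I U))))
  go outside inside = trans (cong₂ _+_ (trans (Σ⊆-cong λ A → cong₂ _*_ (⊆-out outside I A) (⊆-out inside A U)) rec) (trans (Σ⊆-cong λ A → cong₂ _*_ (⊆-out inside I A) (⊆-in A U)) rec))
    (trans (solve 2 (λ a b → a :* b :+ a :* b := a :* ((con 1ℚ :+ (con 1ℚ :+ con 0ℚ)) :* b)) refl (𝕀 (I ⊆? U)) c)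
      (cong₂ _*_ (sym (⊆-out inside I U)) (sym (ι-* 2 (2 ^ ∣ U ─ I ∣)))))
  go inside outside = trans (cong₂ _+_ (Σ⊆-zero λ A → *-≡0ˡ (𝕀 (outside ∷ A ⊆? outside ∷ U)) (in⊈out I A)) (Σ⊆-zero λ A → *-≡0ʳ (𝕀 (inside ∷ I ⊆? inside ∷ A)) (in⊈out A U)))
    (sym (*-≡0ˡ c (in⊈out I U)))
  go inside inside = trans (cong₂ _+_ (Σ⊆-zero λ A → *-≡0ˡ (𝕀 (outside ∷ A ⊆? inside ∷ U)) (in⊈out I A)) (trans (Σ⊆-cong λ A → cong₂ _*_ (⊆-in I A) (⊆-in A U)) rec))
    (trans (+-identityˡ (𝕀 (I ⊆? U) * c)) (cong (_* c) (sym (⊆-in I U))))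

-- Only elements of `U` outside `S` contribute. They are the possible first letters on the way from
-- `S` to `U`, and counting them at each stage produces `k !`.
sum-extensions : ∀ {n} (S U : Subset n) → sum (λ e → 𝕀 (¬? (e ∈? S)) * 𝕀 (S ∪ ⁅ e ⁆ ⊆? U)) ≡ 𝕀 (S ⊆? U) * (ι (∣ U ∣) - ι (∣ S ∣))
sum-extensions {n} S U = trans (sum-cong-≗ λ e → term e (S ⊆? U) (e ∈? S) (e ∈? U) (S ∪ ⁅ e ⁆ ⊆? U))
  (trans (sum-* s (λ e → 𝕀 (e ∈? U) - 𝕀 (e ∈? S))) (cong (s *_) (trans (sum-minus (λ e → 𝕀 (e ∈? U)) (λ e → 𝕀 (e ∈? S))) (cong₂ _-_ (sum-𝕀-∈ U) (sum-𝕀-∈ S)))))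
  where
  s = 𝕀 (S ⊆? U)
  term : ∀ e (d : Dec (S ⊆ U)) (a : Dec (e ∈ S)) (b : Dec (e ∈ U)) (c : Dec (S ∪ ⁅ e ⁆ ⊆ U)) → 𝕀 (¬? a) * 𝕀 c ≡ 𝕀 d * (𝕀 b - 𝕀 a)
  term e (yes S⊆U) (yes e∈S) (no e∉U) c         = contradiction (S⊆U e∈S) e∉U
  term e (yes S⊆U) (yes e∈S) (yes _) (yes _)    = refl
  term e (yes S⊆U) (yes e∈S) (yes _) (no _)     = refl
  term e (yes S⊆U) (no e∉S) (yes e∈U) (yes _)   = refl
  term e (yes S⊆U) (no e∉S) (yes e∈U) (no ¬c)   = ⊥-elim (¬c λ x∈ → Sum.[ S⊆U , (λ { refl → e∈U }) ] (∈∪⁅⁆⁻ x∈))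
  term e (yes S⊆U) (no e∉S) (no e∉U) (yes c)    = contradiction (c ∈∪⁅⁆ʳ) e∉U
  term e (yes S⊆U) (no e∉S) (no e∉U) (no _)     = refl
  term e (no ¬S⊆U) a b (yes c)                  = ⊥-elim (¬S⊆U λ x∈S → c (∈∪⁅⁆ˡ x∈S))
  term e (no ¬S⊆U) (yes _) (yes _) (no _)       = refl
  term e (no ¬S⊆U) (yes _) (no _) (no _)        = refl
  term e (no ¬S⊆U) (no _) (yes _) (no _)        = refl
  term e (no ¬S⊆U) (no _) (no _) (no _)         = refl

⊆∧size⇒≡ : ∀ {n} {p q : Subset n} → p ⊆ q → ∣ q ∣ ℕ.≤ ∣ p ∣ → q ≡ p
⊆∧size⇒≡ {p = p} {q} p⊆q size = ⊆-antisym q⊆p p⊆q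
  where
  q⊆p : q ⊆ p
  q⊆p {x} x∈q with x ∈? p
  ... | yes x∈p = x∈p
  ... | no x∉p  = contradiction (ℕP.<-≤-trans (p⊂q⇒∣p∣<∣q∣ {p = p} {q = q} (p⊆q , x , x∈q , x∉p)) size) (ℕP.<-irrefl refl)

∣─∣-+ : ∀ {n} {p q : Subset n} → p ⊆ q → ∣ q ─ p ∣ ℕ.+ ∣ p ∣ ≡ ∣ q ∣
∣─∣-+ {p = []}          {[]}          p⊆q = refl
∣─∣-+ {p = outside ∷ p} {outside ∷ q} p⊆q = ∣─∣-+ {p = p} {q} (drop-∷-⊆ p⊆q)
∣─∣-+ {p = outside ∷ p} {inside ∷ q}  p⊆q = cong suc (∣─∣-+ {p = p} {q} (drop-∷-⊆ p⊆q))
∣─∣-+ {p = inside ∷ p}  {outside ∷ q} p⊆q with () ← p⊆q here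
∣─∣-+ {p = inside ∷ p}  {inside ∷ q}  p⊆q = trans (+-suc ∣ q ─ p ∣ ∣ p ∣) (cong suc (∣─∣-+ {p = p} {q} (drop-∷-⊆ p⊆q)))

∁-involutive : ∀ {n} (p : Subset n) → ∁ (∁ p) ≡ p
∁-involutive []            = refl
∁-involutive (outside ∷ p) = cong (outside ∷_) (∁-involutive p)
∁-involutive (inside ∷ p)  = cong (inside ∷_) (∁-involutive p)

-- Mixed derivatives of the product polynomial

polar-zero : (vs : List (Vect n)) {T : Tensor n} → (∀ w → T w ≡ 0ℚ) → polar vs T ≡ 0ℚ
polar-zero []       T≡0 = T≡0 []
polar-zero (v ∷ vs) T≡0 = sum-zero λ i → *-≡0ʳ (v i) (polar-zero vs λ w → T≡0 (i ∷ w))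

diag : Vect m → Vect (m ℕ.+ m)
diag {m} v i = Sum.[ v , v ] (splitAt m i)

polar-diag : (v : Vect m) (ws : List (Vect (m ℕ.+ m))) (f g : Tensor m) →
  polar (diag v ∷ ws) (f ⊠ g) ≡ sum (λ a → v a * polar ws (∂ a f ⊠ g)) + sum (λ b → v b * polar ws (f ⊠ ∂ b g))
polar-diag {m} v ws f g = trans (sum-↑ m (λ i → diag v i * polar ws (∂ i (f ⊠ g)))) (cong₂ _+_
  (sum-cong-≗ λ a → cong (λ s → Sum.[ v , v ] s * polar ws (branch f g s)) (splitAt-↑ˡ m a m))
  (sum-cong-≗ λ b → cong (λ s → Sum.[ v , v ] s * polar ws (branch f g s)) (splitAt-↑ʳ m m b)))

cancel-≡ : ∀ {c x y} → 0ℚ < c → x * c ≡ y * c → x ≡ y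
cancel-≡ {c} {x} {y} c>0 e = ℚP.≤-antisym (cancel-≤ c>0 (ℚP.≤-reflexive e′)) (cancel-≤ c>0 (ℚP.≤-reflexive (sym e′)))
  where
  e′ : c * x ≡ c * y
  e′ = trans (*-comm c x) (trans e (*-comm y c))

ŷ t̂ : Vect (suc n)
ŷ = δ zero
t̂ = 0ℚ ◂ 𝟙

x̂ : Fin n → Vect (suc n)
x̂ e = δ (suc e)

elements : ∀ n → List (Fin n)
elements zero    = []
elements (suc n) = zero ∷ map suc (elements n)

x̂s : ∀ n → List (Vect (suc n))
x̂s n = map x̂ (elements n)

length-x̂s : ∀ n → length (x̂s n) ≡ n
length-x̂s n = trans (ListP.length-map x̂ (elements n)) (length-elements n)
  where
  length-elements : ∀ n → length (elements n) ≡ n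
  length-elements zero    = refl
  length-elements (suc n) = cong suc (trans (ListP.length-map suc (elements n)) (length-elements n))

Assignment : ∀ n → Set
Assignment n = Subset n → Subset n → ℚ

-- The effect of a derivative along x_e + x′_e: the letter `e` goes to one of the two factors, and
-- the indicators discard repetitions.
assign : Fin n → Assignment n → Assignment n
assign e F S₁ S₂ = 𝕀 (¬? (e ∈? S₁)) * F (S₁ ∪ ⁅ e ⁆) S₂ + 𝕀 (¬? (e ∈? S₂)) * F S₁ (S₂ ∪ ⁅ e ⁆)

assign-cong : ∀ e {F G : Assignment n} → (∀ S₁ S₂ → F S₁ S₂ ≡ G S₁ S₂) → ∀ S₁ S₂ → assign e F S₁ S₂ ≡ assign e G S₁ S₂
assign-cong e F≡G S₁ S₂ = cong₂ (λ p q → 𝕀 (¬? (e ∈? S₁)) * p + 𝕀 (¬? (e ∈? S₂)) * q) (F≡G (S₁ ∪ ⁅ e ⁆) S₂) (F≡G S₁ (S₂ ∪ ⁅ e ⁆))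

assign-suc : ∀ es {F : Assignment (suc n)} b₁ b₂ S₁ S₂ →
  foldr assign F (map suc es) (b₁ ∷ S₁) (b₂ ∷ S₂) ≡ foldr assign (λ S₁ S₂ → F (b₁ ∷ S₁) (b₂ ∷ S₂)) es S₁ S₂
assign-suc []       b₁ b₂ S₁ S₂ = refl
assign-suc {n} (e ∷ es) {F} b₁ b₂ S₁ S₂ = cong₂ _+_
  (cong₂ _*_ (𝕀-suc b₁ S₁) (trans (cong (λ b → G (b ∷ (S₁ ∪ ⁅ e ⁆)) (b₂ ∷ S₂)) (∨-identityʳ b₁)) (assign-suc es b₁ b₂ (S₁ ∪ ⁅ e ⁆) S₂)))
  (cong₂ _*_ (𝕀-suc b₂ S₂) (trans (cong (λ b → G (b₁ ∷ S₁) (b ∷ (S₂ ∪ ⁅ e ⁆))) (∨-identityʳ b₂)) (assign-suc es b₁ b₂ S₁ (S₂ ∪ ⁅ e ⁆))))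
  where
  G = foldr assign F (map suc es)
  𝕀-suc : ∀ b (S : Subset n) → 𝕀 (¬? (suc e ∈? (b ∷ S))) ≡ 𝕀 (¬? (e ∈? S))
  𝕀-suc b S = 𝕀-cong (¬? (suc e ∈? (b ∷ S))) (¬? (e ∈? S)) (λ ∉ e∈S → ∉ (there e∈S)) (λ ∉ e∈ → ∉ (drop-there e∈))

-- Every element goes to exactly one factor, so the outcomes correspond to the share `A` of the
-- second factor.
assign-all : ∀ n (F : Assignment n) → foldr assign F (elements n) ∅ ∅ ≡ Σ⊆ (λ A → F (∁ A) A)
assign-all zero    F = refl
assign-all (suc n) F = cong₂ _+_
  (trans (cong₂ _*_ (𝕀-yes (¬? (zero ∈? (outside ∷ ∅ {n}))) λ ()) (cong (λ S → G (inside ∷ S) (outside ∷ ∅)) (∪-identityʳ ∅)))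
    (trans (*-identityˡ (G (inside ∷ ∅) (outside ∷ ∅))) (trans (assign-suc (elements n) inside outside ∅ ∅) (assign-all n (λ S₁ S₂ → F (inside ∷ S₁) (outside ∷ S₂))))))
  (trans (cong₂ _*_ (𝕀-yes (¬? (zero ∈? (outside ∷ ∅ {n}))) λ ()) (cong (λ S → G (outside ∷ ∅) (inside ∷ S)) (∪-identityʳ ∅)))
    (trans (*-identityˡ (G (outside ∷ ∅) (inside ∷ ∅))) (trans (assign-suc (elements n) outside inside ∅ ∅) (assign-all n (λ S₁ S₂ → F (outside ∷ S₁) (inside ∷ S₂))))))
  where
  G = foldr assign F (map suc (elements n))

module Evaluation {n : ℕ} {φ₁ φ₂ : Subset n → Set} (φ₁? : ∀ S → Dec (φ₁ S)) (φ₂? : ∀ S → Dec (φ₂ S)) where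

  module P₁ = SubsetPolynomial φ₁?
  module P₂ = SubsetPolynomial φ₂?

  State : Set
  State = Maybe (Subset n × ℕ)

  ⟨_⟩ : Subset n → State
  ⟨ S ⟩ = just (S , 0)

  Φ : List (Vect (suc n)) → State → State → ℚ
  Φ vs s₁ s₂ = polar (map diag vs) (P₁.run s₁ ⊠ P₂.run s₂)

  Φ-zeroˡ : ∀ vs s₁ s₂ → (∀ w → P₁.run s₁ w ≡ 0ℚ) → Φ vs s₁ s₂ ≡ 0ℚ
  Φ-zeroˡ vs s₁ s₂ z = polar-zero (map diag vs) (zero-⊠ {f = P₁.run s₁} {P₂.run s₂} (inj₁ z))

  Φ-zeroʳ : ∀ vs s₁ s₂ → (∀ w → P₂.run s₂ w ≡ 0ℚ) → Φ vs s₁ s₂ ≡ 0ℚ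
  Φ-zeroʳ vs s₁ s₂ z = polar-zero (map diag vs) (zero-⊠ {f = P₁.run s₁} {P₂.run s₂} (inj₂ z))

  Φ-δ : ∀ i vs s₁ s₂ → Φ (δ i ∷ vs) s₁ s₂ ≡ Φ vs (P₁.step s₁ i) s₂ + Φ vs s₁ (P₂.step s₂ i)
  Φ-δ i vs s₁ s₂ = trans (polar-diag (δ i) (map diag vs) (P₁.run s₁) (P₂.run s₂))
    (cong₂ _+_ (sum-δ i (λ a → Φ vs (P₁.step s₁ a) s₂)) (sum-δ i (λ b → Φ vs s₁ (P₂.step s₂ b))))

  Φ-t̂ : ∀ vs s₁ s₂ → Φ (t̂ ∷ vs) s₁ s₂ ≡ sum (λ e → Φ vs (P₁.step s₁ (suc e)) s₂) + sum (λ e → Φ vs s₁ (P₂.step s₂ (suc e)))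
  Φ-t̂ vs s₁ s₂ = trans (polar-diag t̂ (map diag vs) (P₁.run s₁) (P₂.run s₂))
    (cong₂ _+_ (drop-y (λ a → Φ vs (P₁.step s₁ a) s₂)) (drop-y (λ b → Φ vs s₁ (P₂.step s₂ b))))
    where
    drop-y : (h : Fin (suc n) → ℚ) → sum (λ a → t̂ a * h a) ≡ sum (λ e → h (suc e))
    drop-y h = trans (cong₂ _+_ (*-zeroˡ (h zero)) (sum-cong-≗ λ e → *-identityˡ (h (suc e)))) (+-identityˡ (sum (λ e → h (suc e))))

  Φ-xˡ : ∀ vs S j e s₂ → Φ vs (P₁.step (just (S , j)) (suc e)) s₂ ≡ 𝕀 (¬? (e ∈? S)) * Φ vs (just (S ∪ ⁅ e ⁆ , j)) s₂
  Φ-xˡ vs S j e s₂ = go (e ∈? S)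
    where
    go : (d : Dec (e ∈ S)) → Φ vs (P₁.adjoin S e d j) s₂ ≡ 𝕀 (¬? d) * Φ vs (just (S ∪ ⁅ e ⁆ , j)) s₂
    go (yes _) = trans (Φ-zeroˡ vs nothing s₂ P₁.run-nothing) (sym (*-zeroˡ (Φ vs (just (S ∪ ⁅ e ⁆ , j)) s₂)))
    go (no _)  = sym (*-identityˡ (Φ vs (just (S ∪ ⁅ e ⁆ , j)) s₂))

  Φ-xʳ : ∀ vs S j e s₁ → Φ vs s₁ (P₂.step (just (S , j)) (suc e)) ≡ 𝕀 (¬? (e ∈? S)) * Φ vs s₁ (just (S ∪ ⁅ e ⁆ , j))
  Φ-xʳ vs S j e s₁ = go (e ∈? S)
    where
    go : (d : Dec (e ∈ S)) → Φ vs s₁ (P₂.adjoin S e d j) ≡ 𝕀 (¬? d) * Φ vs s₁ (just (S ∪ ⁅ e ⁆ , j))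
    go (yes _) = trans (Φ-zeroʳ vs s₁ nothing P₂.run-nothing) (sym (*-zeroˡ (Φ vs s₁ (just (S ∪ ⁅ e ⁆ , j)))))
    go (no _)  = sym (*-identityˡ (Φ vs s₁ (just (S ∪ ⁅ e ⁆ , j))))

  X : Subset n → Subset n → ℚ
  X S₁ S₂ = 𝕀 (φ₁? S₁) * 𝕀 (φ₂? S₂)

  private
    shift : ∀ j p → suc j ℕ.+ p ≡ j ℕ.+ suc p
    shift j p = sym (+-suc j p)

    shift₃ : ∀ s j p → s ℕ.+ suc j ℕ.+ p ≡ s ℕ.+ j ℕ.+ suc p
    shift₃ s j p = trans (cong (ℕ._+ p) (+-suc s j)) (sym (+-suc (s ℕ.+ j) p))

    overflow : ∀ {s j} → s ℕ.+ j ℕ.+ 0 ≡ n → n ℕ.< s ℕ.+ suc j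
    overflow {s} {j} e = ℕP.≤-reflexive (trans (cong suc (trans (sym e) (ℕP.+-identityʳ (s ℕ.+ j)))) (sym (+-suc s j)))

    underfull : ∀ {s j p} → s ℕ.+ j ℕ.+ suc p ≡ n → s ℕ.+ j ≢ n
    underfull {s} {j} {p} e e′ = ℕP.m≢1+m+n (s ℕ.+ j) (trans e′ (trans (sym e) (+-suc (s ℕ.+ j) p)))

  -- The factors p ! and q ! replace the binomial coefficient counting the interleavings of y and y′.
  Φ-ŷ-scaled : ∀ a p q S₁ j₁ S₂ j₂ → ∣ S₁ ∣ ℕ.+ j₁ ℕ.+ p ≡ n → ∣ S₂ ∣ ℕ.+ j₂ ℕ.+ q ≡ n →
    Φ (replicate a ŷ) (just (S₁ , j₁)) (just (S₂ , j₂)) * (ι (p !) * ι (q !))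
      ≡ 𝕀 (a ℕP.≟ p ℕ.+ q) * (ι (a !) * (X S₁ S₂ * (ι ((j₁ ℕ.+ p) !) * ι ((j₂ ℕ.+ q) !))))
  Φ-ŷ-scaled zero zero zero S₁ j₁ S₂ j₂ e₁ e₂ = trans
    (cong (_* (ι 1 * ι 1)) (cong₂ _*_ (P₁.value-full S₁ j₁ (trans (sym (ℕP.+-identityʳ _)) e₁)) (P₂.value-full S₂ j₂ (trans (sym (ℕP.+-identityʳ _)) e₂))))
    (trans (solve 4 (λ a x b y → a :* x :* (b :* y) :* (con (ι 1) :* con (ι 1)) := con 1ℚ :* (con (ι 1) :* (a :* b :* (x :* y)))) refl (𝕀 (φ₁? S₁)) (ι (j₁ !)) (𝕀 (φ₂? S₂)) (ι (j₂ !)))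
      (cong₂ (λ j k → 1ℚ * (ι 1 * (X S₁ S₂ * (ι (j !) * ι (k !))))) (sym (ℕP.+-identityʳ j₁)) (sym (ℕP.+-identityʳ j₂))))
  Φ-ŷ-scaled zero (suc p) q S₁ j₁ S₂ j₂ e₁ e₂ = trans
    (*-≡0ˡ (ι (suc p !) * ι (q !)) (*-≡0ˡ (P₂.value (just (S₂ , j₂))) (P₁.value-zero S₁ j₁ (underfull {∣ S₁ ∣} e₁))))
    (sym (*-zeroˡ (ι 1 * (X S₁ S₂ * (ι ((j₁ ℕ.+ suc p) !) * ι ((j₂ ℕ.+ q) !))))))
  Φ-ŷ-scaled zero zero (suc q) S₁ j₁ S₂ j₂ e₁ e₂ = trans
    (*-≡0ˡ (ι 1 * ι (suc q !)) (*-≡0ʳ (P₁.value (just (S₁ , j₁))) (P₂.value-zero S₂ j₂ (underfull {∣ S₂ ∣} e₂))))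
    (sym (*-zeroˡ (ι 1 * (X S₁ S₂ * (ι ((j₁ ℕ.+ 0) !) * ι ((j₂ ℕ.+ suc q) !))))))
  Φ-ŷ-scaled (suc a) p q S₁ j₁ S₂ j₂ e₁ e₂ = begin
    Φ (ŷ ∷ replicate a ŷ) s₁ s₂ * (ι (p !) * ι (q !))
      ≡⟨ cong (_* (ι (p !) * ι (q !))) (Φ-δ zero (replicate a ŷ) s₁ s₂) ⟩
    (Φ (replicate a ŷ) (just (S₁ , suc j₁)) s₂ + Φ (replicate a ŷ) s₁ (just (S₂ , suc j₂))) * (ι (p !) * ι (q !))
      ≡⟨ ℚP.*-distribʳ-+ (ι (p !) * ι (q !)) (Φ (replicate a ŷ) (just (S₁ , suc j₁)) s₂) (Φ (replicate a ŷ) s₁ (just (S₂ , suc j₂))) ⟩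
    Φ (replicate a ŷ) (just (S₁ , suc j₁)) s₂ * (ι (p !) * ι (q !)) + Φ (replicate a ŷ) s₁ (just (S₂ , suc j₂)) * (ι (p !) * ι (q !))
      ≡⟨ cong₂ _+_ (left p e₁) (right q e₂) ⟩
    ι p * R p q + ι q * R p q
      ≡⟨ merge (suc a ℕP.≟ p ℕ.+ q) ⟩
    𝕀 (suc a ℕP.≟ p ℕ.+ q) * (ι (suc a !) * Y p q) ∎
    where
    open ≡-Reasoning
    s₁ = just (S₁ , j₁)
    s₂ = just (S₂ , j₂)
    Y R : ℕ → ℕ → ℚ
    Y p q = X S₁ S₂ * (ι ((j₁ ℕ.+ p) !) * ι ((j₂ ℕ.+ q) !))
    R p q = 𝕀 (suc a ℕP.≟ p ℕ.+ q) * (ι (a !) * Y p q)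
    left : ∀ p → ∣ S₁ ∣ ℕ.+ j₁ ℕ.+ p ≡ n → Φ (replicate a ŷ) (just (S₁ , suc j₁)) s₂ * (ι (p !) * ι (q !)) ≡ ι p * R p q
    left zero e = trans (cong (_* (ι 1 * ι (q !))) (Φ-zeroˡ (replicate a ŷ) (just (S₁ , suc j₁)) s₂ (λ w → P₁.run-overfull w (overflow {∣ S₁ ∣} e))))
      (trans (*-zeroˡ (ι 1 * ι (q !))) (sym (*-zeroˡ (R 0 q))))
    left (suc p) e = begin
      F * (ι (suc p !) * ι (q !)) ≡⟨ cong (λ f → F * (f * ι (q !))) (ι-* (suc p) (p !)) ⟩
      F * (ι (suc p) * ι (p !) * ι (q !)) ≡⟨ solve 4 (λ F s p q → F :* (s :* p :* q) := s :* (F :* (p :* q))) refl F (ι (suc p)) (ι (p !)) (ι (q !)) ⟩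
      ι (suc p) * (F * (ι (p !) * ι (q !))) ≡⟨ cong (ι (suc p) *_) (Φ-ŷ-scaled a p q S₁ (suc j₁) S₂ j₂ (trans (shift₃ (∣ S₁ ∣) j₁ p) e) e₂) ⟩
      ι (suc p) * (𝕀 (a ℕP.≟ p ℕ.+ q) * (ι (a !) * (X S₁ S₂ * (ι ((suc j₁ ℕ.+ p) !) * ι ((j₂ ℕ.+ q) !)))))
        ≡⟨ cong₂ (λ i k → ι (suc p) * (i * (ι (a !) * (X S₁ S₂ * (ι (k !) * ι ((j₂ ℕ.+ q) !)))))) (𝕀-cong (a ℕP.≟ p ℕ.+ q) (suc a ℕP.≟ suc p ℕ.+ q) (cong suc) suc-injective) (shift j₁ p) ⟩
      ι (suc p) * R (suc p) q ∎
      where F = Φ (replicate a ŷ) (just (S₁ , suc j₁)) s₂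
    right : ∀ q → ∣ S₂ ∣ ℕ.+ j₂ ℕ.+ q ≡ n → Φ (replicate a ŷ) s₁ (just (S₂ , suc j₂)) * (ι (p !) * ι (q !)) ≡ ι q * R p q
    right zero e = trans (cong (_* (ι (p !) * ι 1)) (Φ-zeroʳ (replicate a ŷ) s₁ (just (S₂ , suc j₂)) (λ w → P₂.run-overfull w (overflow {∣ S₂ ∣} e))))
      (trans (*-zeroˡ (ι (p !) * ι 1)) (sym (*-zeroˡ (R p 0))))
    right (suc q) e = begin
      F * (ι (p !) * ι (suc q !)) ≡⟨ cong (λ f → F * (ι (p !) * f)) (ι-* (suc q) (q !)) ⟩
      F * (ι (p !) * (ι (suc q) * ι (q !))) ≡⟨ solve 4 (λ F s p q → F :* (p :* (s :* q)) := s :* (F :* (p :* q))) refl F (ι (suc q)) (ι (p !)) (ι (q !)) ⟩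
      ι (suc q) * (F * (ι (p !) * ι (q !))) ≡⟨ cong (ι (suc q) *_) (Φ-ŷ-scaled a p q S₁ j₁ S₂ (suc j₂) e₁ (trans (shift₃ (∣ S₂ ∣) j₂ q) e)) ⟩
      ι (suc q) * (𝕀 (a ℕP.≟ p ℕ.+ q) * (ι (a !) * (X S₁ S₂ * (ι ((j₁ ℕ.+ p) !) * ι ((suc j₂ ℕ.+ q) !)))))
        ≡⟨ cong₂ (λ i k → ι (suc q) * (i * (ι (a !) * (X S₁ S₂ * (ι ((j₁ ℕ.+ p) !) * ι (k !)))))) (𝕀-cong (a ℕP.≟ p ℕ.+ q) (suc a ℕP.≟ p ℕ.+ suc q) (λ e → trans (cong suc e) (sym (+-suc p q))) (λ e → suc-injective (trans e (+-suc p q)))) (shift j₂ q) ⟩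
      ι (suc q) * R p (suc q) ∎
      where F = Φ (replicate a ŷ) s₁ (just (S₂ , suc j₂))
    -- Pascal's rule with the denominators cleared: `p + q = suc a` turns `a !` into `suc a !`.
    merge : (d : Dec (suc a ≡ p ℕ.+ q)) → ι p * (𝕀 d * (ι (a !) * Y p q)) + ι q * (𝕀 d * (ι (a !) * Y p q)) ≡ 𝕀 d * (ι (suc a !) * Y p q)
    merge (no _) = solve 4 (λ p q r s → p :* (con 0ℚ :* r) :+ q :* (con 0ℚ :* r) := con 0ℚ :* s) refl (ι p) (ι q) (ι (a !) * Y p q) (ι (suc a !) * Y p q)
    merge (yes e) = trans (solve 4 (λ p q r y → p :* (con 1ℚ :* (r :* y)) :+ q :* (con 1ℚ :* (r :* y)) := con 1ℚ :* ((p :+ q) :* r :* y)) refl (ι p) (ι q) (ι (a !)) (Y p q))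
      (cong (λ s → 1ℚ * (s * Y p q)) (trans (cong (_* ι (a !)) (trans (sym (ι-+ p q)) (cong ι (sym e)))) (sym (ι-* (suc a) (a !)))))

  K : ℕ → Subset n → Subset n → ℚ
  K a S₁ S₂ = 𝕀 (∣ S₁ ∣ ℕ.+ ∣ S₂ ∣ ℕ.+ a ℕP.≟ n ℕ.+ n) * (X S₁ S₂ * ι (a !))

  -- With `p` and `q` the exponents of y and y′, the `a` derivatives can be distributed in
  -- `a ! / (p ! q !)` ways, each contributing `p ! q !`.
  Φ-ŷ : ∀ a S₁ S₂ → Φ (replicate a ŷ) ⟨ S₁ ⟩ ⟨ S₂ ⟩ ≡ K a S₁ S₂
  Φ-ŷ a S₁ S₂ = cancel-≡ (0<* (0<ι! p) (0<ι! q)) (trans (Φ-ŷ-scaled a p q S₁ 0 S₂ 0 e₁ e₂)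
    (trans (cong (_* (ι (a !) * (X S₁ S₂ * (ι (p !) * ι (q !))))) (𝕀-cong (a ℕP.≟ p ℕ.+ q) (∣ S₁ ∣ ℕ.+ ∣ S₂ ∣ ℕ.+ a ℕP.≟ n ℕ.+ n) to from))
      (solve 4 (λ i a x c → i :* (a :* (x :* c)) := i :* (x :* a) :* c) refl (𝕀 (∣ S₁ ∣ ℕ.+ ∣ S₂ ∣ ℕ.+ a ℕP.≟ n ℕ.+ n)) (ι (a !)) (X S₁ S₂) (ι (p !) * ι (q !)))))
    where
    p = n ℕ.∸ ∣ S₁ ∣
    q = n ℕ.∸ ∣ S₂ ∣
    f₁ : ∣ S₁ ∣ ℕ.+ p ≡ n
    f₁ = m+[n∸m]≡n (∣p∣≤n S₁)
    f₂ : ∣ S₂ ∣ ℕ.+ q ≡ n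
    f₂ = m+[n∸m]≡n (∣p∣≤n S₂)
    e₁ : ∣ S₁ ∣ ℕ.+ 0 ℕ.+ p ≡ n
    e₁ = trans (cong (ℕ._+ p) (ℕP.+-identityʳ (∣ S₁ ∣))) f₁
    e₂ : ∣ S₂ ∣ ℕ.+ 0 ℕ.+ q ≡ n
    e₂ = trans (cong (ℕ._+ q) (ℕP.+-identityʳ (∣ S₂ ∣))) f₂
    total : ∣ S₁ ∣ ℕ.+ ∣ S₂ ∣ ℕ.+ (p ℕ.+ q) ≡ n ℕ.+ n
    total = trans (Interchange (∣ S₁ ∣) (∣ S₂ ∣) p q) (cong₂ ℕ._+_ f₁ f₂)
      where
      Interchange : ∀ a b c d → a ℕ.+ b ℕ.+ (c ℕ.+ d) ≡ (a ℕ.+ c) ℕ.+ (b ℕ.+ d)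
      Interchange = ℕ-solve-∀
    to : a ≡ p ℕ.+ q → ∣ S₁ ∣ ℕ.+ ∣ S₂ ∣ ℕ.+ a ≡ n ℕ.+ n
    to refl = total
    from : ∣ S₁ ∣ ℕ.+ ∣ S₂ ∣ ℕ.+ a ≡ n ℕ.+ n → a ≡ p ℕ.+ q
    from e = +-cancelˡ-≡ (∣ S₁ ∣ ℕ.+ ∣ S₂ ∣) a (p ℕ.+ q) (trans e (sym total))

  W : ℕ → Subset n → Subset n → Subset n → Subset n → ℚ
  W a S₁ S₂ U₁ U₂ = 𝕀 (S₁ ⊆? U₁) * 𝕀 (S₂ ⊆? U₂) * K a U₁ U₂

  Σ² : (Subset n → Subset n → ℚ) → ℚ
  Σ² f = Σ⊆ λ U₁ → Σ⊆ λ U₂ → f U₁ U₂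

  Σ²-cong : {f g : Subset n → Subset n → ℚ} → (∀ U₁ U₂ → f U₁ U₂ ≡ g U₁ U₂) → Σ² f ≡ Σ² g
  Σ²-cong f≡g = Σ⊆-cong λ U₁ → Σ⊆-cong λ U₂ → f≡g U₁ U₂

  Σ²-* : ∀ c f → Σ² (λ U₁ U₂ → c * f U₁ U₂) ≡ c * Σ² f
  Σ²-* c f = trans (Σ⊆-cong λ U₁ → Σ⊆-* c (f U₁)) (Σ⊆-* c (λ U₁ → Σ⊆ (f U₁)))

  Σ²-+ : ∀ f g → Σ² (λ U₁ U₂ → f U₁ U₂ + g U₁ U₂) ≡ Σ² f + Σ² g
  Σ²-+ f g = trans (Σ⊆-cong λ U₁ → Σ⊆-+ (f U₁) (g U₁)) (Σ⊆-+ (λ U₁ → Σ⊆ (f U₁)) (λ U₁ → Σ⊆ (g U₁)))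

  Σ²-sum : ∀ (c : Fin n → ℚ) (f : Fin n → Subset n → Subset n → ℚ) → sum (λ e → c e * Σ² (f e)) ≡ Σ² (λ U₁ U₂ → sum (λ e → c e * f e U₁ U₂))
  Σ²-sum c f = trans (sum-cong-≗ λ e → sym (Σ²-* (c e) (f e)))
    (trans (Σ⊆-sum λ e U₁ → Σ⊆ λ U₂ → c e * f e U₁ U₂) (Σ⊆-cong λ U₁ → Σ⊆-sum λ e U₂ → c e * f e U₁ U₂))

  W-diagonal : ∀ a S₁ S₂ → ∣ S₁ ∣ ℕ.+ ∣ S₂ ∣ ℕ.+ a ≡ n ℕ.+ n → ∀ U₁ U₂ → (U₁ ≢ S₁ ⊎ U₂ ≢ S₂) → W a S₁ S₂ U₁ U₂ ≡ 0ℚ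
  W-diagonal a S₁ S₂ e U₁ U₂ ne = go (S₁ ⊆? U₁) (S₂ ⊆? U₂) (∣ U₁ ∣ ℕ.+ ∣ U₂ ∣ ℕ.+ a ℕP.≟ n ℕ.+ n)
    where
    x = X U₁ U₂ * ι (a !)
    go : (d : Dec (S₁ ⊆ U₁)) (d′ : Dec (S₂ ⊆ U₂)) (s : Dec (∣ U₁ ∣ ℕ.+ ∣ U₂ ∣ ℕ.+ a ≡ n ℕ.+ n)) → 𝕀 d * 𝕀 d′ * (𝕀 s * x) ≡ 0ℚ
    go (no _) d′ s = solve 2 (λ p q → con 0ℚ :* p :* q := con 0ℚ) refl (𝕀 d′) (𝕀 s * x)
    go (yes _) (no _) s = solve 1 (λ q → con 1ℚ :* con 0ℚ :* q := con 0ℚ) refl (𝕀 s * x)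
    go (yes _) (yes _) (no _) = solve 1 (λ q → con 1ℚ :* con 1ℚ :* (con 0ℚ :* q) := con 0ℚ) refl x
    go (yes S₁⊆U₁) (yes S₂⊆U₂) (yes e′) = ⊥-elim (Sum.[ (λ ≢ → ≢ (⊆∧size⇒≡ S₁⊆U₁ size₁)) , (λ ≢ → ≢ (⊆∧size⇒≡ S₂⊆U₂ size₂)) ] ne)
      where
      sizes : ∣ U₁ ∣ ℕ.+ ∣ U₂ ∣ ≡ ∣ S₁ ∣ ℕ.+ ∣ S₂ ∣
      sizes = +-cancelʳ-≡ a (∣ U₁ ∣ ℕ.+ ∣ U₂ ∣) (∣ S₁ ∣ ℕ.+ ∣ S₂ ∣) (trans e′ (sym e))
      size₁ : ∣ U₁ ∣ ℕ.≤ ∣ S₁ ∣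
      size₁ = +-cancelʳ-≤ (∣ U₂ ∣) (∣ U₁ ∣) (∣ S₁ ∣) (ℕP.≤-trans (ℕP.≤-reflexive sizes) (ℕP.+-monoʳ-≤ (∣ S₁ ∣) (p⊆q⇒∣p∣≤∣q∣ S₂⊆U₂)))
      size₂ : ∣ U₂ ∣ ℕ.≤ ∣ S₂ ∣
      size₂ = +-cancelˡ-≤ (∣ U₁ ∣) (∣ U₂ ∣) (∣ S₂ ∣) (ℕP.≤-trans (ℕP.≤-reflexive sizes) (ℕP.+-monoˡ-≤ (∣ S₂ ∣) (p⊆q⇒∣p∣≤∣q∣ S₁⊆U₁)))

  -- A pair `U₁`, `U₂` is reached through any of the elements missing from `S₁`, `S₂` as first
  -- letter. The degree condition in `K` fixes their number, at `suc k` in the inductive step, and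
  -- at zero it leaves only `U₁ = S₁`, `U₂ = S₂`.
  Φ-t̂ŷ : ∀ k a S₁ S₂ → ∣ S₁ ∣ ℕ.+ ∣ S₂ ∣ ℕ.+ (k ℕ.+ a) ≡ n ℕ.+ n →
    Φ (replicate k t̂ ++ replicate a ŷ) ⟨ S₁ ⟩ ⟨ S₂ ⟩ ≡ ι (k !) * Σ² (W a S₁ S₂)
  Φ-t̂ŷ zero a S₁ S₂ e = trans (Φ-ŷ a S₁ S₂) (sym (trans (cong (ι 1 *_) collapse)
      (trans (cong₂ (λ p q → ι 1 * (p * q * K a S₁ S₂)) (𝕀-yes (S₁ ⊆? S₁) (λ x∈ → x∈)) (𝕀-yes (S₂ ⊆? S₂) (λ x∈ → x∈))) (solve 1 (λ x → con (ι 1) :* (con 1ℚ :* con 1ℚ :* x) := x) refl (K a S₁ S₂)))))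
    where
    collapse : Σ² (W a S₁ S₂) ≡ W a S₁ S₂ S₁ S₂
    collapse = trans (Σ⊆-single S₁ {λ U₁ → Σ⊆ (W a S₁ S₂ U₁)} λ U₁ ≢ → Σ⊆-zero λ U₂ → W-diagonal a S₁ S₂ e U₁ U₂ (inj₁ ≢))
      (Σ⊆-single S₂ {W a S₁ S₂ S₁} λ U₂ ≢ → W-diagonal a S₁ S₂ e S₁ U₂ (inj₂ ≢))
  Φ-t̂ŷ (suc k) a S₁ S₂ e = begin
    Φ (t̂ ∷ vs) ⟨ S₁ ⟩ ⟨ S₂ ⟩
      ≡⟨ Φ-t̂ vs ⟨ S₁ ⟩ ⟨ S₂ ⟩ ⟩
    sum (λ x → Φ vs (P₁.step ⟨ S₁ ⟩ (suc x)) ⟨ S₂ ⟩) + sum (λ x → Φ vs ⟨ S₁ ⟩ (P₂.step ⟨ S₂ ⟩ (suc x)))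
      ≡⟨ cong₂ _+_ (sum-cong-≗ left) (sum-cong-≗ right) ⟩
    sum (λ x → ι (k !) * (c₁ x * Σ² (W a (S₁ ∪ ⁅ x ⁆) S₂))) + sum (λ x → ι (k !) * (c₂ x * Σ² (W a S₁ (S₂ ∪ ⁅ x ⁆))))
      ≡⟨ cong₂ _+_ (trans (sum-* (ι (k !)) (λ x → c₁ x * Σ² (W a (S₁ ∪ ⁅ x ⁆) S₂))) (cong (ι (k !) *_) (Σ²-sum c₁ (λ x → W a (S₁ ∪ ⁅ x ⁆) S₂))))
           (trans (sum-* (ι (k !)) (λ x → c₂ x * Σ² (W a S₁ (S₂ ∪ ⁅ x ⁆)))) (cong (ι (k !) *_) (Σ²-sum c₂ (λ x → W a S₁ (S₂ ∪ ⁅ x ⁆))))) ⟩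
    ι (k !) * Σ² A₁ + ι (k !) * Σ² A₂
      ≡⟨ trans (sym (*-distribˡ-+ (ι (k !)) (Σ² A₁) (Σ² A₂))) (cong (ι (k !) *_) (sym (Σ²-+ A₁ A₂))) ⟩
    ι (k !) * Σ² (λ U₁ U₂ → A₁ U₁ U₂ + A₂ U₁ U₂)
      ≡⟨ cong (ι (k !) *_) (trans (Σ²-cong pointwise) (Σ²-* (ι (suc k)) (W a S₁ S₂))) ⟩
    ι (k !) * (ι (suc k) * Σ² (W a S₁ S₂))
      ≡⟨ trans (solve 3 (λ f k s → f :* (k :* s) := k :* f :* s) refl (ι (k !)) (ι (suc k)) (Σ² (W a S₁ S₂))) (cong (_* Σ² (W a S₁ S₂)) (sym (ι-* (suc k) (k !)))) ⟩
    ι (suc k !) * Σ² (W a S₁ S₂) ∎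
    where
    open ≡-Reasoning
    vs = replicate k t̂ ++ replicate a ŷ
    c₁ c₂ : Fin n → ℚ
    c₁ x = 𝕀 (¬? (x ∈? S₁))
    c₂ x = 𝕀 (¬? (x ∈? S₂))
    A₁ A₂ : Subset n → Subset n → ℚ
    A₁ U₁ U₂ = sum (λ x → c₁ x * W a (S₁ ∪ ⁅ x ⁆) S₂ U₁ U₂)
    A₂ U₁ U₂ = sum (λ x → c₂ x * W a S₁ (S₂ ∪ ⁅ x ⁆) U₁ U₂)
    guard : ∀ {x} {S : Subset n} {p q : ℚ} → (x ∉ S → p ≡ q) → 𝕀 (¬? (x ∈? S)) * p ≡ 𝕀 (¬? (x ∈? S)) * q
    guard {x} {S} {p} {q} h = go (x ∈? S)
      where
      go : (d : Dec (x ∈ S)) → 𝕀 (¬? d) * p ≡ 𝕀 (¬? d) * q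
      go (yes _) = trans (*-zeroˡ p) (sym (*-zeroˡ q))
      go (no x∉S) = cong (1ℚ *_) (h x∉S)
    size₁ : ∀ {x} → x ∉ S₁ → ∣ S₁ ∪ ⁅ x ⁆ ∣ ℕ.+ ∣ S₂ ∣ ℕ.+ (k ℕ.+ a) ≡ n ℕ.+ n
    size₁ x∉ = trans (cong (λ s → s ℕ.+ ∣ S₂ ∣ ℕ.+ (k ℕ.+ a)) (∣∪⁅⁆∣ x∉)) (trans (sym (+-suc (∣ S₁ ∣ ℕ.+ ∣ S₂ ∣) (k ℕ.+ a))) e)
    size₂ : ∀ {x} → x ∉ S₂ → ∣ S₁ ∣ ℕ.+ ∣ S₂ ∪ ⁅ x ⁆ ∣ ℕ.+ (k ℕ.+ a) ≡ n ℕ.+ n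
    size₂ x∉ = trans (cong (λ s → ∣ S₁ ∣ ℕ.+ s ℕ.+ (k ℕ.+ a)) (∣∪⁅⁆∣ x∉)) (trans (shift₃ (∣ S₁ ∣) (∣ S₂ ∣) (k ℕ.+ a)) e)
    left : ∀ x → Φ vs (P₁.step ⟨ S₁ ⟩ (suc x)) ⟨ S₂ ⟩ ≡ ι (k !) * (c₁ x * Σ² (W a (S₁ ∪ ⁅ x ⁆) S₂))
    left x = trans (Φ-xˡ vs S₁ 0 x ⟨ S₂ ⟩) (trans (guard {x} {S₁} (λ x∉ → Φ-t̂ŷ k a (S₁ ∪ ⁅ x ⁆) S₂ (size₁ x∉)))
      (solve 3 (λ c f s → c :* (f :* s) := f :* (c :* s)) refl (c₁ x) (ι (k !)) (Σ² (W a (S₁ ∪ ⁅ x ⁆) S₂))))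
    right : ∀ x → Φ vs ⟨ S₁ ⟩ (P₂.step ⟨ S₂ ⟩ (suc x)) ≡ ι (k !) * (c₂ x * Σ² (W a S₁ (S₂ ∪ ⁅ x ⁆)))
    right x = trans (Φ-xʳ vs S₂ 0 x ⟨ S₁ ⟩) (trans (guard {x} {S₂} (λ x∉ → Φ-t̂ŷ k a S₁ (S₂ ∪ ⁅ x ⁆) (size₂ x∉)))
      (solve 3 (λ c f s → c :* (f :* s) := f :* (c :* s)) refl (c₂ x) (ι (k !)) (Σ² (W a S₁ (S₂ ∪ ⁅ x ⁆)))))
    pointwise : ∀ U₁ U₂ → A₁ U₁ U₂ + A₂ U₁ U₂ ≡ ι (suc k) * W a S₁ S₂ U₁ U₂
    pointwise U₁ U₂ = begin
      A₁ U₁ U₂ + A₂ U₁ U₂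
        ≡⟨ cong₂ _+_
            (trans (sum-cong-≗ λ x → solve 4 (λ c p q r → c :* (p :* q :* r) := q :* r :* (c :* p)) refl (c₁ x) (𝕀 (S₁ ∪ ⁅ x ⁆ ⊆? U₁)) i₂ κ) (trans (sum-* (i₂ * κ) (λ x → c₁ x * 𝕀 (S₁ ∪ ⁅ x ⁆ ⊆? U₁))) (cong (i₂ * κ *_) (sum-extensions S₁ U₁))))
            (trans (sum-cong-≗ λ x → solve 4 (λ c p q r → c :* (p :* q :* r) := p :* r :* (c :* q)) refl (c₂ x) i₁ (𝕀 (S₂ ∪ ⁅ x ⁆ ⊆? U₂)) κ) (trans (sum-* (i₁ * κ) (λ x → c₂ x * 𝕀 (S₂ ∪ ⁅ x ⁆ ⊆? U₂))) (cong (i₁ * κ *_) (sum-extensions S₂ U₂)))) ⟩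
      i₂ * κ * (i₁ * (u₁ - s₁)) + i₁ * κ * (i₂ * (u₂ - s₂))
        ≡⟨ solve 7 (λ i₁ i₂ κ u₁ s₁ u₂ s₂ → i₂ :* κ :* (i₁ :* (u₁ :- s₁)) :+ i₁ :* κ :* (i₂ :* (u₂ :- s₂)) := i₁ :* i₂ :* (κ :* ((u₁ :+ u₂) :- (s₁ :+ s₂)))) refl i₁ i₂ κ u₁ s₁ u₂ s₂ ⟩
      i₁ * i₂ * (κ * ((u₁ + u₂) - (s₁ + s₂)))
        ≡⟨ cong (i₁ * i₂ *_) (count (∣ U₁ ∣ ℕ.+ ∣ U₂ ∣ ℕ.+ a ℕP.≟ n ℕ.+ n)) ⟩
      i₁ * i₂ * (ι (suc k) * κ)
        ≡⟨ solve 3 (λ i k κ → i :* (k :* κ) := k :* (i :* κ)) refl (i₁ * i₂) (ι (suc k)) κ ⟩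
      ι (suc k) * (i₁ * i₂ * κ) ∎
      where
      i₁ = 𝕀 (S₁ ⊆? U₁)
      i₂ = 𝕀 (S₂ ⊆? U₂)
      κ = K a U₁ U₂
      x = X U₁ U₂ * ι (a !)
      u₁ = ι (∣ U₁ ∣)
      u₂ = ι (∣ U₂ ∣)
      s₁ = ι (∣ S₁ ∣)
      s₂ = ι (∣ S₂ ∣)
      count : (d : Dec (∣ U₁ ∣ ℕ.+ ∣ U₂ ∣ ℕ.+ a ≡ n ℕ.+ n)) → 𝕀 d * x * ((u₁ + u₂) - (s₁ + s₂)) ≡ ι (suc k) * (𝕀 d * x)
      count (no _)   = solve 3 (λ x u k → con 0ℚ :* x :* u := k :* (con 0ℚ :* x)) refl x ((u₁ + u₂) - (s₁ + s₂)) (ι (suc k))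
      count (yes e′) = trans (cong (λ u → 1ℚ * x * (u - (s₁ + s₂))) (trans (sym (ι-+ (∣ U₁ ∣) (∣ U₂ ∣))) (trans (cong ι sizes) (trans (ι-+ (∣ S₁ ∣ ℕ.+ ∣ S₂ ∣) (suc k)) (cong (_+ ι (suc k)) (ι-+ (∣ S₁ ∣) (∣ S₂ ∣)))))))
        (solve 3 (λ x s k → con 1ℚ :* x :* ((s :+ k) :- s) := k :* (con 1ℚ :* x)) refl x (s₁ + s₂) (ι (suc k)))
        where
        sizes : ∣ U₁ ∣ ℕ.+ ∣ U₂ ∣ ≡ ∣ S₁ ∣ ℕ.+ ∣ S₂ ∣ ℕ.+ suc k
        sizes = +-cancelʳ-≡ a (∣ U₁ ∣ ℕ.+ ∣ U₂ ∣) (∣ S₁ ∣ ℕ.+ ∣ S₂ ∣ ℕ.+ suc k) (trans e′ (trans (sym e) (sym (ℕP.+-assoc (∣ S₁ ∣ ℕ.+ ∣ S₂ ∣) (suc k) a))))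

  Φ-x̂ : ∀ es ws S₁ S₂ → Φ (map x̂ es ++ ws) ⟨ S₁ ⟩ ⟨ S₂ ⟩ ≡ foldr assign (λ S₁ S₂ → Φ ws ⟨ S₁ ⟩ ⟨ S₂ ⟩) es S₁ S₂
  Φ-x̂ []       ws S₁ S₂ = refl
  Φ-x̂ (e ∷ es) ws S₁ S₂ = trans (Φ-δ (suc e) (map x̂ es ++ ws) ⟨ S₁ ⟩ ⟨ S₂ ⟩)
    (trans (cong₂ _+_ (Φ-xˡ (map x̂ es ++ ws) S₁ 0 e ⟨ S₂ ⟩) (Φ-xʳ (map x̂ es ++ ws) S₂ 0 e ⟨ S₁ ⟩)) (assign-cong e (Φ-x̂ es ws) S₁ S₂))

  -- The pair `(U₁ , U₂)` is reached from `(∁ A , A)` exactly when `∁ U₁ ⊆ A ⊆ U₂`, so exchanging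
  -- the sums leaves a count of the sets between `I = ∁ U₁` and `U = U₂`.
  Φ-x̂t̂ŷ : ∀ k a → k ℕ.+ a ≡ n →
    Φ (x̂s n ++ replicate k t̂ ++ replicate a ŷ) ⟨ ∅ ⟩ ⟨ ∅ ⟩
      ≡ ι (k !) * Σ² (λ I U → K a (∁ I) U * (𝕀 (I ⊆? U) * ι (2 ^ ∣ U ─ I ∣)))
  Φ-x̂t̂ŷ k a k+a≡n = begin
    Φ (x̂s n ++ vs) ⟨ ∅ ⟩ ⟨ ∅ ⟩
      ≡⟨ trans (Φ-x̂ (elements n) vs ∅ ∅) (assign-all n (λ S₁ S₂ → Φ vs ⟨ S₁ ⟩ ⟨ S₂ ⟩)) ⟩
    Σ⊆ (λ A → Φ vs ⟨ ∁ A ⟩ ⟨ A ⟩)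
      ≡⟨ trans (Σ⊆-cong λ A → Φ-t̂ŷ k a (∁ A) A (cong₂ ℕ._+_ (∣∁∣-+ A) k+a≡n)) (Σ⊆-* (ι (k !)) (λ A → Σ² (W a (∁ A) A))) ⟩
    ι (k !) * Σ⊆ (λ A → Σ² (W a (∁ A) A))
      ≡⟨ cong (ι (k !) *_) (trans (Σ⊆-swap λ A U₁ → Σ⊆ (W a (∁ A) A U₁)) (Σ⊆-cong λ U₁ → trans (Σ⊆-swap λ A U₂ → W a (∁ A) A U₁ U₂) (Σ⊆-cong λ U₂ → inner U₁ U₂))) ⟩
    ι (k !) * Σ⊆ (λ U₁ → g U₁)
      ≡⟨ cong (ι (k !) *_) (sym (Σ⊆-∁ g)) ⟩
    ι (k !) * Σ⊆ (λ I → g (∁ I))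
      ≡⟨ cong (ι (k !) *_) (Σ²-cong λ I U → cong (λ I′ → K a (∁ I) U * (𝕀 (I′ ⊆? U) * ι (2 ^ ∣ U ─ I′ ∣))) (∁-involutive I)) ⟩
    ι (k !) * Σ² (λ I U → K a (∁ I) U * (𝕀 (I ⊆? U) * ι (2 ^ ∣ U ─ I ∣))) ∎
    where
    open ≡-Reasoning
    vs = replicate k t̂ ++ replicate a ŷ
    g : Subset n → ℚ
    g U₁ = Σ⊆ (λ U₂ → K a U₁ U₂ * (𝕀 (∁ U₁ ⊆? U₂) * ι (2 ^ ∣ U₂ ─ ∁ U₁ ∣)))
    ∁⊆ : ∀ {p q : Subset n} → ∁ p ⊆ q → ∁ q ⊆ p
    ∁⊆ h x∈∁q = x∉∁p⇒x∈p λ x∈∁p → x∈∁p⇒x∉p x∈∁q (h x∈∁p)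
    inner : ∀ U₁ U₂ → Σ⊆ (λ A → W a (∁ A) A U₁ U₂) ≡ K a U₁ U₂ * (𝕀 (∁ U₁ ⊆? U₂) * ι (2 ^ ∣ U₂ ─ ∁ U₁ ∣))
    inner U₁ U₂ = trans (Σ⊆-cong λ A → trans (*-comm (𝕀 (∁ A ⊆? U₁) * 𝕀 (A ⊆? U₂)) (K a U₁ U₂)) (cong (λ i → K a U₁ U₂ * (i * 𝕀 (A ⊆? U₂))) (𝕀-cong (∁ A ⊆? U₁) (∁ U₁ ⊆? A) (∁⊆ {A} {U₁}) (∁⊆ {U₁} {A}))))
      (trans (Σ⊆-* (K a U₁ U₂) (λ A → 𝕀 (∁ U₁ ⊆? A) * 𝕀 (A ⊆? U₂))) (cong (K a U₁ U₂ *_) (sum-between (∁ U₁) U₂)))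

-- Naturals, fractions and binomial coefficients in ℚ

toℚᵘ-ι : ∀ k → toℚᵘ (ι k) ℚᵘ.≃ mkℚᵘ (pos k) 0
toℚᵘ-ι zero    = ℚᵘP.≃-refl
toℚᵘ-ι (suc k) = ℚᵘP.≃-trans (ℚP.toℚᵘ-homo-+ 1ℚ (ι k)) (ℚᵘP.≃-trans (ℚᵘP.+-congʳ (toℚᵘ 1ℚ) (toℚᵘ-ι k))
  (*≡* (cong (λ i → i ℤ.* pos 1) (cong (λ i → pos 1 ℤ.+ i) (ℤP.*-identityʳ (pos k))))))

-- The detour through unnormalised rationals avoids the greatest common divisor inside `_/_`.
/-*-ι : ∀ i d .{{_ : ℕ.NonZero d}} → (pos i / d) * ι d ≡ ι i
/-*-ι i (suc d) = ℚP.toℚᵘ-injective (ℚᵘP.≃-trans (ℚP.toℚᵘ-homo-* (pos i / suc d) (ι (suc d)))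
  (ℚᵘP.≃-trans (ℚᵘP.*-cong (ℚP.toℚᵘ-fromℚᵘ (mkℚᵘ (pos i) d)) (toℚᵘ-ι (suc d)))
  (ℚᵘP.≃-trans (*≡* (ℤP.*-assoc (pos i) (pos (suc d)) (pos 1))) (ℚᵘP.≃-sym (toℚᵘ-ι i)))))

nCk*k!*[n-k]!≡n! : ∀ {n k a} → k ℕ.+ a ≡ n → (n choose k) ℕ.* (k ! ℕ.* a !) ≡ n !
nCk*k!*[n-k]!≡n! {n} {k} {a} k+a≡n = trans (cong (λ b → (n choose k) ℕ.* (k ! ℕ.* b !)) (sym n∸k≡a)) (trans (cong (ℕ._* (k ! ℕ.* (n ℕ.∸ k) !)) (nCk≡n!/k![n-k]! k≤n)) (m/n*n≡m divides-n!))
  where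
  instance _ = k !* (n ℕ.∸ k) !≢0
  k≤n : k ℕ.≤ n
  k≤n = subst (k ℕ.≤_) k+a≡n (m≤m+n k a)
  n∸k≡a : n ℕ.∸ k ≡ a
  n∸k≡a = trans (cong (ℕ._∸ k) (sym k+a≡n)) (m+n∸m≡n k a)
  divides-n! : k ! ℕ.* (n ℕ.∸ k) ! ∣ n !
  divides-n! = subst (_∣ n !) (ℕP.*-comm ((n ℕ.∸ k) !) (k !)) ([n∸k]!k!∣n! k≤n)

-- The product polynomial of a pair of matroids

module NestedPairPolynomial {n : ℕ} (M₁ M₂ : Matroid n) where
  module L₁ = CospanningLorentzian M₁
  module L₂ = IndependenceLorentzian M₂
  open Evaluation L₁.φ? (independent? M₂)

  Φ∅ : List (Vect (suc n)) → ℚ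
  Φ∅ vs = Φ vs ⟨ ∅ ⟩ ⟨ ∅ ⟩

  product : Tensor (suc n ℕ.+ suc n)
  product = P₁.polynomial ⊠ P₂.polynomial

  private
    empty-size : ∣ ∅ {n} ∣ ℕ.+ 0 ℕ.+ n ≡ n
    empty-size = cong (λ k → k ℕ.+ 0 ℕ.+ n) (∣⊥∣≡0 n)

    admissible₁ : Admissible n P₁.polynomial
    admissible₁ = P₁.run-admissible {∅} {0} empty-size

    admissible₂ : Admissible n P₂.polynomial
    admissible₂ = P₂.run-admissible {∅} {0} empty-size

  product-admissible : Admissible (n ℕ.+ n) product
  product-admissible = ⊠-admissible admissible₁ admissible₂

  product-Lorentzian : Lorentzian (n ℕ.+ n) product
  product-Lorentzian = ⊠-Lorentzian (n ℕ.+ n) refl admissible₁ admissible₂ L₁.cospanning-Lorentzian L₂.independence-Lorentzian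

  -- For `I ⊆ U` the degree condition in `K` reads `n + |U ─ I| + a = n + n`, which says
  -- `|U ─ I| = k` since `k + a = n`.
  nested-term : ∀ k a → k ℕ.+ a ≡ n → ∀ I U → K a (∁ I) U * (𝕀 (I ⊆? U) * ι (2 ^ ∣ U ─ I ∣)) ≡ ι (a !) * ι (2 ^ k) * 𝕀 (nestedPair? M₁ M₂ k (I , U))
  nested-term k a k+a≡n I U = trans
    (cong (λ i → 𝕀 s * (i * 𝕀 (independent? M₂ U) * ι (a !)) * (𝕀 (I ⊆? U) * ι (2 ^ ∣ U ─ I ∣))) (𝕀-cong (L₁.φ? (∁ I)) (independent? M₁ I) (subst (Independent M₁) (∁-involutive I)) (subst (Independent M₁) (sym (∁-involutive I)))))
    (go (nestedPair? M₁ M₂ k (I , U)))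
    where
    s = ∣ ∁ I ∣ ℕ.+ ∣ U ∣ ℕ.+ a ℕP.≟ n ℕ.+ n
    A = ι (a !)
    size : I ⊆ U → ∣ ∁ I ∣ ℕ.+ ∣ U ∣ ℕ.+ a ≡ n ℕ.+ (∣ U ─ I ∣ ℕ.+ a)
    size I⊆U = trans (cong (λ u → ∣ ∁ I ∣ ℕ.+ u ℕ.+ a) (sym (∣─∣-+ I⊆U))) (trans (arrange (∣ ∁ I ∣) (∣ U ─ I ∣) (∣ I ∣) a) (cong (ℕ._+ (∣ U ─ I ∣ ℕ.+ a)) (∣∁∣-+ I)))
      where
      arrange : ∀ c d i a → c ℕ.+ (d ℕ.+ i) ℕ.+ a ≡ (c ℕ.+ i) ℕ.+ (d ℕ.+ a)
      arrange = ℕ-solve-∀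
    go : (d : Dec (NestedPair M₁ M₂ k (I , U))) → 𝕀 s * (𝕀 (independent? M₁ I) * 𝕀 (independent? M₂ U) * A) * (𝕀 (I ⊆? U) * ι (2 ^ ∣ U ─ I ∣)) ≡ A * ι (2 ^ k) * 𝕀 d
    go (yes (indI , indU , I⊆U , refl)) = trans
      (cong₂ _*_ (cong₂ _*_ (𝕀-yes s (trans (size I⊆U) (cong (n ℕ.+_) k+a≡n))) (cong₂ (λ p q → p * q * A) (𝕀-yes (independent? M₁ I) indI) (𝕀-yes (independent? M₂ U) indU))) (cong (_* ι (2 ^ ∣ U ─ I ∣)) (𝕀-yes (I ⊆? U) I⊆U)))
      (solve 2 (λ a b → con 1ℚ :* (con 1ℚ :* con 1ℚ :* a) :* (con 1ℚ :* b) := a :* b :* con 1ℚ) refl A (ι (2 ^ ∣ U ─ I ∣)))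
    go (no ¬nested) = trans (vanish s (independent? M₁ I) (independent? M₂ U) (I ⊆? U)) (sym (*-zeroʳ (A * ι (2 ^ k))))
      where
      B = ι (2 ^ ∣ U ─ I ∣)
      vanish : (s : Dec (∣ ∁ I ∣ ℕ.+ ∣ U ∣ ℕ.+ a ≡ n ℕ.+ n)) (p : Dec (Independent M₁ I)) (q : Dec (Independent M₂ U)) (d : Dec (I ⊆ U)) →
        𝕀 s * (𝕀 p * 𝕀 q * A) * (𝕀 d * B) ≡ 0ℚ
      vanish (no _) p q d = solve 2 (λ x y → con 0ℚ :* x :* y := con 0ℚ) refl (𝕀 p * 𝕀 q * A) (𝕀 d * B)
      vanish s (no _) q d = solve 4 (λ s q a y → s :* (con 0ℚ :* q :* a) :* y := con 0ℚ) refl (𝕀 s) (𝕀 q) A (𝕀 d * B)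
      vanish s p (no _) d = solve 4 (λ s p a y → s :* (p :* con 0ℚ :* a) :* y := con 0ℚ) refl (𝕀 s) (𝕀 p) A (𝕀 d * B)
      vanish s p q (no _) = solve 2 (λ x b → x :* (con 0ℚ :* b) := con 0ℚ) refl (𝕀 s * (𝕀 p * 𝕀 q * A)) B
      vanish (yes e) (yes indI) (yes indU) (yes I⊆U) = ⊥-elim (¬nested (indI , indU , I⊆U ,
        +-cancelʳ-≡ a (∣ U ─ I ∣) k (trans (+-cancelˡ-≡ n (∣ U ─ I ∣ ℕ.+ a) n (trans (sym (size I⊆U)) e)) (sym k+a≡n))))

  Φ-value : ∀ k a → k ℕ.+ a ≡ n → Φ∅ (x̂s n ++ replicate k t̂ ++ replicate a ŷ) ≡ ι (k !) * ι (a !) * ι (2 ^ k) * ι (J M₁ M₂ k)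
  Φ-value k a k+a≡n = begin
    Φ∅ (x̂s n ++ replicate k t̂ ++ replicate a ŷ)
      ≡⟨ Φ-x̂t̂ŷ k a k+a≡n ⟩
    ι (k !) * Σ² (λ I U → K a (∁ I) U * (𝕀 (I ⊆? U) * ι (2 ^ ∣ U ─ I ∣)))
      ≡⟨ cong (ι (k !) *_) (trans (Σ²-cong (nested-term k a k+a≡n)) (Σ²-* (ι (a !) * ι (2 ^ k)) (λ I U → 𝕀 (nestedPair? M₁ M₂ k (I , U))))) ⟩
    ι (k !) * (ι (a !) * ι (2 ^ k) * Σ² (λ I U → 𝕀 (nestedPair? M₁ M₂ k (I , U))))
      ≡⟨ cong (λ j → ι (k !) * (ι (a !) * ι (2 ^ k) * j)) (sym (ι-J M₁ M₂ k)) ⟩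
    ι (k !) * (ι (a !) * ι (2 ^ k) * ι (J M₁ M₂ k))
      ≡⟨ solve 4 (λ k a p j → k :* (a :* p :* j) := k :* a :* p :* j) refl (ι (k !)) (ι (a !)) (ι (2 ^ k)) (ι (J M₁ M₂ k)) ⟩
    ι (k !) * ι (a !) * ι (2 ^ k) * ι (J M₁ M₂ k) ∎
    where open ≡-Reasoning

  -- The factorials left by differentiation satisfy `k ! a ! = n ! / C(n,k)`: up to `n !`, they
  -- perform the division by the binomial coefficient.
  Φ-normalised : ∀ k a → k ℕ.+ a ≡ n → .(k≤n : k ℕ.≤ n) →
    Φ∅ (x̂s n ++ replicate k t̂ ++ replicate a ŷ) ≡ ι (n !) * ι (2 ^ k) * J/C M₁ M₂ k k≤n
  Φ-normalised k a k+a≡n k≤n = trans (Φ-value k a k+a≡n) (trans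
    (cong (ι (k !) * ι (a !) * ι (2 ^ k) *_) (sym (/-*-ι (J M₁ M₂ k) (n choose k) {{nCk-nonZero k≤n}})))
    (trans (solve 5 (λ k a p j c → k :* a :* p :* (j :* c) := c :* (k :* a) :* p :* j) refl (ι (k !)) (ι (a !)) (ι (2 ^ k)) (J/C M₁ M₂ k k≤n) (ι (n choose k)))
      (cong (λ f → f * ι (2 ^ k) * J/C M₁ M₂ k k≤n) (trans (cong (ι (n choose k) *_) (sym (ι-* (k !) (a !)))) (trans (sym (ι-* (n choose k) (k ! ℕ.* a !))) (cong ι (nCk*k!*[n-k]!≡n! {n} {k} {a} k+a≡n)))))))

  Φ∅-shift : ∀ us v ws → Φ∅ (us ++ v ∷ ws) ≡ Φ∅ (v ∷ us ++ ws)
  Φ∅-shift us v ws = trans (cong (λ l → polar l product) (ListP.map-++ diag us (v ∷ ws)))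
    (trans (polar-shift (map diag us) (diag v) (map diag ws) (symmetric product-admissible)) (cong (λ l → polar (diag v ∷ l) product) (sym (ListP.map-++ diag us ws))))

  diag-0≤ : ∀ {v : Vect (suc n)} → NonNeg v → NonNeg (diag v)
  diag-0≤ {v} v≥0 i = go (splitAt (suc n) i)
    where
    go : ∀ s → 0ℚ ≤ Sum.[ v , v ] s
    go (inj₁ a) = v≥0 a
    go (inj₂ b) = v≥0 b

  δ-0≤ : ∀ {m} (i : Fin m) → NonNeg (δ i)
  δ-0≤ zero    zero    = nonNegative⁻¹ 1ℚ
  δ-0≤ zero    (suc j) = ℚP.≤-refl
  δ-0≤ (suc i) zero    = ℚP.≤-refl
  δ-0≤ (suc i) (suc j) = δ-0≤ i j

  t̂-0≤ : NonNeg {suc n} t̂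
  t̂-0≤ zero    = ℚP.≤-refl
  t̂-0≤ (suc e) = nonNegative⁻¹ 1ℚ

  -- All `x̂ e`, `k` copies of `t̂` and `a` copies of `ŷ` stay fixed; filling the two free slots of
  -- Alexandrov-Fenchel with `ŷ ŷ`, `ŷ t̂` or `t̂ t̂` gives the indices `k`, `k + 1` and `k + 2`.
  -- The rest is reordering of derivatives.
  Φ-log-concave : ∀ k a → 2 ℕ.+ k ℕ.+ a ≡ n →
    Φ∅ (x̂s n ++ replicate k t̂ ++ replicate (2 ℕ.+ a) ŷ) * Φ∅ (x̂s n ++ replicate (2 ℕ.+ k) t̂ ++ replicate a ŷ)
      ≤ Φ∅ (x̂s n ++ replicate (1 ℕ.+ k) t̂ ++ replicate (1 ℕ.+ a) ŷ) * Φ∅ (x̂s n ++ replicate (1 ℕ.+ k) t̂ ++ replicate (1 ℕ.+ a) ŷ)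
  Φ-log-concave k a e = subst₂ _≤_ (cong₂ _*_ yy tt′) (cong₂ _*_ yt yt)
    (alexandrov–fenchel {d = d} (subst (λ D → Admissible D product) degree product-admissible) (subst (λ D → Lorentzian D product) degree product-Lorentzian)
      {map diag vs} vs≥0 len (diag ŷ) {diag t̂} (diag-0≤ t̂-0≤))
    where
    T = replicate k t̂
    Y = replicate a ŷ
    E = x̂s n
    vs = E ++ T ++ Y
    d = n ℕ.+ (k ℕ.+ a)
    degree : n ℕ.+ n ≡ 2 ℕ.+ d
    degree = trans (cong (n ℕ.+_) (sym e)) (arrange n k a)
      where
      arrange : ∀ n k a → n ℕ.+ (2 ℕ.+ k ℕ.+ a) ≡ 2 ℕ.+ (n ℕ.+ (k ℕ.+ a))
      arrange = ℕ-solve-∀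
    len : length (map diag vs) ≡ d
    len = trans (ListP.length-map diag vs) (trans (ListP.length-++ E) (cong₂ ℕ._+_ (length-x̂s n)
      (trans (ListP.length-++ T) (cong₂ ℕ._+_ (ListP.length-replicate k) (ListP.length-replicate a)))))
    vs≥0 : All NonNeg (map diag vs)
    vs≥0 = All.map⁺ (All.++⁺ (All.map⁺ (All.universal (λ e → diag-0≤ (δ-0≤ (suc e))) (elements n)))
      (All.++⁺ (All.replicate⁺ k (diag-0≤ t̂-0≤)) (All.replicate⁺ a (diag-0≤ (δ-0≤ zero)))))
    past-T : ∀ v us → Φ∅ (v ∷ E ++ T ++ us) ≡ Φ∅ (E ++ T ++ v ∷ us)
    past-T v us = trans (cong (λ l → Φ∅ (v ∷ l)) (sym (++-assoc E T us)))
      (trans (sym (Φ∅-shift (E ++ T) v us)) (cong Φ∅ (++-assoc E T (v ∷ us))))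
    yy : Φ∅ (ŷ ∷ ŷ ∷ vs) ≡ Φ∅ (E ++ T ++ ŷ ∷ ŷ ∷ Y)
    yy = trans (cong (λ l → Φ∅ (ŷ ∷ ŷ ∷ l)) (sym (++-assoc E T Y)))
      (trans (sym (Φ∅-shift (ŷ ∷ E ++ T) ŷ Y)) (trans (cong (λ l → Φ∅ (ŷ ∷ l)) (++-assoc E T (ŷ ∷ Y))) (past-T ŷ (ŷ ∷ Y))))
    tt′ : Φ∅ (t̂ ∷ t̂ ∷ vs) ≡ Φ∅ (E ++ t̂ ∷ t̂ ∷ T ++ Y)
    tt′ = trans (sym (Φ∅-shift (t̂ ∷ E) t̂ (T ++ Y))) (sym (Φ∅-shift E t̂ (t̂ ∷ T ++ Y)))
    yt : Φ∅ (ŷ ∷ t̂ ∷ vs) ≡ Φ∅ (E ++ t̂ ∷ T ++ ŷ ∷ Y)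
    yt = trans (cong (λ l → Φ∅ (ŷ ∷ t̂ ∷ l)) (sym (++-assoc E T Y)))
      (trans (sym (Φ∅-shift (t̂ ∷ E ++ T) ŷ Y)) (trans (cong (λ l → Φ∅ (t̂ ∷ l)) (++-assoc E T (ŷ ∷ Y))) (sym (Φ∅-shift E t̂ (T ++ ŷ ∷ Y)))))

corollary2 : (n : ℕ) (M₁ M₂ : Matroid n) (k : ℕ) (k+2≤n : 2 ℕ.+ k ℕ.≤ n) →
    J/C M₁ M₂ k (m+n≤o⇒n≤o 2 k+2≤n) * J/C M₁ M₂ (2 ℕ.+ k) k+2≤n
      ≤ J/C M₁ M₂ (1 ℕ.+ k) (m+n≤o⇒n≤o 1 k+2≤n) * J/C M₁ M₂ (1 ℕ.+ k) (m+n≤o⇒n≤o 1 k+2≤n)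
corollary2 n M₁ M₂ k k+2≤n = cancel-≤ (0<* c>0 c>0) (subst₂ _≤_
    (trans (cong₂ _*_ (Φ-normalised k (2 ℕ.+ a) (trans (shift₂ k a) e) (m+n≤o⇒n≤o 2 k+2≤n)) (trans (Φ-normalised (2 ℕ.+ k) a e k+2≤n) (cong (λ p → N * p * j₂) 2^2+k)))
      (solve 5 (λ N t p j₀ j₂ → N :* p :* j₀ :* (N :* (t :* (t :* p)) :* j₂) := N :* (t :* p) :* (N :* (t :* p)) :* (j₀ :* j₂)) refl N (ι 2) P j₀ j₂))
    (trans (cong₂ _*_ middle middle)
      (solve 3 (λ N q j → N :* q :* j :* (N :* q :* j) := N :* q :* (N :* q) :* (j :* j)) refl N (ι 2 * P) j₁))
    (Φ-log-concave k a e))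
  where
  open NestedPairPolynomial M₁ M₂
  a = n ℕ.∸ (2 ℕ.+ k)
  e : 2 ℕ.+ k ℕ.+ a ≡ n
  e = m+[n∸m]≡n k+2≤n
  shift₁ : ∀ k a → 1 ℕ.+ k ℕ.+ (1 ℕ.+ a) ≡ 2 ℕ.+ k ℕ.+ a
  shift₁ = ℕ-solve-∀
  shift₂ : ∀ k a → k ℕ.+ (2 ℕ.+ a) ≡ 2 ℕ.+ k ℕ.+ a
  shift₂ = ℕ-solve-∀
  N P j₀ j₁ j₂ : ℚ
  N = ι (n !)
  P = ι (2 ^ k)
  j₀ = J/C M₁ M₂ k (m+n≤o⇒n≤o 2 k+2≤n)
  j₁ = J/C M₁ M₂ (1 ℕ.+ k) (m+n≤o⇒n≤o 1 k+2≤n)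
  j₂ = J/C M₁ M₂ (2 ℕ.+ k) k+2≤n
  -- Since `2^k · 2^(k+2) = (2^(k+1))²`, both sides carry the same positive factor
  -- `(N * (ι 2 * P))²`, which is cancelled.
  2^2+k : ι (2 ^ (2 ℕ.+ k)) ≡ ι 2 * (ι 2 * P)
  2^2+k = trans (ι-* 2 (2 ^ (1 ℕ.+ k))) (cong (ι 2 *_) (ι-* 2 (2 ^ k)))
  middle : Φ∅ (x̂s n ++ replicate (1 ℕ.+ k) t̂ ++ replicate (1 ℕ.+ a) ŷ) ≡ N * (ι 2 * P) * j₁
  middle = trans (Φ-normalised (1 ℕ.+ k) (1 ℕ.+ a) (trans (shift₁ k a) e) (m+n≤o⇒n≤o 1 k+2≤n)) (cong (λ p → N * p * j₁) (ι-* 2 (2 ^ k)))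
  0<ι2^ : ∀ k → 0ℚ < ι (2 ^ k)
  0<ι2^ zero    = positive⁻¹ 1ℚ
  0<ι2^ (suc k) = subst (0ℚ <_) (sym (ι-* 2 (2 ^ k))) (0<* (0<ι 1) (0<ι2^ k))
  c>0 : 0ℚ < N * (ι 2 * P)
  c>0 = 0<* (0<ι! n) (0<* (0<ι 1) (0<ι2^ k))
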